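{- There exist absolute constants $\mathfrak{k}>0$ and $C_0>0$ such that for every prime number $p$ there exist positive integers $q$ and $a$ with $0<a<q$, $\gcd(a,q)=1$, $q\equiv 0 \pmod p$ and $q\le C_0\, p^{30}$, such that all partial quotients of the continued fraction expansion of $a/q$ are bounded by $\mathfrak{k}$.
   Context: For coprime positive integers $0<a<q$, the rational number $a/q$ is uniquely represented as a regular continued fraction $$\frac{a}{q}=[0;b_1,\dots,b_s]=\cfrac{1}{b_1+\cfrac{1}{b_2+\cdots+\cfrac{1}{b_s}}},\qquad b_s\ge 2,$$ with positive integers $b_1,\dots,b_s$, called the partial quotients of $a/q$. "All partial quotients are bounded by $\mathfrak{k}$" means $b_j\le \mathfrak{k}$ for all $1\le j\le s$. -}

module Defs where

open import Data.Integer.Base using (+_)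
open import Data.List.Base using (List; []; _∷_; last)
open import Data.List.Relation.Unary.All using (All; []; _∷_)
import Data.Maybe.Relation.Unary.Any as Maybe
open import Data.Nat.Base as ℕ using (ℕ; _≤_)
open import Data.Product using (∃; _×_)
open import Data.Rational.Base using (ℚ; 0ℚ; _+_; _/_; 1/_; NonNegative; Positive)
open import Data.Rational.Properties
  using (normalize-pos; pos+nonNeg⇒pos; pos⇒nonZero; pos⇒nonNeg; 1/pos⇒pos)
open import Relation.Binary.PropositionalEquality using (_≡_)

-- ⟦ b₁ , … , bₛ ⟧ = [0; b₁ , … , bₛ ], with the empty fraction equal to 0, so
-- that [0; b] = 1/(b + 0).  The denominators are nonzero because all the
-- partial quotients are positive.
mutual
  ⟦_⟧ : ∀ {bs} → All ℕ.NonZero bs → ℚ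
  ⟦ [] ⟧ = 0ℚ
  ⟦ _∷_ {x = b} b≢0 bs≢0 ⟧ =
    (1/ denominator b bs≢0)
      {{pos⇒nonZero (denominator b bs≢0) {{denominator-pos b bs≢0 b≢0}}}}

  denominator : ∀ {bs} → ℕ → All ℕ.NonZero bs → ℚ
  denominator b bs≢0 = + b / 1 + ⟦ bs≢0 ⟧

  denominator-pos : ∀ {bs} b (bs≢0 : All ℕ.NonZero bs) → ℕ.NonZero b →
                    Positive (denominator b bs≢0)
  denominator-pos b bs≢0 b≢0 =
    pos+nonNeg⇒pos (+ b / 1) {{normalize-pos b 1 {{_}} {{b≢0}}}} ⟦ bs≢0 ⟧ {{⟦⟧-nonNeg bs≢0}}

  ⟦⟧-nonNeg : ∀ {bs} (bs≢0 : All ℕ.NonZero bs) → NonNegative ⟦ bs≢0 ⟧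
  ⟦⟧-nonNeg [] = _
  ⟦⟧-nonNeg (_∷_ {x = b} b≢0 bs≢0) =
    pos⇒nonNeg ⟦ b≢0 ∷ bs≢0 ⟧
      {{1/pos⇒pos (denominator b bs≢0) {{denominator-pos b bs≢0 b≢0}}}}

-- Maybe.Any also makes bs nonempty.
record IsRegularContinuedFraction (x : ℚ) (bs : List ℕ) : Set where
  field
    positive : All ℕ.NonZero bs
    last≥2   : Maybe.Any (2 ≤_) (last bs)
    value    : x ≡ ⟦ positive ⟧

-- A rational strictly between 0 and 1 has exactly one such expansion, so the
-- existential speaks of the partial quotients of x.
PartialQuotientsBoundedBy : ℕ → ℚ → Set
PartialQuotientsBoundedBy k x =
  ∃ λ bs → IsRegularContinuedFraction x bs × All (_≤ k) bs

{-# OPTIONS --safe #-}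

-- For letters in {1, …, k}² let M(w) be the product of the matrices [[1,0],[b₁,1]] [[1,b₂],[0,1]], whose lower right
-- entry D(w) is a denominator with partial quotients at most k.  Telescoping 1 / (g b * g (b + 1)) along the tree of
-- words shows that at least N ^ (2 − ε) words have D(w) ≈ N, with ε → 0 as k → ∞.  Since
-- D(u x vᵀ) = (bottom row of u) M(x) (bottom row of v)ᵀ, it suffices to find u, v, x for which this vanishes modulo p.
--
-- Second moments over all 2 × 2 matrices modulo p show that it vanishes for some u, v ∈ 𝓐 and x ∈ 𝓢 as soon as
-- |𝓐|² |𝓢| exceeds about p⁴, provided that the bottom rows of 𝓐 and the matrices of 𝓢 are pairwise distinct up to
-- scalars modulo p.  Words with D ≤ √p give |𝓐|² = p ^ (2 − ε), so slightly more than p² matrices are needed, which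
-- products x = g h with g of size p and h of size p ^ (1/50) supply.  If two of them agree up to sign modulo p,
-- then g h = ± g′ h′ + p m with m small, and comparing determinants shows that the entries of g′ satisfy a linear
-- relation modulo p with small coefficients.  Few g′ do: for a relation of rank 2 write g′ = w v and intersect the
-- relations on w coming from two different v, which leaves a conic; a relation of rank 1 holds in ℤ
-- and factors as (α c + β d)(α b + γ d) = − α².
module Submission where

import Data.Integer.Properties as ℤ
import Data.Nat.Divisibility as ℕ∣
import Data.Nat.Properties as ℕ
import Data.Nat.Tactic.RingSolver as ℕ
open import Data.List.Base
  using (List; []; _∷_; _++_; map; length; filter; cartesianProduct; foldl; foldr; reverse; [_]; concatMap;
    downFrom; last; upTo)
open import Data.List.Membership.Propositional using (_∈_; find; lose)
open import Data.List.Membership.Propositional.Properties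
  using (∈-map⁺; ∈-map⁻; ∈-++⁺ˡ; ∈-++⁺ʳ; ∈-++⁻; ∈-concatMap⁻; ∈-cartesianProduct⁺; ∈-cartesianProduct⁻;
    ∈-downFrom⁻; ∈-filter⁻; ∈-upTo⁺; ∈-upTo⁻)
open import Data.List.Properties
  using (foldl-++; reverse-foldr; reverse-injective; unfold-reverse; ∷-injective; ∷-injectiveˡ; ∷-injectiveʳ;
    length-map; length-++; length-upTo; length-downFrom; ++-assoc)
open import Data.List.Relation.Unary.All as All using ([]; _∷_; All)
import Data.List.Relation.Unary.All.Properties as All
open import Data.List.Relation.Unary.Any as Any using (here; there; Any; any?)
open import Data.List.Relation.Unary.Unique.Propositional using (Unique)
import Data.List.Relation.Unary.Unique.Propositional.Properties as Unique
open import Data.Nat.Primality using (Prime; euclidsLemma; prime⇒nonZero; prime⇒nonTrivial)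
open import Data.Product using (∃; _×_; _,_; proj₁; proj₂; swap; Σ-syntax)
open import Data.Product.Properties using (,-injective; ≡-dec)
open import Data.Sum.Base using (_⊎_; inj₁; inj₂; [_,_]′)
open import Function.Base using (_∘_; flip)
open import Relation.Binary.Definitions using (DecidableEquality)
open import Relation.Binary.PropositionalEquality hiding ([_])
open import Relation.Nullary using (Dec; does; yes; no; ¬_; contradiction; _×-dec_; _→-dec_; ¬?; decidable-stable)

-- All sizes are powers of t, with p between constant multiples of t⁵⁰⁰⁰. Bounding the letters by k
-- costs a code with denominators near tⁿ a factor of about t^(n/100). The codes of exponents 4500,
-- 500, 100 and twice 2500 thus lose t^(45 + 5 + 1 + 2·25) = t¹⁰¹ together. This loss leaves |𝓐|²
-- times the number of matrices g below p⁴ for every k, and the factor h, worth t²⁰⁰, repays it. The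
-- price of h is that entries of g h exceed p, so different products may agree modulo p. The
-- resulting relations have coefficients of order H², where H is the size of h, so there are about
-- H⁸ of them. A relation of rank 2 may hold for about |𝓤| + |𝓓|² p of the |𝓤| |𝓓| pairs (w , v),
-- hence the saving per relation is about |𝓓|. So H⁸, of order t⁸⁰⁰, must stay below |𝓓|, which is
-- at least t⁹⁹⁵, while |𝓓| p stays below |𝓤|. This explains the split 5000 = 4500 + 500. The
-- exponent 30 leaves much room: the words constructed have D at most p² H, and the bound recorded
-- is p⁶.

-- Finite sums, counting and bounds by fibres.

module FiniteSums where

  open import Data.Bool.Base using (if_then_else_)
  open import Data.List.Relation.Unary.AllPairs using ([]; _∷_)
  open import Data.Nat.Base hiding (_/_)
  open import Data.Nat.Properties
  open import Data.Nat.Tactic.RingSolver using (solve-∀)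
  open import Level using (0ℓ)
  open import Relation.Unary using (Pred; Decidable)

  private variable
    X Y : Set
    P Q : Set

  ∑ : List X → (X → ℕ) → ℕ
  ∑ []       f = 0
  ∑ (x ∷ xs) f = f x + ∑ xs f

  syntax ∑ xs (λ x → e) = ∑[ x ← xs ] e

  ∑-mono : ∀ (xs : List X) {f g} → (∀ x → x ∈ xs → f x ≤ g x) → ∑ xs f ≤ ∑ xs g
  ∑-mono []       h = z≤n
  ∑-mono (x ∷ xs) h = +-mono-≤ (h x (here refl)) (∑-mono xs (λ y m → h y (there m)))

  ∑-cong : ∀ (xs : List X) {f g} → (∀ x → f x ≡ g x) → ∑ xs f ≡ ∑ xs g
  ∑-cong []       h = refl
  ∑-cong (x ∷ xs) h = cong₂ _+_ (h x) (∑-cong xs h)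

  ∑-const : ∀ (xs : List X) n → ∑[ _ ← xs ] n ≡ length xs * n
  ∑-const []       n = refl
  ∑-const (x ∷ xs) n = cong (n +_) (∑-const xs n)

  ∑-≤ : ∀ (xs : List X) {f n} → (∀ x → x ∈ xs → f x ≤ n) → ∑ xs f ≤ length xs * n
  ∑-≤ xs {n = n} h = ≤-trans (∑-mono xs h) (≤-reflexive (∑-const xs n))

  +-interchange : ∀ a b c d → (a + b) + (c + d) ≡ (a + c) + (b + d)
  +-interchange = solve-∀

  ∑-+ : ∀ (xs : List X) (f g : X → ℕ) → ∑[ x ← xs ] (f x + g x) ≡ ∑ xs f + ∑ xs g
  ∑-+ []       f g = refl
  ∑-+ (x ∷ xs) f g =
    trans (cong (f x + g x +_) (∑-+ xs f g)) (+-interchange (f x) (g x) (∑ xs f) (∑ xs g))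

  ∑-*ˡ : ∀ (xs : List X) n (f : X → ℕ) → ∑[ x ← xs ] (n * f x) ≡ n * ∑ xs f
  ∑-*ˡ []       n f = sym (*-zeroʳ n)
  ∑-*ˡ (x ∷ xs) n f = trans (cong (n * f x +_) (∑-*ˡ xs n f)) (sym (*-distribˡ-+ n (f x) _))

  ∑-*ʳ : ∀ (xs : List X) n (f : X → ℕ) → ∑[ x ← xs ] (f x * n) ≡ ∑ xs f * n
  ∑-*ʳ xs n f = trans (∑-cong xs (λ x → *-comm (f x) n)) (trans (∑-*ˡ xs n f) (*-comm n _))

  ∑-swap : ∀ (xs : List X) (ys : List Y) (f : X → Y → ℕ) →
           ∑[ x ← xs ] ∑[ y ← ys ] f x y ≡ ∑[ y ← ys ] ∑[ x ← xs ] f x y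
  ∑-swap []       ys f = sym (trans (∑-const ys 0) (*-zeroʳ (length ys)))
  ∑-swap (x ∷ xs) ys f = trans (cong (∑ ys (f x) +_) (∑-swap xs ys f)) (sym (∑-+ ys (f x) _))

  ∑-++ : ∀ (xs ys : List X) (f : X → ℕ) → ∑ (xs ++ ys) f ≡ ∑ xs f + ∑ ys f
  ∑-++ []       ys f = refl
  ∑-++ (x ∷ xs) ys f = trans (cong (f x +_) (∑-++ xs ys f)) (sym (+-assoc (f x) _ _))

  ∑-map : ∀ (h : X → Y) xs (f : Y → ℕ) → ∑ (map h xs) f ≡ ∑[ x ← xs ] f (h x)
  ∑-map h []       f = refl
  ∑-map h (x ∷ xs) f = cong (f (h x) +_) (∑-map h xs f)

  ∑-cartesianProduct : ∀ (xs : List X) (ys : List Y) (f : X × Y → ℕ) →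
    ∑ (cartesianProduct xs ys) f ≡ ∑[ x ← xs ] ∑[ y ← ys ] f (x , y)
  ∑-cartesianProduct []       ys f = refl
  ∑-cartesianProduct (x ∷ xs) ys f =
    trans (∑-++ (map (x ,_) ys) _ f)
          (cong₂ _+_ (∑-map (x ,_) ys f) (∑-cartesianProduct xs ys f))

  ∑-term : ∀ {xs : List X} {x} (f : X → ℕ) → x ∈ xs → f x ≤ ∑ xs f
  ∑-term f (here refl) = m≤m+n _ _
  ∑-term f (there m)   = ≤-trans (∑-term f m) (m≤n+m _ _)

  𝟙 : Dec P → ℕ
  𝟙 p = if does p then 1 else 0

  𝟙-true : (p : Dec P) → P → 𝟙 p ≡ 1
  𝟙-true (yes _) _ = refl
  𝟙-true (no ¬p) p = contradiction p ¬p

  𝟙-false : (p : Dec P) → ¬ P → 𝟙 p ≡ 0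
  𝟙-false (yes p) ¬p = contradiction p ¬p
  𝟙-false (no _)  _  = refl

  𝟙≤1 : (p : Dec P) → 𝟙 p ≤ 1
  𝟙≤1 (yes _) = s≤s z≤n
  𝟙≤1 (no _)  = z≤n

  𝟙-mono : (p : Dec P) (q : Dec Q) → (P → Q) → 𝟙 p ≤ 𝟙 q
  𝟙-mono (yes p) (yes _) f = s≤s z≤n
  𝟙-mono (yes p) (no ¬q) f = contradiction (f p) ¬q
  𝟙-mono (no _)  _       f = z≤n

  length-filter-∑ : ∀ {P : Pred X 0ℓ} (P? : Decidable P) xs → length (filter P? xs) ≡ ∑[ x ← xs ] 𝟙 (P? x)
  length-filter-∑ P? [] = refl
  length-filter-∑ P? (x ∷ xs) with P? x
  ... | yes _ = cong suc (length-filter-∑ P? xs)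
  ... | no  _ = length-filter-∑ P? xs

  length≡∑1 : ∀ (xs : List X) → length xs ≡ ∑[ _ ← xs ] 1
  length≡∑1 xs = sym (trans (∑-const xs 1) (*-identityʳ _))

  length-cartesianProduct : ∀ (xs : List X) (ys : List Y) → length (cartesianProduct xs ys) ≡ length xs * length ys
  length-cartesianProduct xs ys = trans (length≡∑1 (cartesianProduct xs ys)) (trans (∑-cartesianProduct xs ys (λ _ → 1))
    (trans (∑-cong xs (λ _ → sym (length≡∑1 ys))) (∑-const xs (length ys))))

  module _ {P : Pred X 0ℓ} (P? : Decidable P) where

    count : List X → ℕ
    count xs = ∑[ x ← xs ] 𝟙 (P? x)

    count-none : ∀ {xs} → (∀ {x} → x ∈ xs → ¬ P x) → count xs ≡ 0
    count-none {[]}     h = refl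
    count-none {x ∷ xs} h = cong₂ _+_ (𝟙-false (P? x) (h (here refl))) (count-none (h ∘ there))

    count≤1 : ∀ {xs} → Unique xs → (∀ {x y} → x ∈ xs → y ∈ xs → P x → P y → x ≡ y) → count xs ≤ 1
    count≤1 [] h = z≤n
    count≤1 {x ∷ xs} (x∉ ∷ u) h with P? x
    ... | no _  = count≤1 u (λ i j → h (there i) (there j))
    ... | yes p = s≤s (≤-reflexive (count-none λ i q →
                    All.lookup x∉ i (h (here refl) (there i) p q)))

    count≤2 : ∀ {xs} → Unique xs →
              (∀ {x y z} → x ∈ xs → y ∈ xs → z ∈ xs → P x → P y → P z → x ≡ y ⊎ x ≡ z ⊎ y ≡ z) →
              count xs ≤ 2
    count≤2 [] h = z≤n
    count≤2 {x ∷ xs} (x∉ ∷ u) h with P? x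
    ... | no _  = count≤2 u (λ i j k → h (there i) (there j) (there k))
    ... | yes p = s≤s (count≤1 u λ i j q r → lemma i j (h (here refl) (there i) (there j) p q r))
      where
      lemma : ∀ {y z} → y ∈ xs → z ∈ xs → x ≡ y ⊎ x ≡ z ⊎ y ≡ z → y ≡ z
      lemma i j (inj₁ e)        = contradiction e (All.lookup x∉ i)
      lemma i j (inj₂ (inj₁ e)) = contradiction e (All.lookup x∉ j)
      lemma i j (inj₂ (inj₂ e)) = e

  module _ (_≟_ : DecidableEquality Y) {xs : List X} {ys : List Y} (u : Unique xs)
           (φ : X → Y) (φ∈ : ∀ {x} → x ∈ xs → φ x ∈ ys) where

    private
      -- Double counting: the term at y = φ x of an inner sum already gives `F (φ x)`, and after the
      -- exchange of sums any bound on the fibres of `φ` applies.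
      ∑-fibres : ∀ (F : Y → ℕ) → ∑[ x ← xs ] F (φ x) ≤ ∑[ y ← ys ] (F y * ∑[ x ← xs ] 𝟙 (φ x ≟ y))
      ∑-fibres F = begin
        ∑[ x ← xs ] F (φ x)                                  ≤⟨ ∑-mono xs (λ x i → one x i) ⟩
        ∑[ x ← xs ] ∑[ y ← ys ] (F y * 𝟙 (φ x ≟ y))          ≡⟨ ∑-swap xs ys _ ⟩
        ∑[ y ← ys ] ∑[ x ← xs ] (F y * 𝟙 (φ x ≟ y))          ≡⟨ ∑-cong ys (λ y → ∑-*ˡ xs (F y) _) ⟩
        ∑[ y ← ys ] (F y * ∑[ x ← xs ] 𝟙 (φ x ≟ y))          ∎
        where
        open ≤-Reasoning
        one : ∀ x → x ∈ xs → F (φ x) ≤ ∑[ y ← ys ] (F y * 𝟙 (φ x ≟ y))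
        one x i = ≤-trans
          (≤-reflexive (sym (trans (cong (F (φ x) *_) (𝟙-true (φ x ≟ φ x) refl)) (*-identityʳ _))))
          (∑-term (λ y → F y * 𝟙 (φ x ≟ y)) (φ∈ i))

    ∑-injection : ∀ (F : Y → ℕ) → (∀ {x y} → x ∈ xs → y ∈ xs → φ x ≡ φ y → x ≡ y) →
                  ∑[ x ← xs ] F (φ x) ≤ ∑ ys F
    ∑-injection F inj = ≤-trans (∑-fibres F) (∑-mono ys λ y _ →
      ≤-trans (*-monoʳ-≤ (F y) (count≤1 (λ x → φ x ≟ y) u
                (λ i j p q → inj i j (trans p (sym q)))))
              (≤-reflexive (*-identityʳ (F y))))

    length-injection : (∀ {x y} → x ∈ xs → y ∈ xs → φ x ≡ φ y → x ≡ y) → length xs ≤ length ys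
    length-injection inj = subst₂ _≤_ (sym (length≡∑1 xs)) (sym (length≡∑1 ys)) (∑-injection (λ _ → 1) inj)

    -- The hypothesis speaks of triples because a quadratic congruence yields exactly this: among
    -- three roots, two coincide.
    length-two-to-one :
      (∀ {x y z} → x ∈ xs → y ∈ xs → z ∈ xs → φ x ≡ φ y → φ x ≡ φ z → x ≡ y ⊎ x ≡ z ⊎ y ≡ z) →
      length xs ≤ length ys * 2
    length-two-to-one h = begin
      length xs                                      ≡⟨ length≡∑1 xs ⟩
      ∑[ _ ← xs ] 1                                  ≤⟨ ∑-fibres (λ _ → 1) ⟩
      ∑[ y ← ys ] (1 * ∑[ x ← xs ] 𝟙 (φ x ≟ y))      ≤⟨ ∑-≤ ys (λ y _ → ≤-trans (≤-reflexive (*-identityˡ _))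
        (count≤2 (λ x → φ x ≟ y) u (λ i j k p q r → h i j k (trans p (sym q)) (trans p (sym r))))) ⟩
      length ys * 2                                  ∎
      where open ≤-Reasoning

  -- If P holds at some x₀, all further elements satisfying P pair up with x₀.
  count≤1+pairs : (_≟_ : DecidableEquality X) {P : Pred X 0ℓ} (P? : Decidable P) {xs : List X} → Unique xs →
    ∀ (R : X → X → ℕ) → (∀ {x y} → x ∈ xs → y ∈ xs → x ≢ y → P x → P y → 1 ≤ R x y) →
    count P? xs ≤ 1 + ∑[ x ← xs ] ∑[ y ← xs ] R x y
  count≤1+pairs _≟_ {P} P? {xs} u R h with filter P? xs in eq
  ... | [] = ≤-trans (≤-reflexive (trans (sym (length-filter-∑ P? xs)) (cong length eq))) z≤n
  ... | x₀ ∷ _ = begin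
    count P? xs                                    ≤⟨ ∑-mono xs bound ⟩
    ∑[ y ← xs ] (𝟙 (y ≟ x₀) + R x₀ y)             ≡⟨ ∑-+ xs _ _ ⟩
    count (_≟ x₀) xs + ∑[ y ← xs ] R x₀ y          ≤⟨ +-mono-≤ (count≤1 (_≟ x₀) u λ _ _ p q → trans p (sym q))
                                                              (∑-term (λ x → ∑[ y ← xs ] R x y) (proj₁ m)) ⟩
    1 + ∑[ x ← xs ] ∑[ y ← xs ] R x y              ∎
    where
    open ≤-Reasoning
    m : x₀ ∈ xs × P x₀
    m = ∈-filter⁻ P? {xs = xs} (subst (x₀ ∈_) (sym eq) (here refl))
    bound : ∀ y → y ∈ xs → 𝟙 (P? y) ≤ 𝟙 (y ≟ x₀) + R x₀ y
    bound y i with P? y | y ≟ x₀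
    ... | no _  | _     = z≤n
    ... | yes _ | yes _ = s≤s z≤n
    ... | yes p | no ne = h (proj₁ m) i (ne ∘ sym) (proj₂ m) p

  -- Union bound over the labels `ys`: an element that is not good is charged to a label that
  -- witnesses it.
  length-good : {G : X → Set} (good? : Decidable G) {B : Y → X → Set} (bad? : ∀ y x → Dec (B y x)) (xs : List X) (ys : List Y) →
    (∀ {x} → x ∈ xs → ¬ G x → ∃ λ y → y ∈ ys × B y x) →
    length xs ≤ length (filter good? xs) + ∑[ y ← ys ] count (bad? y) xs
  length-good good? bad? xs ys h = begin
    length xs                                                        ≡⟨ length≡∑1 xs ⟩
    ∑[ _ ← xs ] 1                                                    ≤⟨ ∑-mono xs pointwise ⟩
    ∑[ x ← xs ] (𝟙 (good? x) + ∑[ y ← ys ] 𝟙 (bad? y x))             ≡⟨ ∑-+ xs (λ x → 𝟙 (good? x)) _ ⟩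
    count good? xs + ∑[ x ← xs ] ∑[ y ← ys ] 𝟙 (bad? y x)            ≡⟨ cong₂ _+_ (sym (length-filter-∑ good? xs)) (∑-swap xs ys (λ x y → 𝟙 (bad? y x))) ⟩
    length (filter good? xs) + ∑[ y ← ys ] count (bad? y) xs         ∎
    where
    open ≤-Reasoning
    pointwise : ∀ x → x ∈ xs → 1 ≤ 𝟙 (good? x) + ∑[ y ← ys ] 𝟙 (bad? y x)
    pointwise x i with good? x
    ... | yes _ = s≤s z≤n
    ... | no ¬g with h i ¬g
    ... | y , y∈ , b = ≤-trans (≤-reflexive (sym (𝟙-true (bad? y x) b))) (∑-term (λ y → 𝟙 (bad? y x)) y∈)

-- Words, their matrices, and recovery of a word from its bottom row.

module Words where

  import Data.List.Relation.Unary.Any.Properties as Any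
  open import Data.Nat.Base hiding (_/_)
  open import Data.Nat.DivMod using (_%_; [m+kn]%n≡m%n; m<n⇒m%n≡m)
  open import Data.Nat.Properties
  open import Data.Nat.Tactic.RingSolver using (solve-∀)

  All-reverse : ∀ {X : Set} {P : X → Set} {xs} → All P xs → All P (reverse xs)
  All-reverse ps = All.tabulate (λ i → All.lookup ps (Any.reverse⁻ i))

  Word : Set
  Word = List (ℕ × ℕ)

  -- Right multiplication of a row vector by [[1,0],[b₁,1]] · [[1,b₂],[0,1]].
  step : ℕ × ℕ → ℕ × ℕ → ℕ × ℕ
  step (x , y) (b₁ , b₂) = x + b₁ * y , y + b₂ * (x + b₁ * y)

  run : ℕ × ℕ → Word → ℕ × ℕ
  run = foldl step

  top bottom : Word → ℕ × ℕ
  top    = run (1 , 0)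
  bottom = run (0 , 1)

  A B C D : Word → ℕ
  A w = proj₁ (top w)
  B w = proj₂ (top w)
  C w = proj₁ (bottom w)
  D w = proj₂ (bottom w)

  run-linear : ∀ x y s t w →
    run (x * proj₁ s + y * proj₁ t , x * proj₂ s + y * proj₂ t) w ≡
    (x * proj₁ (run s w) + y * proj₁ (run t w) , x * proj₂ (run s w) + y * proj₂ (run t w))
  run-linear x y s t [] = refl
  run-linear x y s t ((b₁ , b₂) ∷ w) = trans
    (cong (λ u → run u w) (cong₂ _,_ (eq₁ x y (proj₁ s) (proj₂ s) (proj₁ t) (proj₂ t) b₁)
                                     (eq₂ x y (proj₁ s) (proj₂ s) (proj₁ t) (proj₂ t) b₁ b₂)))
    (run-linear x y (step s (b₁ , b₂)) (step t (b₁ , b₂)) w)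
    where
    eq₁ : ∀ x y s s′ t t′ b → (x * s + y * t) + b * (x * s′ + y * t′) ≡ x * (s + b * s′) + y * (t + b * t′)
    eq₁ = solve-∀
    eq₂ : ∀ x y s s′ t t′ b c →
      (x * s′ + y * t′) + c * ((x * s + y * t) + b * (x * s′ + y * t′)) ≡
      x * (s′ + c * (s + b * s′)) + y * (t′ + c * (t + b * t′))
    eq₂ = solve-∀

  run-matrix : ∀ s w → run s w ≡
    (proj₁ s * A w + proj₂ s * C w , proj₁ s * B w + proj₂ s * D w)
  run-matrix (x , y) w = trans (cong (λ u → run u w) (cong₂ _,_ (eq₁ x y) (eq₂ x y))) (run-linear x y (1 , 0) (0 , 1) w)
    where
    eq₁ : ∀ x y → x ≡ x * 1 + y * 0
    eq₁ = solve-∀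
    eq₂ : ∀ x y → y ≡ x * 0 + y * 1
    eq₂ = solve-∀

  module _ (w v : Word) where

    A-++ : A (w ++ v) ≡ A w * A v + B w * C v
    A-++ = cong proj₁ (trans (foldl-++ step (1 , 0) w v) (run-matrix (top w) v))

    B-++ : B (w ++ v) ≡ A w * B v + B w * D v
    B-++ = cong proj₂ (trans (foldl-++ step (1 , 0) w v) (run-matrix (top w) v))

    C-++ : C (w ++ v) ≡ C w * A v + D w * C v
    C-++ = cong proj₁ (trans (foldl-++ step (0 , 1) w v) (run-matrix (bottom w) v))

    D-++ : D (w ++ v) ≡ C w * B v + D w * D v
    D-++ = cong proj₂ (trans (foldl-++ step (0 , 1) w v) (run-matrix (bottom w) v))

  -- Both factors of a letter are elementary matrices of determinant 1. The determinant appears as a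
  -- sum because the entries are natural numbers.
  det-run : ∀ n s t w → proj₁ s * proj₂ t ≡ n + proj₂ s * proj₁ t →
    proj₁ (run s w) * proj₂ (run t w) ≡ n + proj₂ (run s w) * proj₁ (run t w)
  det-run n s t [] h = h
  det-run n (a , b) (c , d) ((l , m) ∷ w) h = det-run n (step (a , b) (l , m)) (step (c , d) (l , m)) w (begin
    (a + l * b) * (d + m * (c + l * d))                               ≡⟨ expandˡ a b c d l m ⟩
    a * d + (l * (b * d) + m * ((a + l * b) * (c + l * d)))           ≡⟨ cong (_+ (l * (b * d) + m * ((a + l * b) * (c + l * d)))) h ⟩
    n + b * c + (l * (b * d) + m * ((a + l * b) * (c + l * d)))       ≡⟨ expandʳ n a b c d l m ⟨
    n + (b + m * (a + l * b)) * (c + l * d)                           ∎)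
    where
    open ≡-Reasoning
    expandˡ : ∀ a b c d l m →
      (a + l * b) * (d + m * (c + l * d)) ≡ a * d + (l * (b * d) + m * ((a + l * b) * (c + l * d)))
    expandˡ = solve-∀
    expandʳ : ∀ n a b c d l m →
      n + (b + m * (a + l * b)) * (c + l * d) ≡ n + b * c + (l * (b * d) + m * ((a + l * b) * (c + l * d)))
    expandʳ = solve-∀

  det : ∀ w → A w * D w ≡ 1 + B w * C w
  det w = det-run 1 (1 , 0) (0 , 1) w refl

  Letter : ℕ → ℕ × ℕ → Set
  Letter k (b₁ , b₂) = (1 ≤ b₁ × b₁ ≤ k) × (1 ≤ b₂ × b₂ ≤ k)

  Positive : ℕ × ℕ → Set
  Positive (b₁ , b₂) = 1 ≤ b₁ × 1 ≤ b₂

  Letter⇒Positive : ∀ {k l} → Letter k l → Positive l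
  Letter⇒Positive ((p , _) , (q , _)) = p , q

  -- Entrywise domination of the top row by the bottom row fails for the empty word, since 1 > 0 in
  -- the first column. Comparing the row sums instead gives an invariant: the new first entry a + (l
  -- + 1) b is (a + b) + l b, and both summands are controlled.
  record Dominated (s t : ℕ × ℕ) : Set where
    constructor dominated
    field
      a≤d     : proj₁ s ≤ proj₂ t
      b≤d     : proj₂ s ≤ proj₂ t
      c<d     : proj₁ t < proj₂ t
      a+b≤c+d : proj₁ s + proj₂ s ≤ proj₁ t + proj₂ t

  step-c<d : ∀ t {l} → Positive l → proj₁ t < proj₂ t → proj₁ (step t l) < proj₂ (step t l)
  step-c<d (c , d) {l₁ , suc m} _ c<d = begin-strict
    c + l₁ * d                         <⟨ m<n+m _ (≤-<-trans z≤n c<d) ⟩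
    d + (c + l₁ * d)                   ≤⟨ +-monoʳ-≤ d (m≤m+n _ (m * (c + l₁ * d))) ⟩
    d + suc m * (c + l₁ * d)           ∎
    where open ≤-Reasoning

  Dominated-step : ∀ s t {l} → Positive l → Dominated s t → Dominated (step s l) (step t l)
  Dominated-step (a , b) (c , d) {suc l , suc m} pos (dominated a≤d b≤d c<d a+b≤c+d) = dominated
    (≤-trans a′≤c′ (<⇒≤ c′<d′)) b′≤d′ c′<d′ (+-mono-≤ a′≤c′ b′≤d′)
    where
    a′≤c′ : a + suc l * b ≤ c + suc l * d
    a′≤c′ = begin
      a + (b + l * b)    ≡⟨ +-assoc a b _ ⟨
      a + b + l * b      ≤⟨ +-mono-≤ a+b≤c+d (*-monoʳ-≤ l b≤d) ⟩
      c + d + l * d      ≡⟨ +-assoc c d _ ⟩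
      c + (d + l * d)    ∎
      where open ≤-Reasoning
    b′≤d′ = +-mono-≤ b≤d (*-monoʳ-≤ (suc m) a′≤c′)
    c′<d′ = step-c<d (c , d) {suc l , suc m} pos c<d

  run-Dominated : ∀ s t {w} → All Positive w → Dominated s t → Dominated (run s w) (run t w)
  run-Dominated s t []       h = h
  run-Dominated s t {l ∷ w} (p ∷ ps) h = run-Dominated (step s l) (step t l) ps (Dominated-step s t {l} p h)

  word-Dominated : ∀ {w} → All Positive w → Dominated (top w) (bottom w)
  word-Dominated ps = run-Dominated (1 , 0) (0 , 1) ps (dominated ≤-refl z≤n (s≤s z≤n) ≤-refl)

  D>0 : ∀ {w} → All Positive w → 0 < D w
  D>0 ps = ≤-<-trans z≤n (Dominated.c<d (word-Dominated ps))

  C<D : ∀ {w} → All Positive w → C w < D w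
  C<D ps = Dominated.c<d (word-Dominated ps)

  B≤D : ∀ {w} → All Positive w → B w ≤ D w
  B≤D ps = Dominated.b≤d (word-Dominated ps)

  A≤D : ∀ {w} → All Positive w → A w ≤ D w
  A≤D ps = Dominated.a≤d (word-Dominated ps)

  D-++-≤ : ∀ {w v} → All Positive w → All Positive v → D (w ++ v) ≤ 2 * (D w * D v)
  D-++-≤ {w} {v} p q = begin
    D (w ++ v)                  ≡⟨ D-++ w v ⟩
    C w * B v + D w * D v       ≤⟨ +-monoˡ-≤ _ (*-mono-≤ (<⇒≤ (C<D p)) (B≤D q)) ⟩
    D w * D v + D w * D v       ≡⟨ cong (D w * D v +_) (+-identityʳ _) ⟨
    2 * (D w * D v)             ∎
    where open ≤-Reasoning

  quotient-unique : ∀ {n r r′} q q′ → r < n → r′ < n → r + q * n ≡ r′ + q′ * n → r ≡ r′ × q ≡ q′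
  quotient-unique {suc n} {r} {r′} q q′ r<n r′<n eq = r≡r′ ,
    *-cancelʳ-≡ q q′ (suc n) (+-cancelˡ-≡ r _ _ (trans eq (cong (_+ q′ * suc n) (sym r≡r′))))
    where
    open ≡-Reasoning
    r≡r′ : r ≡ r′
    r≡r′ = begin
      r                          ≡⟨ m<n⇒m%n≡m r<n ⟨
      r % suc n                  ≡⟨ [m+kn]%n≡m%n r q (suc n) ⟨
      (r + q * suc n) % suc n    ≡⟨ cong (_% suc n) eq ⟩
      (r′ + q′ * suc n) % suc n  ≡⟨ [m+kn]%n≡m%n r′ q′ (suc n) ⟩
      r′ % suc n                 ≡⟨ m<n⇒m%n≡m r′<n ⟩
      r′                         ∎

  -- Euclid's algorithm: the old row and the letter are the remainders and quotients of two
  -- divisions of the new row.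
  step-injective : ∀ {s t l m} → Positive l → Positive m → proj₁ s < proj₂ s → proj₁ t < proj₂ t →
                   step s l ≡ step t m → s ≡ t × l ≡ m
  step-injective {c , suc d} {e , suc f} {suc l , l′} {suc m , m′} _ _ c<d e<f eq
    with ,-injective eq
  -- The old second entry lies between 1 and the new first entry and may equal it, so its
  -- predecessor serves as the remainder.
  ... | eq₁ , eq₂ with quotient-unique l′ m′ (d< c d l)
                        (subst (f <_) (sym eq₁) (d< e f m))
                        (suc-injective (trans eq₂ (cong (λ z → suc f + m′ * z) (sym eq₁))))
    where
    d< : ∀ c d l → d < c + suc l * suc d
    d< c d l = ≤-trans (m≤m+n (suc d) (l * suc d)) (m≤n+m _ c)
  ... | refl , refl with quotient-unique (suc l) (suc m) c<d e<f eq₁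
  ... | refl , refl = refl , refl

  private
    -- On the reversed word the head is the letter applied last, which is the one that division with
    -- remainder recovers; induction can then peel letters off the front.
    runʳ : Word → ℕ × ℕ
    runʳ = foldr (flip step) (0 , 1)

    runʳ-c<d : ∀ {w} → All Positive w → proj₁ (runʳ w) < proj₂ (runʳ w)
    runʳ-c<d []             = s≤s z≤n
    runʳ-c<d {_ ∷ w} (p ∷ ps) = step-c<d (runʳ w) p (runʳ-c<d ps)

    runʳ-c>0 : ∀ {l w} → All Positive (l ∷ w) → 0 < proj₁ (runʳ (l ∷ w))
    runʳ-c>0 {suc l , _} {w} (_ ∷ ps) = begin
      1                                                ≤⟨ ≤-<-trans z≤n (runʳ-c<d ps) ⟩
      proj₂ (runʳ w)                                   ≤⟨ m≤m+n _ _ ⟩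
      suc l * proj₂ (runʳ w)                           ≤⟨ m≤n+m _ (proj₁ (runʳ w)) ⟩
      proj₁ (runʳ w) + suc l * proj₂ (runʳ w)          ∎
      where open ≤-Reasoning

    runʳ-injective : ∀ {w v} → All Positive w → All Positive v → runʳ w ≡ runʳ v → w ≡ v
    runʳ-injective {[]}    {[]}    _ _ _ = refl
    runʳ-injective {[]}    {l ∷ v} _ q eq = contradiction (cong proj₁ eq) (<⇒≢ (runʳ-c>0 q))
    runʳ-injective {l ∷ w} {[]}    p _ eq = contradiction (cong proj₁ (sym eq)) (<⇒≢ (runʳ-c>0 p))
    runʳ-injective {l ∷ w} {m ∷ v} (p ∷ ps) (q ∷ qs) eq
      with step-injective {runʳ w} {runʳ v} p q (runʳ-c<d ps) (runʳ-c<d qs) eq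
    ... | eq′ , refl = cong (l ∷_) (runʳ-injective ps qs eq′)

  bottom-injective : ∀ {w v} → All Positive w → All Positive v → bottom w ≡ bottom v → w ≡ v
  bottom-injective {w} {v} p q eq = reverse-injective (runʳ-injective (All-reverse p) (All-reverse q)
    (trans (reverse-foldr (flip step) (0 , 1) w) (trans eq (sym (reverse-foldr (flip step) (0 , 1) v)))))

  -- If C were 0, the determinant would force D = 1, which is the bottom row of the empty word.
  C>0 : ∀ {l w} → All Positive (l ∷ w) → 0 < C (l ∷ w)
  C>0 {l} {w} p = n≢0⇒n>0 λ C≡0 → contradiction (bottom-injective p [] (cong₂ _,_ C≡0 (D≡1 C≡0))) λ ()
    where
    D≡1 : C (l ∷ w) ≡ 0 → D (l ∷ w) ≡ 1
    D≡1 C≡0 = m*n≡1⇒n≡1 (A (l ∷ w)) _ (trans (det (l ∷ w))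
      (cong suc (trans (cong (B (l ∷ w) *_) C≡0) (*-zeroʳ (B (l ∷ w))))))

  -- The transpose of [[1,0],[b₁,1]] [[1,b₂],[0,1]] is [[1,0],[b₂,1]] [[1,b₁],[0,1]], so reversing a
  -- word and swapping its letters transposes the matrix.
  transpose : Word → Word
  transpose w = reverse (map swap w)

  transpose-∷ : ∀ l w → transpose (l ∷ w) ≡ transpose w ++ [ swap l ]
  transpose-∷ l w = unfold-reverse (swap l) (map swap w)

  record Transposed (w v : Word) : Set where
    constructor transposed
    field
      A≡ : A v ≡ A w
      B≡ : B v ≡ C w
      C≡ : C v ≡ B w
      D≡ : D v ≡ D w

  transpose-Transposed : ∀ w → Transposed w (transpose w)
  transpose-Transposed [] = transposed refl refl refl refl
  transpose-Transposed (l ∷ w) rewrite transpose-∷ l w =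
    transposed
      (trans (A-++ v [ swap l ]) (trans (cong₂ (λ x y → x * A [ swap l ] + y * C [ swap l ]) A≡ B≡)
        (trans (eqA (A w) (C w) (proj₁ l) (proj₂ l)) (sym (A-++ [ l ] w)))))
      (trans (B-++ v [ swap l ]) (trans (cong₂ (λ x y → x * B [ swap l ] + y * D [ swap l ]) A≡ B≡)
        (trans (eqB (A w) (C w) (proj₁ l) (proj₂ l)) (sym (C-++ [ l ] w)))))
      (trans (C-++ v [ swap l ]) (trans (cong₂ (λ x y → x * A [ swap l ] + y * C [ swap l ]) C≡ D≡)
        (trans (eqA (B w) (D w) (proj₁ l) (proj₂ l)) (sym (B-++ [ l ] w)))))
      (trans (D-++ v [ swap l ]) (trans (cong₂ (λ x y → x * B [ swap l ] + y * D [ swap l ]) C≡ D≡)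
        (trans (eqB (B w) (D w) (proj₁ l) (proj₂ l)) (sym (D-++ [ l ] w)))))
    where
    v = transpose w
    open Transposed (transpose-Transposed w)
    eqA : ∀ a c l m → a * (1 + m * 0) + c * (0 + m * 1) ≡ (1 + l * 0) * a + (0 + m * (1 + l * 0)) * c
    eqA = solve-∀
    eqB : ∀ a c l m → a * (0 + l * (1 + m * 0)) + c * (1 + l * (0 + m * 1)) ≡ (0 + l * 1) * a + (1 + m * (0 + l * 1)) * c
    eqB = solve-∀

  transpose-All : ∀ {P : ℕ × ℕ → Set} {w} → All (λ l → P (swap l)) w → All P (transpose w)
  transpose-All h = All-reverse (All.map⁺ h)

-- Prefix codes of words with denominators near N, and their cardinality.

module PrefixCodes where

  open FiniteSums
  open Words
  open import Data.List.Relation.Binary.Disjoint.Propositional using (Disjoint)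
  open import Data.List.Relation.Unary.AllPairs as AllPairs using ([]; _∷_)
  import Data.List.Relation.Unary.AllPairs.Properties as AllPairs
  open import Data.Nat.Base hiding (_/_)
  open import Data.Nat.Properties
  open import Data.Nat.Tactic.RingSolver using (solve-∀)

  range : ℕ → List ℕ
  range k = map suc (downFrom k)

  ∈-range⁻ : ∀ {k b} → b ∈ range k → 1 ≤ b × b ≤ k
  ∈-range⁻ m with ∈-map⁻ suc m
  ... | b , b∈ , refl = s≤s z≤n , ∈-downFrom⁻ b∈

  letters : ℕ → List (ℕ × ℕ)
  letters k = cartesianProduct (range k) (range k)

  letters-Letter : ∀ {k l} → l ∈ letters k → Letter k l
  letters-Letter {k} m with ∈-cartesianProduct⁻ (range k) (range k) m
  ... | i , j = ∈-range⁻ i , ∈-range⁻ j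

  letters-unique : ∀ k → Unique (letters k)
  letters-unique k = Unique.cartesianProduct⁺ u u
    where u = Unique.map⁺ suc-injective (Unique.downFrom⁺ k)

  -- ∑_{b ≤ k} 1 / (g b * g (b + 1)) = k / (g 1 * g (k + 1)) for g b = y + b x.
  telescope : ∀ (n : ℕ → ℕ) x y M k → 0 < x →
    (∀ b → 1 ≤ b → b ≤ k → M ≤ n b * ((y + b * x) * (y + suc b * x))) →
    k * M ≤ ∑ (range k) n * ((y + x) * (y + suc k * x))
  telescope n x y M zero    x>0 h = z≤n
  telescope n x y M (suc j) x>0 h = *-cancelˡ-≤ g {{>-nonZero g>0}} (begin
    g * (suc j * M)                                             ≡⟨ eq₁ x y j M ⟩
    (j * M) * (y + suc (suc j) * x) + M * (y + x)               ≤⟨ +-mono-≤ (*-monoˡ-≤ _ ih) (*-monoˡ-≤ (y + x) (h (suc j) (s≤s z≤n) ≤-refl)) ⟩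
    (S * ((y + x) * g)) * g′ + (n (suc j) * (g * g′)) * (y + x) ≡⟨ eq₂ S (y + x) g g′ (n (suc j)) ⟩
    g * ((n (suc j) + S) * ((y + x) * g′))                      ∎)
    where
    open ≤-Reasoning
    S = ∑ (range j) n
    g = y + suc j * x
    g′ = y + suc (suc j) * x
    g>0 : 0 < g
    g>0 = ≤-trans x>0 (≤-trans (m≤m+n x (j * x)) (m≤n+m _ y))
    ih = telescope n x y M j x>0 (λ b p q → h b p (m≤n⇒m≤1+n q))
    eq₁ : ∀ x y j M → (y + (x + j * x)) * (M + j * M) ≡ (j * M) * (y + (x + (x + j * x))) + M * (y + x)
    eq₁ = solve-∀
    eq₂ : ∀ S u g g′ m → (S * (u * g)) * g′ + (m * (g * g′)) * u ≡ g * ((m + S) * (u * g′))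
    eq₂ = solve-∀

  -- Since y ≤ x, the last value y + (k + 1) x is at most (k + 2) x. Stopping the sum at k therefore
  -- costs only the factor k / (k + 2) against the full sum 1 / (x (x + y)).
  telescope-≤ : ∀ (n : ℕ → ℕ) x y M k → 0 < x → y ≤ x →
    (∀ b → 1 ≤ b → b ≤ k → M ≤ n b * ((y + b * x) * (y + suc b * x))) →
    M * k ≤ ∑ (range k) n * (x * (x + y)) * (k + 2)
  telescope-≤ n x y M k x>0 y≤x h = begin
    M * k                                             ≡⟨ *-comm M k ⟩
    k * M                                             ≤⟨ telescope n x y M k x>0 h ⟩
    ∑ (range k) n * ((y + x) * (y + suc k * x))       ≤⟨ *-monoʳ-≤ S (*-monoʳ-≤ (y + x) (+-monoˡ-≤ _ y≤x)) ⟩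
    S * ((y + x) * (x + suc k * x))                   ≡⟨ eq S x y k ⟩
    S * (x * (x + y)) * (k + 2)                       ∎
    where
    open ≤-Reasoning
    S = ∑ (range k) n
    eq : ∀ S x y k → S * ((y + x) * (x + (x + k * x))) ≡ S * (x * (x + y)) * (k + 2)
    eq = solve-∀

  length-concatMap : ∀ {X Y : Set} (g : X → List Y) xs → length (concatMap g xs) ≡ ∑[ x ← xs ] length (g x)
  length-concatMap g []       = refl
  length-concatMap g (x ∷ xs) = trans (length-++ (g x)) (cong (length (g x) +_) (length-concatMap g xs))

  module _ (N k : ℕ) where

    -- A word is cut off as soon as the denominator reaches N, which makes the words a prefix code.
    -- The first argument bounds the depth; branches that exhaust it are dropped, which does not
    -- happen when N ≤ 2 ^ f * d at the start.
    leaves : ℕ → ℕ × ℕ → List Word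
    leaves f s with N ≤? proj₂ s
    leaves f       s | yes _ = [ [] ]
    leaves zero    s | no _  = []
    leaves (suc f) s | no _  = concatMap (λ l → map (l ∷_) (leaves f (step s l))) (letters k)

    data Leaf : ℕ × ℕ → Word → Set where
      stop : ∀ {s} → N ≤ proj₂ s → Leaf s []
      next : ∀ {s l w} → proj₂ s < N → Letter k l → Leaf (step s l) w → Leaf s (l ∷ w)

    leaves-Leaf : ∀ f s {w} → w ∈ leaves f s → Leaf s w
    leaves-Leaf f s m with N ≤? proj₂ s
    leaves-Leaf f       s (here refl) | yes p = stop p
    leaves-Leaf (suc f) s m           | no ¬p with find (∈-concatMap⁻ _ {xs = letters k} m)
    ... | l , l∈ , m′ with ∈-map⁻ (l ∷_) m′
    ... | w , w∈ , refl = next (≰⇒> ¬p) (letters-Letter l∈) (leaves-Leaf f (step s l) w∈)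

    Leaf-Letters : ∀ {s w} → Leaf s w → All (Letter k) w
    Leaf-Letters (stop _)      = []
    Leaf-Letters (next _ p lw) = p ∷ Leaf-Letters lw

    Leaf-prefix-free : ∀ {s w v x y} → Leaf s w → Leaf s v → w ++ x ≡ v ++ y → w ≡ v × x ≡ y
    Leaf-prefix-free (stop _) (stop _) eq = refl , eq
    Leaf-prefix-free (stop p) (next q _ _) eq = contradiction p (<⇒≱ q)
    Leaf-prefix-free (next q _ _) (stop p) eq = contradiction p (<⇒≱ q)
    Leaf-prefix-free (next _ _ lw) (next _ _ lv) eq with ∷-injective eq
    ... | refl , eq′ with Leaf-prefix-free lw lv eq′
    ... | refl , eq″ = refl , eq″

    -- The denominator is below N before the last letter, and one letter multiplies it by at most (k
    -- + 1)².
    Leaf-bound : ∀ {s w} → Leaf s w → proj₁ s ≤ proj₂ s → proj₂ s < suc k * suc k * N →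
                 proj₂ (run s w) < suc k * suc k * N
    Leaf-bound (stop _) c≤d d< = d<
    Leaf-bound {c , d} (next {l = b₁ , b₂} d<N pos@((1≤b₁ , b₁≤k) , 1≤b₂ , b₂≤k) lw) c≤d d< =
      Leaf-bound lw c′≤d′ (begin-strict
        d + b₂ * (c + b₁ * d)    ≤⟨ +-monoʳ-≤ d (*-mono-≤ b₂≤k (+-mono-≤ c≤d (*-monoˡ-≤ d b₁≤k))) ⟩
        d + k * (d + k * d)      ≤⟨ m≤m+n _ (k * d) ⟩
        d + k * (d + k * d) + k * d ≡⟨ eq d k ⟩
        suc k * suc k * d        <⟨ *-monoʳ-< (suc k * suc k) d<N ⟩
        suc k * suc k * N        ∎)
      where
      open ≤-Reasoning
      eq : ∀ d k → d + k * (d + k * d) + k * d ≡ (1 + k) * (1 + k) * d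
      eq = solve-∀
      c′≤d′ : c + b₁ * d ≤ d + b₂ * (c + b₁ * d)
      c′≤d′ = ≤-trans (≤-trans (≤-reflexive (sym (*-identityˡ _))) (*-monoˡ-≤ _ 1≤b₂)) (m≤n+m _ d)

    leaves-unique : ∀ f s → Unique (leaves f s)
    leaves-unique f s with N ≤? proj₂ s
    leaves-unique f       s | yes _ = [] ∷ []
    leaves-unique zero    s | no _  = []
    leaves-unique (suc f) s | no _  = Unique.concat⁺
      (All.map⁺ (All.tabulate λ {l} _ → Unique.map⁺ ∷-injectiveʳ (leaves-unique f (step s l))))
      (AllPairs.map⁺ (AllPairs.map disjoint (letters-unique k)))
      where
      disjoint : ∀ {l m} → l ≢ m → Disjoint (map (l ∷_) (leaves f (step s l))) (map (m ∷_) (leaves f (step s m)))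
      disjoint {l} {m} l≢m (i , j) with ∈-map⁻ (l ∷_) i | ∈-map⁻ (m ∷_) j
      ... | _ , _ , refl | _ , _ , eq = l≢m (∷-injectiveˡ eq)

    -- The weight 1 / (d (d + c)) is the length of the interval of continued fractions with a given
    -- beginning. With unbounded letters it would be preserved from a node to its children; letters
    -- up to k keep at least (k / (k + 2))² of it at each level. A leaf weighs at most 1 / N², so
    -- the weight of the root counts the leaves.
    length-leaves : ∀ f c d → 0 < d → c ≤ d → N ≤ 2 ^ f * d →
      N * N * k ^ (f + f) ≤ length (leaves f (c , d)) * (d * (d + c)) * (k + 2) ^ (f + f)
    length-leaves f c d d>0 c≤d N≤ with N ≤? d
    ... | yes N≤d = *-mono-≤ (begin
            N * N              ≤⟨ *-mono-≤ N≤d (≤-trans N≤d (m≤m+n d c)) ⟩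
            d * (d + c)        ≡⟨ +-identityʳ _ ⟨
            1 * (d * (d + c))  ∎)
            (^-monoˡ-≤ (f + f) (m≤m+n k 2))
      where open ≤-Reasoning
    length-leaves zero    c d d>0 c≤d N≤ | no N≰d = contradiction (≤-trans N≤ (≤-reflexive (+-identityʳ d))) N≰d
    length-leaves (suc f) c d d>0 c≤d N≤ | no N≰d = begin
      N * N * k ^ (suc f + suc f)                   ≡⟨ trans (cong (N * N *_) (pow-eq k)) (reassoc (N * N) (k ^ (f + f)) k) ⟩
      -- A letter is two partial quotients, hence two telescoping sums: over b₁ with increment d
      -- here, and over b₂ with increment c + b₁ d inside `outer`.
      N * N * k ^ (f + f) * k * k                   ≤⟨ telescope-≤ (λ b₁ → T b₁ * (k + 2) ^ (f + f) * (k + 2)) d c _ k d>0 c≤d outer ⟩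
      ∑ (range k) (λ b₁ → T b₁ * (k + 2) ^ (f + f) * (k + 2)) * (d * (d + c)) * (k + 2)
        ≡⟨ cong (λ z → z * (d * (d + c)) * (k + 2)) (trans (∑-*ʳ (range k) (k + 2) _) (cong (_* (k + 2)) (∑-*ʳ (range k) _ T))) ⟩
      ∑ (range k) T * (k + 2) ^ (f + f) * (k + 2) * (d * (d + c)) * (k + 2)
        ≡⟨ regroup (∑ (range k) T) ((k + 2) ^ (f + f)) (k + 2) (d * (d + c)) ⟩
      ∑ (range k) T * (d * (d + c)) * ((k + 2) ^ (f + f) * (k + 2) * (k + 2))
        ≡⟨ cong₂ (λ z u → z * (d * (d + c)) * u) (sym total) (sym (pow-eq (k + 2))) ⟩
      length (concatMap (λ l → map (l ∷_) (leaves f (step (c , d) l))) (letters k)) * (d * (d + c)) * (k + 2) ^ (suc f + suc f) ∎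
      where
      open ≤-Reasoning
      L : ℕ → ℕ → ℕ
      L b₁ b₂ = length (leaves f (step (c , d) (b₁ , b₂)))
      T : ℕ → ℕ
      T b₁ = ∑ (range k) (L b₁)
      pow-eq : ∀ n → n ^ (suc f + suc f) ≡ n ^ (f + f) * n * n
      pow-eq n = trans (cong (n ^_) (cong suc (+-suc f f))) (eq n (n ^ (f + f)))
        where
        eq : ∀ n p → n * (n * p) ≡ p * n * n
        eq = solve-∀
      reassoc : ∀ m p n → m * (p * n * n) ≡ m * p * n * n
      reassoc = solve-∀
      regroup : ∀ s p q e → s * p * q * e * q ≡ s * e * (p * q * q)
      regroup = solve-∀
      total : length (concatMap (λ l → map (l ∷_) (leaves f (step (c , d) l))) (letters k)) ≡ ∑ (range k) T
      total = trans (length-concatMap (λ l → map (l ∷_) (leaves f (step (c , d) l))) (letters k))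
        (trans (∑-cong (letters k) (λ l → length-map (l ∷_) (leaves f (step (c , d) l))))
               (∑-cartesianProduct (range k) (range k) (λ l → length (leaves f (step (c , d) l)))))
      inner : ∀ b₁ → 1 ≤ b₁ → ∀ b₂ → 1 ≤ b₂ → b₂ ≤ k → let c′ = c + b₁ * d in
        N * N * k ^ (f + f) ≤ L b₁ b₂ * (k + 2) ^ (f + f) * ((d + b₂ * c′) * (d + suc b₂ * c′))
      inner b₁ 1≤b₁ b₂ 1≤b₂ _ = begin
        N * N * k ^ (f + f)                                        ≤⟨ length-leaves f c′ d′ (≤-trans d>0 (m≤m+n d _)) c′≤d′ N≤′ ⟩
        L b₁ b₂ * (d′ * (d′ + c′)) * (k + 2) ^ (f + f)             ≡⟨ eq (L b₁ b₂) d b₂ c′ ((k + 2) ^ (f + f)) ⟩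
        L b₁ b₂ * (k + 2) ^ (f + f) * (d′ * (d + suc b₂ * c′))     ∎
        where
        c′ = c + b₁ * d
        d′ = d + b₂ * c′
        eq : ∀ L d b c p → L * ((d + b * c) * ((d + b * c) + c)) * p ≡ L * p * ((d + b * c) * (d + (c + b * c)))
        eq = solve-∀
        c′≤b₂c′ : c′ ≤ b₂ * c′
        c′≤b₂c′ = ≤-trans (≤-reflexive (sym (*-identityˡ _))) (*-monoˡ-≤ _ 1≤b₂)
        c′≤d′ : c′ ≤ d′
        c′≤d′ = ≤-trans c′≤b₂c′ (m≤n+m _ d)
        d≤c′ : d ≤ c′
        d≤c′ = ≤-trans (≤-trans (≤-reflexive (sym (*-identityˡ _))) (*-monoˡ-≤ d 1≤b₁)) (m≤n+m _ c)
        -- Since d ≤ c′, a letter at least doubles d, which pays for the level of depth it uses.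
        N≤′ : N ≤ 2 ^ f * d′
        N≤′ = begin
          N                  ≤⟨ N≤ ⟩
          2 * 2 ^ f * d      ≡⟨ eq′ (2 ^ f) d ⟩
          2 ^ f * (d + d)    ≤⟨ *-monoʳ-≤ (2 ^ f) (+-monoʳ-≤ d (≤-trans d≤c′ c′≤b₂c′)) ⟩
          2 ^ f * d′         ∎
          where
          eq′ : ∀ p d → 2 * p * d ≡ p * (d + d)
          eq′ = solve-∀
      outer : ∀ b₁ → 1 ≤ b₁ → b₁ ≤ k →
        N * N * k ^ (f + f) * k ≤ T b₁ * (k + 2) ^ (f + f) * (k + 2) * ((c + b₁ * d) * (c + suc b₁ * d))
      outer b₁ 1≤b₁ _ = begin
        N * N * k ^ (f + f) * k
          ≤⟨ telescope-≤ (λ b₂ → L b₁ b₂ * (k + 2) ^ (f + f)) c′ d _ k (≤-trans d>0 d≤c′) d≤c′ (inner b₁ 1≤b₁) ⟩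
        ∑ (range k) (λ b₂ → L b₁ b₂ * (k + 2) ^ (f + f)) * (c′ * (c′ + d)) * (k + 2)
          ≡⟨ cong (λ z → z * (c′ * (c′ + d)) * (k + 2)) (∑-*ʳ (range k) _ (L b₁)) ⟩
        T b₁ * (k + 2) ^ (f + f) * (c′ * (c′ + d)) * (k + 2)
          ≡⟨ eq (T b₁) ((k + 2) ^ (f + f)) c b₁ d (k + 2) ⟩
        T b₁ * (k + 2) ^ (f + f) * (k + 2) * (c′ * (c + suc b₁ * d)) ∎
        where
        c′ = c + b₁ * d
        d≤c′ : d ≤ c′
        d≤c′ = ≤-trans (≤-trans (≤-reflexive (sym (*-identityˡ _))) (*-monoˡ-≤ d 1≤b₁)) (m≤n+m _ c)
        eq : ∀ T p c b d q → T * p * ((c + b * d) * ((c + b * d) + d)) * q ≡ T * p * q * ((c + b * d) * (c + (d + b * d)))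
        eq = solve-∀

-- From words to regular continued fractions of rational numbers.

module Expansions where

  open import Defs
  open Words
  open import Data.Integer.Base as ℤ using (+_)
  import Data.Maybe.Relation.Unary.Any as Maybe
  open import Data.Nat.Base as ℕ hiding (_/_)
  open import Data.Nat.Properties
  open import Data.Nat.Tactic.RingSolver using (solve-∀)
  open import Data.Rational.Base as ℚ using (ℚ; 1ℚ; _/_; 1/_; toℚᵘ)
  import Data.Rational.Properties as ℚ
  open import Data.Rational.Unnormalised.Base as ℚᵘ using (mkℚᵘ; *≡*)
  import Data.Rational.Unnormalised.Properties as ℚᵘ

  numerator denominatorᶜ : List ℕ → ℕ
  numerator    []       = 0
  numerator    (b ∷ bs) = denominatorᶜ bs
  denominatorᶜ []       = 1
  denominatorᶜ (b ∷ bs) = b * denominatorᶜ bs + numerator bs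

  denominatorᶜ-nonZero : ∀ {bs} → All NonZero bs → NonZero (denominatorᶜ bs)
  denominatorᶜ-nonZero [] = _
  denominatorᶜ-nonZero (_∷_ {x = suc b} _ ps) with denominatorᶜ-nonZero ps
  ... | h = >-nonZero (≤-trans (>-nonZero⁻¹ _ {{h}}) (≤-trans (m≤m+n _ _) (m≤m+n _ _)))

  1/-unique : ∀ q r .{{_ : ℚ.NonZero q}} → q ℚ.* r ≡ 1ℚ → 1/ q ≡ r
  1/-unique q r qr≡1 = begin
    1/ q                 ≡⟨ ℚ.*-identityʳ (1/ q) ⟨
    1/ q ℚ.* 1ℚ          ≡⟨ cong (1/ q ℚ.*_) qr≡1 ⟨
    1/ q ℚ.* (q ℚ.* r)   ≡⟨ ℚ.*-assoc (1/ q) q r ⟨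
    1/ q ℚ.* q ℚ.* r     ≡⟨ cong (ℚ._* r) (ℚ.*-inverseˡ q) ⟩
    1ℚ ℚ.* r             ≡⟨ ℚ.*-identityˡ r ⟩
    r                    ∎
    where open ≡-Reasoning

  private
    fraction-step : ∀ b n d m → m ≡ b * d + n → .{{_ : NonZero d}} .{{_ : NonZero m}} →
      (+ b / 1 ℚ.+ + n / d) ℚ.* (+ d / m) ≡ 1ℚ
    fraction-step b n (suc d) (suc m) eq = ℚ.toℚᵘ-injective (begin
      toℚᵘ ((+ b / 1 ℚ.+ + n / suc d) ℚ.* (+ suc d / suc m))
        ≈⟨ ℚ.toℚᵘ-homo-* (+ b / 1 ℚ.+ + n / suc d) (+ suc d / suc m) ⟩
      toℚᵘ (+ b / 1 ℚ.+ + n / suc d) ℚᵘ.* toℚᵘ (+ suc d / suc m)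
        ≈⟨ ℚᵘ.*-cong (ℚ.toℚᵘ-homo-+ (+ b / 1) (+ n / suc d)) (ℚ.toℚᵘ-fromℚᵘ (mkℚᵘ (+ suc d) m)) ⟩
      (toℚᵘ (+ b / 1) ℚᵘ.+ toℚᵘ (+ n / suc d)) ℚᵘ.* mkℚᵘ (+ suc d) m
        ≈⟨ ℚᵘ.*-congʳ (ℚᵘ.+-cong (ℚ.toℚᵘ-fromℚᵘ (mkℚᵘ (+ b) 0)) (ℚ.toℚᵘ-fromℚᵘ (mkℚᵘ (+ n) d))) ⟩
      (mkℚᵘ (+ b) 0 ℚᵘ.+ mkℚᵘ (+ n) d) ℚᵘ.* mkℚᵘ (+ suc d) m
        ≈⟨ *≡* identity ⟩
      toℚᵘ 1ℚ ∎)
      where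
      open ℚᵘ.≃-Reasoning
      nat : (b * suc d + n * 1) * suc d * 1 ≡ 1 * (1 * suc d * suc m)
      nat = trans (ring b (suc d) n) (cong (λ z → 1 * (1 * suc d * z)) (sym eq))
        where
        ring : ∀ b d n → (b * d + n * 1) * d * 1 ≡ 1 * (1 * d * (b * d + n))
        ring = solve-∀
      identity : (+ b ℤ.* + suc d ℤ.+ + n ℤ.* + 1) ℤ.* + suc d ℤ.* + 1 ≡ + 1 ℤ.* + (1 * suc d * suc m)
      identity = trans (cong (λ z → z ℤ.* + suc d ℤ.* + 1)
                   (trans (cong₂ ℤ._+_ (sym (ℤ.pos-* b (suc d))) (sym (ℤ.pos-* n 1))) (sym (ℤ.pos-+ (b * suc d) (n * 1)))))
                 (trans (cong (ℤ._* + 1) (sym (ℤ.pos-* (b * suc d + n * 1) (suc d))))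
                 (trans (sym (ℤ.pos-* ((b * suc d + n * 1) * suc d) 1))
                 (trans (cong +_ nat) (ℤ.pos-* 1 (1 * suc d * suc m)))))

  ⟦⟧-fraction : ∀ {bs} (ps : All NonZero bs) →
    ⟦ ps ⟧ ≡ _/_ (+ numerator bs) (denominatorᶜ bs) {{denominatorᶜ-nonZero ps}}
  ⟦⟧-fraction [] = refl
  ⟦⟧-fraction (_∷_ {x = b} {xs = bs} p ps) = 1/-unique _ _ {{_}}
    (trans (cong (λ z → (+ b / 1 ℚ.+ z) ℚ.* r) (⟦⟧-fraction ps))
           (fraction-step b (numerator bs) (denominatorᶜ bs) _ refl {{denominatorᶜ-nonZero ps}} {{denominatorᶜ-nonZero (p ∷ ps)}}))
    where
    r : ℚ
    r = _/_ (+ denominatorᶜ bs) (denominatorᶜ (b ∷ bs)) {{denominatorᶜ-nonZero (p ∷ ps)}}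

  quotients : Word → List ℕ
  quotients [] = []
  quotients ((b₁ , b₂) ∷ w) = b₁ ∷ b₂ ∷ quotients w

  quotients-All : ∀ {P : ℕ → Set} {w} → All (λ l → P (proj₁ l) × P (proj₂ l)) w → All P (quotients w)
  quotients-All [] = []
  quotients-All ((p , q) ∷ ps) = p ∷ q ∷ quotients-All ps

  -- Prepending a letter multiplies the matrix on the left, and its action on the right column (B ,
  -- D) is the recursion 1 / (b + n / d) = d / (b d + n) applied twice. `run` reads letters from the
  -- other side, so the passage is made by `B-++` and `D-++` with a one-letter word.
  convergent : ∀ w → numerator (quotients w) ≡ B w × denominatorᶜ (quotients w) ≡ D w
  convergent [] = refl , refl
  convergent (l@(b₁ , b₂) ∷ w) with convergent w
  ... | eqB , eqD =
    trans (cong₂ (λ x y → b₂ * y + x) eqB eqD) (trans (ringB b₁ b₂ (B w) (D w)) (sym (B-++ [ l ] w))) ,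
    trans (cong₂ (λ x y → b₁ * (b₂ * y + x) + y) eqB eqD) (trans (ringD b₁ b₂ (B w) (D w)) (sym (D-++ [ l ] w)))
    where
    ringB : ∀ l m b d → m * d + b ≡ (1 + l * 0) * b + (0 + m * (1 + l * 0)) * d
    ringB = solve-∀
    ringD : ∀ l m b d → l * (m * d + b) + d ≡ (0 + l * 1) * b + (1 + m * (0 + l * 1)) * d
    ringD = solve-∀

  last-∷ : ∀ {P : ℕ → Set} x xs → Maybe.Any P (last xs) → Maybe.Any P (last (x ∷ xs))
  last-∷ x (_ ∷ _) h = h

  last-quotients : ∀ w b₁ b₂ {P : ℕ → Set} → P b₂ → Maybe.Any P (last (quotients (w ++ [ b₁ , b₂ ])))
  last-quotients []              b₁ b₂ p = Maybe.just p
  last-quotients ((c₁ , c₂) ∷ w) b₁ b₂ p = last-∷ c₁ (c₂ ∷ quotients (w ++ [ b₁ , b₂ ])) (last-∷ c₂ (quotients (w ++ [ b₁ , b₂ ])) (last-quotients w b₁ b₂ p))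

  word-continuedFraction : ∀ {k} w b₁ b₂ → All (Letter k) (w ++ [ b₁ , b₂ ]) → 2 ≤ b₂ →
    .{{_ : NonZero (D (w ++ [ b₁ , b₂ ]))}} →
    PartialQuotientsBoundedBy k (+ B (w ++ [ b₁ , b₂ ]) / D (w ++ [ b₁ , b₂ ]))
  word-continuedFraction w b₁ b₂ ps 2≤b₂ = quotients v ,
    record { positive = positive ; last≥2 = last-quotients w b₁ b₂ 2≤b₂
           ; value = sym (trans (⟦⟧-fraction positive) (congruence {{denominatorᶜ-nonZero positive}} (proj₁ (convergent v)) (proj₂ (convergent v)))) } ,
    quotients-All (All.map (λ ((_ , p) , (_ , q)) → p , q) ps)
    where
    v = w ++ [ b₁ , b₂ ]
    positive : All NonZero (quotients v)
    positive = quotients-All (All.map (λ ((p , _) , (q , _)) → >-nonZero p , >-nonZero q) ps)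
    congruence : ∀ {a a′ q q′} .{{_ : NonZero q}} .{{_ : NonZero q′}} → a ≡ a′ → q ≡ q′ → + a / q ≡ + a′ / q′
    congruence refl refl = refl

-- Linear and quadratic congruences modulo a prime.

module Residues where

  open import Data.Integer.Base as ℤ renaming (∣_∣ to abs) using (ℤ; +_; _+_; _*_; _-_; -_; 0ℤ; 1ℤ)
  open import Data.Integer.Divisibility.Signed as ℤ∣ using (_∣_; divides; ∣⇒∣ᵤ; ∣ᵤ⇒∣; ∣m∣n⇒∣m+n; ∣m∣n⇒∣m-n; ∣n⇒∣m*n)
  open import Data.Integer.DivMod using (_%ℕ_; _/ℕ_; n%ℕd<d; a≡a%ℕn+[a/ℕn]*n)
  open import Data.Integer.Tactic.RingSolver using (solve-∀)
  open import Data.Nat.Base as ℕ using (ℕ; zero; suc)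
  open import Data.Nat.Coprimality using (prime⇒coprime; coprime-Bézout)
  open import Data.Nat.GCD using (module Bézout)

  infix 4 _∤_
  _∤_ : ℤ → ℤ → Set
  k ∤ z = ¬ k ∣ z

  ∣-resp : ∀ {k x y} → x ≡ y → k ∣ x → k ∣ y
  ∣-resp refl h = h

  ∣-combination : ∀ {k x y} u v → k ∣ x → k ∣ y → k ∣ u * x + v * y
  ∣-combination u v p q = ∣m∣n⇒∣m+n (∣n⇒∣m*n u p) (∣n⇒∣m*n v q)

  module _ {p : ℕ} (pp : Prime p) where

    private
      P = + p
      instance _ = prime⇒nonZero pp

    opaque
      euclid : ∀ x y → P ∣ x * y → P ∣ x ⊎ P ∣ y
      euclid x y h = [ inj₁ ∘ ∣ᵤ⇒∣ , inj₂ ∘ ∣ᵤ⇒∣ ]′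
        (euclidsLemma (abs x) (abs y) pp (subst (p ℕ∣.∣_) (ℤ.abs-* x y) (∣⇒∣ᵤ h)))

      ∣-cancelˡ : ∀ x y → P ∤ x → P ∣ x * y → P ∣ y
      ∣-cancelˡ x y n h = [ (λ q → contradiction q n) , (λ q → q) ]′ (euclid x y h)

      ∤-* : ∀ {x y} → P ∤ x → P ∤ y → P ∤ x * y
      ∤-* {x} {y} n m h = m (∣-cancelˡ x y n h)

      small-∣ : ∀ {x} → abs x ℕ.< p → P ∣ x → x ≡ 0ℤ
      small-∣ {x} x<p h with abs x in eq
      ... | zero  = ℤ.∣i∣≡0⇒i≡0 eq
      ... | suc n = contradiction (subst (p ℕ∣.∣_) eq (∣⇒∣ᵤ h)) (ℕ∣.>⇒∤ x<p)

      small-∤ : ∀ {x} → abs x ℕ.< p → x ≢ 0ℤ → P ∤ x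
      small-∤ x<p x≢0 h = x≢0 (small-∣ x<p h)

      p∤1 : P ∤ 1ℤ
      p∤1 h = small-∤ (ℕ.nonTrivial⇒n>1 p {{prime⇒nonTrivial pp}}) (λ ()) h

      residue-unique : ∀ {x y} → x ℕ.< p → y ℕ.< p → P ∣ + x - + y → x ≡ y
      residue-unique {x} {y} x<p y<p h = ℤ.+-injective (ℤ.i-j≡0⇒i≡j (+ x) (+ y) (small-∣ bound h))
        where
        bound : abs (+ x - + y) ℕ.< p
        bound = ℕ.≤-<-trans (ℕ.≤-trans (ℕ.≤-reflexive (cong abs (ℤ.m-n≡m⊖n x y)))
          (ℤ.∣m⊝n∣≤m⊔n x y)) (ℕ.⊔-lub x<p y<p)


      residue : ℤ → ℕ
      residue z = z %ℕ p

      residue< : ∀ z → residue z ℕ.< p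
      residue< z = n%ℕd<d z p

      residue-∣ : ∀ z → P ∣ z - + residue z
      residue-∣ z = divides (z /ℕ p) (trans (cong (_- + residue z) (a≡a%ℕn+[a/ℕn]*n z p)) (eq (+ residue z) _))
        where
        eq : ∀ r q → r + q - r ≡ q
        eq = solve-∀

      cramer : ∀ a b c d {x y} → P ∤ a * d - b * c → P ∣ a * x + b * y → P ∣ c * x + d * y → P ∣ x × P ∣ y
      cramer a b c d {x} {y} n h k =
        ∣-cancelˡ _ x n (∣-resp (eq₁ a b c d x y) (∣-combination d (- b) h k)) ,
        ∣-cancelˡ _ y n (∣-resp (eq₂ a b c d x y) (∣-combination (- c) a h k))
        where
        eq₁ : ∀ a b c d x y → d * (a * x + b * y) + (- b) * (c * x + d * y) ≡ (a * d - b * c) * x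
        eq₁ = solve-∀
        eq₂ : ∀ a b c d x y → (- c) * (a * x + b * y) + a * (c * x + d * y) ≡ (a * d - b * c) * y
        eq₂ = solve-∀

      root-difference : ∀ r s t x y →
        P ∣ r * (x * x) + s * x + t → P ∣ r * (y * y) + s * y + t → P ∣ x - y ⊎ P ∣ r * (x + y) + s
      root-difference r s t x y hx hy = euclid (x - y) (r * (x + y) + s) (∣-resp (eq r s t x y) (∣m∣n⇒∣m-n hx hy))
        where
        eq : ∀ r s t x y → (r * (x * x) + s * x + t) - (r * (y * y) + s * y + t) ≡ (x - y) * (r * (x + y) + s)
        eq = solve-∀

      -- If `x` differs from `y` and from `z`, both of these satisfy the linear congruence r (x + ·)
      -- + s ≡ 0 left after division by the difference, so they coincide.
      quadratic-roots : ∀ r s t x y z → P ∤ r →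
        P ∣ r * (x * x) + s * x + t → P ∣ r * (y * y) + s * y + t → P ∣ r * (z * z) + s * z + t →
        P ∣ x - y ⊎ P ∣ x - z ⊎ P ∣ y - z
      quadratic-roots r s t x y z n hx hy hz = lemma (root-difference r s t x y hx hy) (root-difference r s t x z hx hz)
        where
        eq : ∀ r s x y z → (r * (x + y) + s) - (r * (x + z) + s) ≡ r * (y - z)
        eq = solve-∀
        lemma : P ∣ x - y ⊎ P ∣ r * (x + y) + s → P ∣ x - z ⊎ P ∣ r * (x + z) + s → P ∣ x - y ⊎ P ∣ x - z ⊎ P ∣ y - z
        lemma (inj₁ h) _        = inj₁ h
        lemma (inj₂ _) (inj₁ h) = inj₂ (inj₁ h)
        lemma (inj₂ h) (inj₂ k) = inj₂ (inj₂ (∣-cancelˡ r (y - z) n (∣-resp (eq r s x y z) (∣m∣n⇒∣m-n h k))))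

      private
        cast : ∀ a b c d → 1 ℕ.+ a ℕ.* b ≡ c ℕ.* d → 1ℤ + + a * + b ≡ + c * + d
        cast a b c d e = trans (cong (λ z → 1ℤ + z) (sym (ℤ.pos-* a b))) (trans (cong (λ n → + n) e) (ℤ.pos-* c d))

      inverse : ∀ u → P ∤ u → ∃ λ v → P ∣ u * v - 1ℤ
      inverse u p∤u with residue u in eq | residue< u | residue-∣ u
      ... | zero  | _   | h = contradiction (∣-resp (ℤ.+-identityʳ u) h) p∤u
      ... | suc r | r<p | h with coprime-Bézout (prime⇒coprime pp r<p)
      ... | Bézout.+- x y e = - + y , ∣-resp (eq₁ u (+ suc r) (+ x) (+ y) P (cast y (suc r) x p e))
              (∣m∣n⇒∣m-n (∣n⇒∣m*n (- + y) h) (∣n⇒∣m*n (+ x) ℤ∣.∣-refl))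
        where
        eq₁ : ∀ u r x y P → 1ℤ + y * r ≡ x * P → (- y) * (u - r) - x * P ≡ u * (- y) - 1ℤ
        eq₁ u r x y P e = trans (cong (λ z → (- y) * (u - r) - z) (sym e)) (ring u r y)
          where
          ring : ∀ u r y → (- y) * (u - r) - (1ℤ + y * r) ≡ u * (- y) - 1ℤ
          ring = solve-∀
      ... | Bézout.-+ x y e = + y , ∣-resp (eq₁ u (+ suc r) (+ x) (+ y) P (cast x p y (suc r) e))
              (∣m∣n⇒∣m+n (∣n⇒∣m*n (+ y) h) (∣n⇒∣m*n (+ x) ℤ∣.∣-refl))
        where
        eq₁ : ∀ u r x y P → 1ℤ + x * P ≡ y * r → y * (u - r) + x * P ≡ u * y - 1ℤ
        eq₁ u r x y P e = trans (ring u r y (x * P)) (trans (cong (λ z → u * y - 1ℤ + (z - y * r)) e) (ring′ u y (y * r)))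
          where
          ring′ : ∀ u y z → u * y - 1ℤ + (z - z) ≡ u * y - 1ℤ
          ring′ = solve-∀
          ring : ∀ u r y z → y * (u - r) + z ≡ u * y - 1ℤ + (1ℤ + z - y * r)
          ring = solve-∀

      linear-solution : ∀ u t → P ∤ u → Σ[ x ∈ ℕ ] x ℕ.< p × P ∣ t + u * + x
      linear-solution u t p∤u with inverse u p∤u
      ... | v , h = residue (- (v * t)) , residue< (- (v * t)) ,
        ∣-resp (eq u v t (+ residue (- (v * t)))) (∣m∣n⇒∣m+n (∣n⇒∣m*n (- t) h) (∣n⇒∣m*n (- u) (residue-∣ (- (v * t)))))
        where
        eq : ∀ u v t r → (- t) * (u * v - 1ℤ) + (- u) * (- (v * t) - r) ≡ t + u * r
        eq = solve-∀

-- Second moment of incidences between matrices modulo p and hyperplanes given by pure tensors.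

module Planes where

  open FiniteSums
  open Residues
  open PrefixCodes using (range; ∈-range⁻)
  open import Data.Integer.Base as ℤ renaming (∣_∣ to abs) using (ℤ; +_; _+_; _*_; _-_; -_)
  open import Data.Integer.Divisibility.Signed as ℤ∣ using (_∣_; _∣?_; ∣m∣n⇒∣m+n; ∣m∣n⇒∣m-n)
  open import Data.Integer.Tactic.RingSolver using (solve-∀)
  open import Data.Nat.Base as ℕ using (ℕ; zero; suc; NonZero; _≤_; _<_; s≤s; z≤n)

  record Mat : Set where
    constructor mat
    field
      m₁₁ m₁₂ m₂₁ m₂₂ : ℤ
  open Mat public

  Quad : Set
  Quad = ℕ × ℕ × ℕ × ℕ

  infixl 7 _·_
  _·_ : Mat → Quad → ℤ
  mat u₁ u₂ u₃ u₄ · (x₁ , x₂ , x₃ , x₄) = u₁ * + x₁ + u₂ * + x₂ + u₃ * + x₃ + u₄ * + x₄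

  module Incidence {p : ℕ} (pp : Prime p) where

    private P = + p

    quads : List Quad
    quads = cartesianProduct (upTo p) (cartesianProduct (upTo p) (cartesianProduct (upTo p) (upTo p)))

    pairs : List (ℕ × ℕ)
    pairs = cartesianProduct (upTo p) (upTo p)

    quads-unique : Unique quads
    quads-unique = Unique.cartesianProduct⁺ u (Unique.cartesianProduct⁺ u (Unique.cartesianProduct⁺ u u))
      where u = Unique.upTo⁺ p

    ∈-quads⁺ : ∀ {x₁ x₂ x₃ x₄} → x₁ < p → x₂ < p → x₃ < p → x₄ < p → (x₁ , x₂ , x₃ , x₄) ∈ quads
    ∈-quads⁺ a b c d = ∈-cartesianProduct⁺ (∈-upTo⁺ a) (∈-cartesianProduct⁺ (∈-upTo⁺ b)
      (∈-cartesianProduct⁺ (∈-upTo⁺ c) (∈-upTo⁺ d)))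

    ∈-quads⁻ : ∀ {x₁ x₂ x₃ x₄} → (x₁ , x₂ , x₃ , x₄) ∈ quads → x₁ < p × x₂ < p × x₃ < p × x₄ < p
    ∈-quads⁻ i with ∈-cartesianProduct⁻ (upTo p) _ i
    ... | a , i with ∈-cartesianProduct⁻ (upTo p) _ i
    ... | b , i with ∈-cartesianProduct⁻ (upTo p) _ i
    ... | c , d = ∈-upTo⁻ a , ∈-upTo⁻ b , ∈-upTo⁻ c , ∈-upTo⁻ d

    ∑-quads : ∀ (f : Quad → ℕ) → ∑ quads f ≡
      ∑[ x₁ ← upTo p ] ∑[ x₂ ← upTo p ] ∑[ x₃ ← upTo p ] ∑[ x₄ ← upTo p ] f (x₁ , x₂ , x₃ , x₄)
    ∑-quads f = trans (∑-cartesianProduct (upTo p) _ f) (∑-cong (upTo p) λ x₁ →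
      trans (∑-cartesianProduct (upTo p) _ (λ y → f (x₁ , y))) (∑-cong (upTo p) λ x₂ →
      ∑-cartesianProduct (upTo p) (upTo p) (λ y → f (x₁ , x₂ , y))))

    ∑-upTo-const : ∀ n → ∑[ _ ← upTo p ] n ≡ p ℕ.* n
    ∑-upTo-const n = trans (∑-const (upTo p) n) (cong (ℕ._* n) (length-upTo p))

    length-quads : length quads ≡ p ℕ.* (p ℕ.* (p ℕ.* p))
    length-quads = trans (length-cartesianProduct (upTo p) _) (cong₂ ℕ._*_ l (trans (length-cartesianProduct (upTo p) _)
      (cong₂ ℕ._*_ l (trans (length-cartesianProduct (upTo p) _) (cong₂ ℕ._*_ l l)))))
      where l = length-upTo p

    opaque
      incident? : ∀ u x → Dec (P ∣ u · x)
      incident? u x = P ∣? u · x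

    private
      last-coordinate : ∀ u t x y → P ∤ u → x < p → y < p → P ∣ t + u * + x → P ∣ t + u * + y → x ≡ y
      last-coordinate u t x y n x<p y<p h k = residue-unique pp x<p y<p
        (∣-cancelˡ pp u (+ x - + y) n (∣-resp (eq u t (+ x) (+ y)) (∣m∣n⇒∣m-n h k)))
        where
        eq : ∀ u t x y → (t + u * x) - (t + u * y) ≡ u * (x - y)
        eq = solve-∀

    -- The last coefficient is invertible, so the first three coordinates are free and determine the
    -- fourth.
    count-hyperplane : ∀ u → P ∤ m₂₂ u → count (incident? u) quads ≡ p ℕ.* (p ℕ.* p)
    count-hyperplane u@(mat u₁ u₂ u₃ u₄) n = trans (∑-quads (λ x → 𝟙 (incident? u x))) (trans (∑-cong (upTo p) λ x₁ →
      trans (∑-cong (upTo p) λ x₂ → trans (∑-cong (upTo p) λ x₃ → one x₁ x₂ x₃)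
        (trans (∑-upTo-const 1) (ℕ.*-identityʳ p)))
      (∑-upTo-const p)) (∑-upTo-const (p ℕ.* p)))
      where
      one : ∀ x₁ x₂ x₃ → ∑[ x₄ ← upTo p ] 𝟙 (incident? u (x₁ , x₂ , x₃ , x₄)) ≡ 1
      one x₁ x₂ x₃ = ℕ.≤-antisym
        (count≤1 (λ x₄ → incident? u (x₁ , x₂ , x₃ , x₄)) (Unique.upTo⁺ p)
          λ {x} {y} i j h k → last-coordinate u₄ (u₁ * + x₁ + u₂ * + x₂ + u₃ * + x₃) x y n (∈-upTo⁻ i) (∈-upTo⁻ j) h k)
        at-least
        where
        at-least : 1 ≤ ∑[ x₄ ← upTo p ] 𝟙 (incident? u (x₁ , x₂ , x₃ , x₄))
        at-least with linear-solution pp u₄ (u₁ * + x₁ + u₂ * + x₂ + u₃ * + x₃) n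
        ... | x₄ , x₄<p , h = ℕ.≤-trans
          (ℕ.≤-reflexive (sym (𝟙-true (incident? u (x₁ , x₂ , x₃ , x₄)) h)))
          (∑-term (λ x₄ → 𝟙 (incident? u (x₁ , x₂ , x₃ , x₄))) (∈-upTo⁺ x₄<p))

    private
      two-coordinates : ∀ a b c d t s x y x′ y′ → P ∤ a * d - b * c →
        x < p → y < p → x′ < p → y′ < p →
        P ∣ t + (a * + x + b * + y) → P ∣ t + (a * + x′ + b * + y′) →
        P ∣ s + (c * + x + d * + y) → P ∣ s + (c * + x′ + d * + y′) → x ≡ x′ × y ≡ y′
      two-coordinates a b c d t s x y x′ y′ n x< y< x′< y′< h h′ k k′ =
        residue-unique pp x< x′< (proj₁ both) , residue-unique pp y< y′< (proj₂ both)
        where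
        eq : ∀ a b t x y x′ y′ → (t + (a * x + b * y)) - (t + (a * x′ + b * y′)) ≡ a * (x - x′) + b * (y - y′)
        eq = solve-∀
        both : P ∣ + x - + x′ × P ∣ + y - + y′
        both = cramer pp a b c d n (∣-resp (eq a b t (+ x) (+ y) (+ x′) (+ y′)) (∣m∣n⇒∣m-n h h′))
                                   (∣-resp (eq c d s (+ x) (+ y) (+ x′) (+ y′)) (∣m∣n⇒∣m-n k k′))

    incident-both? : ∀ u v x → Dec (P ∣ u · x × P ∣ v · x)
    incident-both? u v x with incident? u x | incident? v x
    ... | yes p | yes q = yes (p , q)
    ... | no ¬p | _     = no (λ h → ¬p (proj₁ h))
    ... | _     | no ¬q = no (λ h → ¬q (proj₂ h))

    private
      common : Mat → Mat → List Quad
      common u v = filter (incident-both? u v) quads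

      common-unique : ∀ u v → Unique (common u v)
      common-unique u v = Unique.filter⁺ (incident-both? u v) quads-unique

      _≟²_ : DecidableEquality (ℕ × ℕ)
      _≟²_ = ≡-dec ℕ._≟_ ℕ._≟_

      length-pairs : length pairs ≡ p ℕ.* p
      length-pairs = trans (length-cartesianProduct (upTo p) (upTo p)) (cong₂ ℕ._*_ (length-upTo p) (length-upTo p))

      ∈-pairs : ∀ {x y} → x < p → y < p → (x , y) ∈ pairs
      ∈-pairs x< y< = ∈-cartesianProduct⁺ (∈-upTo⁺ x<) (∈-upTo⁺ y<)

    -- A nonzero minor in columns 2 and 4 lets the coordinates x₁ and x₃ determine x₂ and x₄.
    count-common-24 : ∀ u v → P ∤ m₁₂ u * m₂₂ v - m₂₂ u * m₁₂ v →
                      count (incident-both? u v) quads ≤ p ℕ.* p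
    count-common-24 u@(mat u₁ u₂ u₃ u₄) v@(mat v₁ v₂ v₃ v₄) n =
      subst₂ _≤_ (length-filter-∑ (incident-both? u v) quads) length-pairs
        (length-injection _≟²_ (common-unique u v) (λ x → proj₁ x , proj₁ (proj₂ (proj₂ x))) into injective)
      where
      into : ∀ {x} → x ∈ common u v → (proj₁ x , proj₁ (proj₂ (proj₂ x))) ∈ pairs
      into i with ∈-quads⁻ (proj₁ (∈-filter⁻ (incident-both? u v) {xs = quads} i))
      ... | x₁< , _ , x₃< , _ = ∈-pairs x₁< x₃<
      eq : ∀ u₁ u₂ u₃ u₄ x₁ x₂ x₃ x₄ → u₁ * x₁ + u₂ * x₂ + u₃ * x₃ + u₄ * x₄ ≡ (u₁ * x₁ + u₃ * x₃) + (u₂ * x₂ + u₄ * x₄)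
      eq = solve-∀
      injective : ∀ {x y} → x ∈ common u v → y ∈ common u v →
        (proj₁ x , proj₁ (proj₂ (proj₂ x))) ≡ (proj₁ y , proj₁ (proj₂ (proj₂ y))) → x ≡ y
      injective i j = from (∈-filter⁻ (incident-both? u v) {xs = quads} i) (∈-filter⁻ (incident-both? u v) {xs = quads} j)
        where
        Solution : Quad → Set
        Solution x = x ∈ quads × P ∣ u · x × P ∣ v · x
        key : Quad → ℕ × ℕ
        key = (λ (x : Quad) → proj₁ x , proj₁ (proj₂ (proj₂ x)))
        from : ∀ {x y} → Solution x → Solution y → key x ≡ key y → x ≡ y
        from {x₁ , x₂ , x₃ , x₄} {.x₁ , y₂ , .x₃ , y₄} (i , h , k) (j , h′ , k′) refl = bounded (∈-quads⁻ i) (∈-quads⁻ j)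
          where
          bounded : x₁ < p × x₂ < p × x₃ < p × x₄ < p → x₁ < p × y₂ < p × x₃ < p × y₄ < p → (x₁ , x₂ , x₃ , x₄) ≡ (x₁ , y₂ , x₃ , y₄)
          bounded (_ , x₂< , _ , x₄<) (_ , y₂< , _ , y₄<) = (λ (e , e′) → cong₂ (λ z z′ → x₁ , z , x₃ , z′) e e′) (two-coordinates u₂ u₄ v₂ v₄ (u₁ * + x₁ + u₃ * + x₃) (v₁ * + x₁ + v₃ * + x₃) x₂ x₄ y₂ y₄ n x₂< x₄< y₂< y₄<
            (∣-resp (eq u₁ u₂ u₃ u₄ (+ x₁) (+ x₂) (+ x₃) (+ x₄)) h) (∣-resp (eq u₁ u₂ u₃ u₄ (+ x₁) (+ y₂) (+ x₃) (+ y₄)) h′)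
            (∣-resp (eq v₁ v₂ v₃ v₄ (+ x₁) (+ x₂) (+ x₃) (+ x₄)) k) (∣-resp (eq v₁ v₂ v₃ v₄ (+ x₁) (+ y₂) (+ x₃) (+ y₄)) k′))

    count-common-34 : ∀ u v → P ∤ m₂₁ u * m₂₂ v - m₂₂ u * m₂₁ v →
                      count (incident-both? u v) quads ≤ p ℕ.* p
    count-common-34 u@(mat u₁ u₂ u₃ u₄) v@(mat v₁ v₂ v₃ v₄) n =
      subst₂ _≤_ (length-filter-∑ (incident-both? u v) quads) length-pairs
        (length-injection _≟²_ (common-unique u v) (λ x → proj₁ x , proj₁ (proj₂ x)) into injective)
      where
      into : ∀ {x} → x ∈ common u v → (proj₁ x , proj₁ (proj₂ x)) ∈ pairs
      into i with ∈-quads⁻ (proj₁ (∈-filter⁻ (incident-both? u v) {xs = quads} i))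
      ... | x₁< , x₂< , _ , _ = ∈-pairs x₁< x₂<
      eq : ∀ u₁ u₂ u₃ u₄ x₁ x₂ x₃ x₄ → u₁ * x₁ + u₂ * x₂ + u₃ * x₃ + u₄ * x₄ ≡ (u₁ * x₁ + u₂ * x₂) + (u₃ * x₃ + u₄ * x₄)
      eq = solve-∀
      injective : ∀ {x y} → x ∈ common u v → y ∈ common u v →
        (proj₁ x , proj₁ (proj₂ x)) ≡ (proj₁ y , proj₁ (proj₂ y)) → x ≡ y
      injective i j = from (∈-filter⁻ (incident-both? u v) {xs = quads} i) (∈-filter⁻ (incident-both? u v) {xs = quads} j)
        where
        Solution : Quad → Set
        Solution x = x ∈ quads × P ∣ u · x × P ∣ v · x
        key : Quad → ℕ × ℕ
        key = (λ (x : Quad) → proj₁ x , proj₁ (proj₂ x))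
        from : ∀ {x y} → Solution x → Solution y → key x ≡ key y → x ≡ y
        from {x₁ , x₂ , x₃ , x₄} {.x₁ , .x₂ , y₃ , y₄} (i , h , k) (j , h′ , k′) refl = bounded (∈-quads⁻ i) (∈-quads⁻ j)
          where
          bounded : x₁ < p × x₂ < p × x₃ < p × x₄ < p → x₁ < p × x₂ < p × y₃ < p × y₄ < p → (x₁ , x₂ , x₃ , x₄) ≡ (x₁ , x₂ , y₃ , y₄)
          bounded (_ , _ , x₃< , x₄<) (_ , _ , y₃< , y₄<) = (λ (e , e′) → cong₂ (λ z z′ → x₁ , x₂ , z , z′) e e′) (two-coordinates u₃ u₄ v₃ v₄ (u₁ * + x₁ + u₂ * + x₂) (v₁ * + x₁ + v₂ * + x₂) x₃ x₄ y₃ y₄ n x₃< x₄< y₃< y₄<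
            (∣-resp (eq u₁ u₂ u₃ u₄ (+ x₁) (+ x₂) (+ x₃) (+ x₄)) h) (∣-resp (eq u₁ u₂ u₃ u₄ (+ x₁) (+ x₂) (+ y₃) (+ y₄)) h′)
            (∣-resp (eq v₁ v₂ v₃ v₄ (+ x₁) (+ x₂) (+ x₃) (+ x₄)) k) (∣-resp (eq v₁ v₂ v₃ v₄ (+ x₁) (+ x₂) (+ y₃) (+ y₄)) k′))

    -- (c , d) X (c′ , d′)ᵀ = (tensor c d c′ d′) · X
    tensor : ℤ → ℤ → ℤ → ℤ → Mat
    tensor c d c′ d′ = mat (c * c′) (c * d′) (d * c′) (d * d′)

    module _ {I : Set} (_≟_ : DecidableEquality I) {𝓐 : List I} (𝓐-unique : Unique 𝓐)
      (c d : I → ℤ) (d≢0 : ∀ {i} → i ∈ 𝓐 → P ∤ d i)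
      (distinct : ∀ {i j} → i ∈ 𝓐 → j ∈ 𝓐 → P ∣ c i * d j - c j * d i → i ≡ j)
      {J : Set} {𝓢 : List J} (𝓢-unique : Unique 𝓢) (M : J → Mat)
      (projectively-distinct : ∀ {j j′} l l′ → j ∈ 𝓢 → j′ ∈ 𝓢 → P ∤ l →
        P ∣ l * m₁₁ (M j) - l′ * m₁₁ (M j′) → P ∣ l * m₁₂ (M j) - l′ * m₁₂ (M j′) →
        P ∣ l * m₂₁ (M j) - l′ * m₂₁ (M j′) → P ∣ l * m₂₂ (M j) - l′ * m₂₂ (M j′) → j ≡ j′)
      (nonzero : ∀ {j} z → j ∈ 𝓢 → P ∣ m₁₁ (M j) * z → P ∣ m₁₂ (M j) * z → P ∣ m₂₁ (M j) * z → P ∣ m₂₂ (M j) * z → P ∣ z)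
      (avoids : ∀ {i k j} → i ∈ 𝓐 → k ∈ 𝓐 → j ∈ 𝓢 →
        P ∤ c i * c k * m₁₁ (M j) + c i * d k * m₁₂ (M j) + d i * c k * m₂₁ (M j) + d i * d k * m₂₂ (M j))
      where

      private
        planes : List (I × I)
        planes = cartesianProduct 𝓐 𝓐

        K : ℕ
        K = length planes

        plane : I × I → Mat
        plane (i , k) = tensor (c i) (d i) (c k) (d k)

        N : Quad → ℕ
        N x = ∑[ a ← planes ] 𝟙 (incident? (plane a) x)

        planes∈ : ∀ {a} → a ∈ planes → proj₁ a ∈ 𝓐 × proj₂ a ∈ 𝓐
        planes∈ = ∈-cartesianProduct⁻ 𝓐 𝓐

        _≟ᴵ_ : DecidableEquality (I × I)
        _≟ᴵ_ = ≡-dec _≟_ _≟_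

        p² = p ℕ.* p
        p³ = p ℕ.* (p ℕ.* p)
        p⁴ = p ℕ.* (p ℕ.* (p ℕ.* p))

        plane≢0 : ∀ {a} → a ∈ planes → P ∤ m₂₂ (plane a)
        plane≢0 i = ∤-* pp (d≢0 (proj₁ (planes∈ i))) (d≢0 (proj₂ (planes∈ i)))

        ∑N : ∑ quads N ≡ K ℕ.* p³
        ∑N = trans (∑-swap quads planes _) (trans (ℕ.≤-antisym
          (∑-mono planes (λ a i → ℕ.≤-reflexive (count-hyperplane (plane a) (plane≢0 i))))
          (∑-mono planes (λ a i → ℕ.≤-reflexive (sym (count-hyperplane (plane a) (plane≢0 i))))))
          (∑-const planes p³))

        𝟙*𝟙 : ∀ a b x → 𝟙 (incident? (plane a) x) ℕ.* 𝟙 (incident? (plane b) x) ≡ 𝟙 (incident-both? (plane a) (plane b) x)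
        𝟙*𝟙 a b x with incident? (plane a) x | incident? (plane b) x
        ... | yes _ | yes _ = refl
        ... | yes _ | no _  = refl
        ... | no _  | yes _ = refl
        ... | no _  | no _  = refl

        minor₂₄ : ∀ a b b′ e f f′ → (a * b′) * (f * f′) - (b * b′) * (e * f′) ≡ (b′ * f′) * (a * f - e * b)
        minor₂₄ = solve-∀
        minor₃₄ : ∀ b a′ b′ f e′ f′ → (b * a′) * (f * f′) - (b * b′) * (f * e′) ≡ (b * f) * (a′ * f′ - e′ * b′)
        minor₃₄ = solve-∀

        -- For pure tensors the minor in columns 2 and 4 is the determinant of the left factors
        -- times d k d k′, and the one in columns 3 and 4 is the determinant of the right factors
        -- times d i d i′. Different pairs of bottom rows make at least one of them nonzero, so the
        -- two hyperplanes meet in codimension 2.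
        meet : ∀ {a b} → a ∈ planes → b ∈ planes → a ≢ b → count (incident-both? (plane a) (plane b)) quads ≤ p²
        meet {i , k} {i′ , k′} a∈ b∈ a≢b = cases (P ∣? c i * d i′ - c i′ * d i) (P ∣? c k * d k′ - c k′ * d k)
          where
          cases : Dec (P ∣ c i * d i′ - c i′ * d i) → Dec (P ∣ c k * d k′ - c k′ * d k) →
                  count (incident-both? (plane (i , k)) (plane (i′ , k′))) quads ≤ p²
          cases (no n) _ = count-common-24 (plane (i , k)) (plane (i′ , k′)) λ h →
            ∤-* pp (∤-* pp (d≢0 (proj₂ (planes∈ a∈))) (d≢0 (proj₂ (planes∈ b∈)))) n
              (∣-resp (minor₂₄ (c i) (d i) (d k) (c i′) (d i′) (d k′)) h)
          cases (yes _) (no n) = count-common-34 (plane (i , k)) (plane (i′ , k′)) λ h →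
            ∤-* pp (∤-* pp (d≢0 (proj₁ (planes∈ a∈))) (d≢0 (proj₁ (planes∈ b∈)))) n
              (∣-resp (minor₃₄ (d i) (c k) (d k) (d i′) (c k′) (d k′)) h)
          cases (yes h) (yes h′) = contradiction
            (cong₂ _,_ (distinct (proj₁ (planes∈ a∈)) (proj₁ (planes∈ b∈)) h)
                       (distinct (proj₂ (planes∈ a∈)) (proj₂ (planes∈ b∈)) h′)) a≢b

        planes-unique : Unique planes
        planes-unique = Unique.cartesianProduct⁺ 𝓐-unique 𝓐-unique

        N²-expand : ∀ x → N x ℕ.* N x ≡ ∑[ a ← planes ] ∑[ b ← planes ] 𝟙 (incident-both? (plane a) (plane b) x)
        N²-expand x = sym (trans (∑-cong planes λ a → trans (∑-cong planes λ b → sym (𝟙*𝟙 a b x))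
          (∑-*ˡ planes (𝟙 (incident? (plane a) x)) (λ b → 𝟙 (incident? (plane b) x))))
          (∑-*ʳ planes (N x) (λ a → 𝟙 (incident? (plane a) x))))

        pair-bound : ∀ {a b} → a ∈ planes → b ∈ planes →
          count (incident-both? (plane a) (plane b)) quads ≤ p² ℕ.+ p³ ℕ.* 𝟙 (b ≟ᴵ a)
        pair-bound {a} {b} a∈ b∈ with b ≟ᴵ a
        ... | no b≢a = ℕ.≤-trans (meet a∈ b∈ (λ e → b≢a (sym e))) (ℕ.m≤m+n _ _)
        ... | yes _ = ℕ.≤-trans (∑-mono quads (λ x _ → both≤ x))
          (ℕ.≤-trans (ℕ.≤-reflexive (trans (count-hyperplane (plane a) (plane≢0 a∈)) (sym (ℕ.*-identityʳ p³))))
                     (ℕ.m≤n+m _ p²))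
          where
          both≤ : ∀ x → 𝟙 (incident-both? (plane a) (plane b) x) ≤ 𝟙 (incident? (plane a) x)
          both≤ x = ℕ.≤-trans (ℕ.≤-reflexive (sym (𝟙*𝟙 a b x)))
            (ℕ.≤-trans (ℕ.*-monoʳ-≤ (𝟙 (incident? (plane a) x)) (𝟙≤1 (incident? (plane b) x))) (ℕ.≤-reflexive (ℕ.*-identityʳ _)))

        ∑N² : ∑[ x ← quads ] (N x ℕ.* N x) ≤ K ℕ.* (K ℕ.* p² ℕ.+ p³)
        ∑N² = begin
          ∑[ x ← quads ] (N x ℕ.* N x)
            ≡⟨ ∑-cong quads N²-expand ⟩
          ∑[ x ← quads ] ∑[ a ← planes ] ∑[ b ← planes ] 𝟙 (incident-both? (plane a) (plane b) x)
            ≡⟨ ∑-swap quads planes _ ⟩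
          ∑[ a ← planes ] ∑[ x ← quads ] ∑[ b ← planes ] 𝟙 (incident-both? (plane a) (plane b) x)
            ≡⟨ ∑-cong planes (λ a → ∑-swap quads planes _) ⟩
          ∑[ a ← planes ] ∑[ b ← planes ] count (incident-both? (plane a) (plane b)) quads
            ≤⟨ ∑-≤ planes row ⟩
          K ℕ.* (K ℕ.* p² ℕ.+ p³) ∎
          where
          open ℕ.≤-Reasoning
          row : ∀ a → a ∈ planes → ∑[ b ← planes ] count (incident-both? (plane a) (plane b)) quads ≤ K ℕ.* p² ℕ.+ p³
          row a a∈ = begin
            ∑[ b ← planes ] count (incident-both? (plane a) (plane b)) quads
              ≤⟨ ∑-mono planes (λ b b∈ → pair-bound a∈ b∈) ⟩
            ∑[ b ← planes ] (p² ℕ.+ p³ ℕ.* 𝟙 (b ≟ᴵ a))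
              ≡⟨ ∑-+ planes (λ _ → p²) (λ b → p³ ℕ.* 𝟙 (b ≟ᴵ a)) ⟩
            ∑[ _ ← planes ] p² ℕ.+ ∑[ b ← planes ] (p³ ℕ.* 𝟙 (b ≟ᴵ a))
              ≡⟨ cong₂ ℕ._+_ (∑-const planes p²) (∑-*ˡ planes p³ (λ b → 𝟙 (b ≟ᴵ a))) ⟩
            K ℕ.* p² ℕ.+ p³ ℕ.* count (_≟ᴵ a) planes
              ≤⟨ ℕ.+-monoʳ-≤ (K ℕ.* p²) (ℕ.≤-trans (ℕ.*-monoʳ-≤ p³ (count≤1 (_≟ᴵ a) planes-unique (λ _ _ q r → trans q (sym r))))
                                      (ℕ.≤-reflexive (ℕ.*-identityʳ p³))) ⟩
            K ℕ.* p² ℕ.+ p³ ∎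

        scalars : List ℕ
        scalars = range (p ℕ.∸ 1)

        scalar< : ∀ {l} → l ∈ scalars → 0 < l × l < p
        scalar< i with ∈-range⁻ i
        ... | 0<l , l≤ = 0<l , ℕ.<-≤-trans (s≤s l≤) (ℕ.≤-reflexive (ℕ.suc-pred p {{prime⇒nonZero pp}}))

        -- Lying on no hyperplane is invariant under nonzero scalars. Each matrix therefore stands
        -- for p - 1 points, which gains a factor p - 1 in the final bound.
        scaled : List (ℕ × J)
        scaled = cartesianProduct scalars 𝓢

        scaled∈ : ∀ {a} → a ∈ scaled → proj₁ a ∈ scalars × proj₂ a ∈ 𝓢
        scaled∈ = ∈-cartesianProduct⁻ scalars 𝓢

        φ : ℕ × J → Quad
        φ (l , j) = residue pp (+ l * m₁₁ (M j)) , residue pp (+ l * m₁₂ (M j)) ,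
                    residue pp (+ l * m₂₁ (M j)) , residue pp (+ l * m₂₂ (M j))

        scalar∤ : ∀ {l} → l ∈ scalars → P ∤ + l
        scalar∤ {l} i with scalar< i
        ... | 0<l , l<p = small-∤ pp l<p λ e → ℕ.<⇒≢ 0<l (sym (ℤ.+-injective e))

        residue-≡ : ∀ x y → residue pp x ≡ residue pp y → P ∣ x - y
        residue-≡ x y e = ∣-resp (eq x y (+ residue pp y))
          (∣m∣n⇒∣m-n (subst (λ r → P ∣ x - + r) e (residue-∣ pp x)) (residue-∣ pp y))
          where
          eq : ∀ x y r → (x - r) - (y - r) ≡ x - y
          eq = solve-∀

        φ-injective : ∀ {a b} → a ∈ scaled → b ∈ scaled → φ a ≡ φ b → a ≡ b
        φ-injective {l , j} {l′ , j′} a∈ b∈ e = same-matrix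
          (projectively-distinct (+ l) (+ l′) j∈ j′∈ (scalar∤ l∈)
            (residue-≡ (+ l * m₁₁ (M j)) (+ l′ * m₁₁ (M j′)) (cong proj₁ e))
            (residue-≡ (+ l * m₁₂ (M j)) (+ l′ * m₁₂ (M j′)) (cong (λ q → proj₁ (proj₂ q)) e))
            (residue-≡ (+ l * m₂₁ (M j)) (+ l′ * m₂₁ (M j′)) (cong (λ q → proj₁ (proj₂ (proj₂ q))) e))
            (residue-≡ (+ l * m₂₂ (M j)) (+ l′ * m₂₂ (M j′)) (cong (λ q → proj₂ (proj₂ (proj₂ q))) e))) e
          where
          l∈ = proj₁ (scaled∈ a∈)
          j∈ = proj₂ (scaled∈ a∈)
          l′∈ = proj₁ (scaled∈ b∈)
          j′∈ = proj₂ (scaled∈ b∈)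
          eq : ∀ l l′ m → l * m - l′ * m ≡ m * (l - l′)
          eq = solve-∀
          entry : ∀ m → residue pp (+ l * m) ≡ residue pp (+ l′ * m) → P ∣ m * (+ l - + l′)
          entry m e = ∣-resp (eq (+ l) (+ l′) m) (residue-≡ (+ l * m) (+ l′ * m) e)
          same-matrix : j ≡ j′ → φ (l , j) ≡ φ (l′ , j′) → (l , j) ≡ (l′ , j′)
          same-matrix refl e = cong (_, j) (residue-unique pp (proj₂ (scalar< l∈)) (proj₂ (scalar< l′∈))
            (nonzero (+ l - + l′) j∈
              (entry (m₁₁ (M j)) (cong proj₁ e)) (entry (m₁₂ (M j)) (cong (λ q → proj₁ (proj₂ q)) e))
              (entry (m₂₁ (M j)) (cong (λ q → proj₁ (proj₂ (proj₂ q))) e)) (entry (m₂₂ (M j)) (cong (λ q → proj₂ (proj₂ (proj₂ q))) e))))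

        Z : Quad → ℕ
        Z x = 𝟙 (N x ℕ.≟ 0)

        N-φ : ∀ {a} → a ∈ scaled → N (φ a) ≡ 0
        N-φ {l , j} a∈ = count-none (λ b → incident? (plane b) (φ (l , j))) none
          where
          l∈ = proj₁ (scaled∈ a∈)
          j∈ = proj₂ (scaled∈ a∈)
          r₁ = + l * m₁₁ (M j)
          r₂ = + l * m₁₂ (M j)
          r₃ = + l * m₂₁ (M j)
          r₄ = + l * m₂₂ (M j)
          none : ∀ {b} → b ∈ planes → P ∤ plane b · φ (l , j)
          none {i , k} b∈ h = avoids (proj₁ (planes∈ b∈)) (proj₂ (planes∈ b∈)) j∈
            (∣-cancelˡ pp (+ l) (c i * c k * m₁₁ (M j) + c i * d k * m₁₂ (M j) + d i * c k * m₂₁ (M j) + d i * d k * m₂₂ (M j)) (scalar∤ l∈)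
              (∣-resp (eq (+ l) (c i * c k) (c i * d k) (d i * c k) (d i * d k) (m₁₁ (M j)) (m₁₂ (M j)) (m₂₁ (M j)) (m₂₂ (M j))
                          (+ residue pp r₁) (+ residue pp r₂) (+ residue pp r₃) (+ residue pp r₄))
                (∣m∣n⇒∣m+n h (∣m∣n⇒∣m+n (∣-combination (c i * c k) (c i * d k) (residue-∣ pp r₁) (residue-∣ pp r₂))
                                        (∣-combination (d i * c k) (d i * d k) (residue-∣ pp r₃) (residue-∣ pp r₄))))))
            where
            eq : ∀ l u₁ u₂ u₃ u₄ m₁ m₂ m₃ m₄ x₁ x₂ x₃ x₄ →
              (u₁ * x₁ + u₂ * x₂ + u₃ * x₃ + u₄ * x₄) +
                ((u₁ * (l * m₁ - x₁) + u₂ * (l * m₂ - x₂)) + (u₃ * (l * m₃ - x₃) + u₄ * (l * m₄ - x₄))) ≡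
              l * (u₁ * m₁ + u₂ * m₂ + u₃ * m₃ + u₄ * m₄)
            eq = solve-∀

        ∑Z : (p ℕ.∸ 1) ℕ.* length 𝓢 ≤ ∑ quads Z
        ∑Z = begin
          (p ℕ.∸ 1) ℕ.* length 𝓢      ≡⟨ cong (ℕ._* length 𝓢) (trans (length-map suc (downFrom (p ℕ.∸ 1))) (length-downFrom (p ℕ.∸ 1))) ⟨
          length scalars ℕ.* length 𝓢 ≡⟨ length-cartesianProduct scalars 𝓢 ⟨
          length scaled               ≡⟨ length≡∑1 scaled ⟩
          ∑[ a ← scaled ] 1           ≤⟨ ∑-mono scaled (λ a i → ℕ.≤-reflexive (sym (𝟙-true (N (φ a) ℕ.≟ 0) (N-φ i)))) ⟩
          ∑[ a ← scaled ] Z (φ a)     ≤⟨ ∑-injection (≡-dec ℕ._≟_ (≡-dec ℕ._≟_ (≡-dec ℕ._≟_ ℕ._≟_)))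
                                           (Unique.cartesianProduct⁺ (Unique.map⁺ ℕ.suc-injective (Unique.downFrom⁺ (p ℕ.∸ 1))) 𝓢-unique)
                                           φ (λ {a} _ → ∈-quads⁺ (residue< pp (+ proj₁ a * m₁₁ (M (proj₂ a)))) (residue< pp (+ proj₁ a * m₁₂ (M (proj₂ a))))
                                                          (residue< pp (+ proj₁ a * m₂₁ (M (proj₂ a)))) (residue< pp (+ proj₁ a * m₂₂ (M (proj₂ a)))))
                                           Z φ-injective ⟩
          ∑ quads Z                   ∎
          where open ℕ.≤-Reasoning

        square : ∀ a b → 2 ℕ.* (a ℕ.* b) ≤ a ℕ.* a ℕ.+ b ℕ.* b
        square a b with ℕ.≤-total a b
        ... | inj₁ a≤b with ℕ.m≤n⇒∃[o]m+o≡n a≤b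
        ... | o , refl = ℕ.≤-trans (ℕ.m≤m+n _ (o ℕ.* o)) (ℕ.≤-reflexive (eq a o))
          where
          eq : ∀ a o → 2 ℕ.* (a ℕ.* (a ℕ.+ o)) ℕ.+ o ℕ.* o ≡ a ℕ.* a ℕ.+ (a ℕ.+ o) ℕ.* (a ℕ.+ o)
          eq = ℕ.solve-∀
        square a b | inj₂ b≤a with ℕ.m≤n⇒∃[o]m+o≡n b≤a
        ... | o , refl = ℕ.≤-trans (ℕ.m≤m+n _ (o ℕ.* o)) (ℕ.≤-reflexive (eq b o))
          where
          eq : ∀ b o → 2 ℕ.* ((b ℕ.+ o) ℕ.* b) ℕ.+ o ℕ.* o ≡ (b ℕ.+ o) ℕ.* (b ℕ.+ o) ℕ.+ b ℕ.* b
          eq = ℕ.solve-∀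

        -- This is (p N - K)² ≥ 0 without subtraction, where K / p is the mean of N. At a point with
        -- N = 0 the square equals K², and the term with `Z` retains it.
        pointwise : ∀ x → 2 ℕ.* (p ℕ.* K) ℕ.* N x ℕ.+ K ℕ.* K ℕ.* Z x ≤ p ℕ.* p ℕ.* (N x ℕ.* N x) ℕ.+ K ℕ.* K
        pointwise x = bound (N x)
          where
          eq₀ : ∀ p K → 2 ℕ.* (p ℕ.* K) ℕ.* 0 ℕ.+ K ℕ.* K ℕ.* 1 ≡ p ℕ.* p ℕ.* 0 ℕ.+ K ℕ.* K
          eq₀ = ℕ.solve-∀
          eq₁ : ∀ p K n → 2 ℕ.* (p ℕ.* K) ℕ.* n ℕ.+ K ℕ.* K ℕ.* 0 ≡ 2 ℕ.* (p ℕ.* n ℕ.* K)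
          eq₁ = ℕ.solve-∀
          eq₂ : ∀ p K n → p ℕ.* n ℕ.* (p ℕ.* n) ℕ.+ K ℕ.* K ≡ p ℕ.* p ℕ.* (n ℕ.* n) ℕ.+ K ℕ.* K
          eq₂ = ℕ.solve-∀
          bound : ∀ n → 2 ℕ.* (p ℕ.* K) ℕ.* n ℕ.+ K ℕ.* K ℕ.* 𝟙 (n ℕ.≟ 0) ≤ p ℕ.* p ℕ.* (n ℕ.* n) ℕ.+ K ℕ.* K
          bound zero      = ℕ.≤-reflexive (eq₀ p K)
          bound n@(suc _) = ℕ.≤-trans (ℕ.≤-reflexive (eq₁ p K n)) (ℕ.≤-trans (square (p ℕ.* n) K) (ℕ.≤-reflexive (eq₂ p K n)))

        -- Chebyshev's inequality. The pairs a ≠ b contribute to the second moment no more than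
        -- independent hyperplanes would, so the variance comes from the p³ points of each diagonal
        -- pair; after summation 2 K² p⁴ cancels and K p⁵ remains.
        second-moment : K ℕ.* (K ℕ.* ∑ quads Z) ≤ K ℕ.* (p ℕ.* p⁴)
        second-moment = ℕ.+-cancelˡ-≤ (2 ℕ.* (K ℕ.* K) ℕ.* p⁴) _ _ (begin
          2 ℕ.* (K ℕ.* K) ℕ.* p⁴ ℕ.+ K ℕ.* (K ℕ.* ∑ quads Z)
            ≡⟨ eq₁ p K (∑ quads Z) ⟩
          2 ℕ.* (p ℕ.* K) ℕ.* (K ℕ.* p³) ℕ.+ K ℕ.* K ℕ.* ∑ quads Z
            ≡⟨ cong₂ ℕ._+_ (trans (∑-*ˡ quads (2 ℕ.* (p ℕ.* K)) N) (cong (2 ℕ.* (p ℕ.* K) ℕ.*_) ∑N)) (∑-*ˡ quads (K ℕ.* K) Z) ⟨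
          ∑[ x ← quads ] (2 ℕ.* (p ℕ.* K) ℕ.* N x) ℕ.+ ∑[ x ← quads ] (K ℕ.* K ℕ.* Z x)
            ≡⟨ ∑-+ quads _ _ ⟨
          ∑[ x ← quads ] (2 ℕ.* (p ℕ.* K) ℕ.* N x ℕ.+ K ℕ.* K ℕ.* Z x)
            ≤⟨ ∑-mono quads (λ x _ → pointwise x) ⟩
          ∑[ x ← quads ] (p ℕ.* p ℕ.* (N x ℕ.* N x) ℕ.+ K ℕ.* K)
            ≡⟨ ∑-+ quads _ _ ⟩
          ∑[ x ← quads ] (p ℕ.* p ℕ.* (N x ℕ.* N x)) ℕ.+ ∑[ _ ← quads ] (K ℕ.* K)
            ≡⟨ cong₂ ℕ._+_ (∑-*ˡ quads (p ℕ.* p) (λ x → N x ℕ.* N x)) (trans (∑-const quads (K ℕ.* K)) (cong (ℕ._* (K ℕ.* K)) length-quads)) ⟩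
          p ℕ.* p ℕ.* ∑[ x ← quads ] (N x ℕ.* N x) ℕ.+ p⁴ ℕ.* (K ℕ.* K)
            ≤⟨ ℕ.+-monoˡ-≤ _ (ℕ.*-monoʳ-≤ (p ℕ.* p) ∑N²) ⟩
          p ℕ.* p ℕ.* (K ℕ.* (K ℕ.* p² ℕ.+ p³)) ℕ.+ p⁴ ℕ.* (K ℕ.* K)
            ≡⟨ eq₂ p K ⟩
          2 ℕ.* (K ℕ.* K) ℕ.* p⁴ ℕ.+ K ℕ.* (p ℕ.* p⁴) ∎)
          where
          open ℕ.≤-Reasoning
          eq₁ : ∀ p K Z → 2 ℕ.* (K ℕ.* K) ℕ.* (p ℕ.* (p ℕ.* (p ℕ.* p))) ℕ.+ K ℕ.* (K ℕ.* Z) ≡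
                          2 ℕ.* (p ℕ.* K) ℕ.* (K ℕ.* (p ℕ.* (p ℕ.* p))) ℕ.+ K ℕ.* K ℕ.* Z
          eq₁ = ℕ.solve-∀
          eq₂ : ∀ p K → p ℕ.* p ℕ.* (K ℕ.* (K ℕ.* (p ℕ.* p) ℕ.+ p ℕ.* (p ℕ.* p))) ℕ.+ p ℕ.* (p ℕ.* (p ℕ.* p)) ℕ.* (K ℕ.* K) ≡
                        2 ℕ.* (K ℕ.* K) ℕ.* (p ℕ.* (p ℕ.* (p ℕ.* p))) ℕ.+ K ℕ.* (p ℕ.* (p ℕ.* (p ℕ.* (p ℕ.* p))))
          eq₂ = ℕ.solve-∀

      -- The scaled matrices are (p - 1) |𝓢| different zeros of `N`, and the second moment admits at
      -- most p⁵ / K zeros.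
      incidence-bound : (p ℕ.∸ 1) ℕ.* length 𝓢 ℕ.* (length 𝓐 ℕ.* length 𝓐) ≤ p ℕ.* (p ℕ.* (p ℕ.* (p ℕ.* p)))
      incidence-bound = subst (λ k → (p ℕ.∸ 1) ℕ.* length 𝓢 ℕ.* k ≤ p ℕ.* p⁴) (length-cartesianProduct 𝓐 𝓐) (bound K refl)
        where
        open ℕ.≤-Reasoning
        bound : ∀ k → k ≡ K → (p ℕ.∸ 1) ℕ.* length 𝓢 ℕ.* K ≤ p ℕ.* p⁴
        bound zero    e = ℕ.≤-trans (ℕ.≤-reflexive (trans (cong ((p ℕ.∸ 1) ℕ.* length 𝓢 ℕ.*_) (sym e)) (ℕ.*-zeroʳ ((p ℕ.∸ 1) ℕ.* length 𝓢)))) z≤n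
        bound (suc k) e = begin
          (p ℕ.∸ 1) ℕ.* length 𝓢 ℕ.* K   ≤⟨ ℕ.*-monoˡ-≤ K ∑Z ⟩
          ∑ quads Z ℕ.* K                ≡⟨ ℕ.*-comm (∑ quads Z) K ⟩
          K ℕ.* ∑ quads Z                ≤⟨ ℕ.*-cancelˡ-≤ K {{subst NonZero e _}} second-moment ⟩
          p ℕ.* p⁴                       ∎

-- Words whose matrices satisfy two independent linear relations modulo p.

module Conics where

  open FiniteSums
  open Residues
  open Words
  open Planes using (Mat; mat; m₁₁; m₁₂; m₂₁; m₂₂)
  open import Data.Integer.Base as ℤ renaming (∣_∣ to abs) using (ℤ; +_; _+_; _*_; _-_; -_; 0ℤ; 1ℤ)
  open import Data.Integer.Divisibility.Signed as ℤ∣ using (_∣_; divides; _∣?_; ∣m∣n⇒∣m-n; ∣n⇒∣m*n; ∣m⇒∣m*n; ∣m⇒∣-m)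
  open import Data.Integer.Tactic.RingSolver using (solve-∀)
  open import Data.Nat.Base as ℕ using (ℕ; _≤_; _<_)

  matrix : Word → Mat
  matrix w = mat (+ A w) (+ B w) (+ C w) (+ D w)

  infixl 7 _∙_
  _∙_ : Mat → Mat → ℤ
  mat t₁ t₂ s₁ s₂ ∙ mat a b c d = t₁ * a + t₂ * b + s₁ * c + s₂ * d

  detᶻ : Mat → ℤ
  detᶻ (mat a b c d) = a * d - b * c

  det-matrix : ∀ w → detᶻ (matrix w) ≡ 1ℤ
  det-matrix w = begin
    + A w * + D w - + B w * + C w        ≡⟨ cong₂ _-_ (ℤ.pos-* (A w) (D w)) (ℤ.pos-* (B w) (C w)) ⟨
    + (A w ℕ.* D w) - + (B w ℕ.* C w)    ≡⟨ cong (λ z → + z - + (B w ℕ.* C w)) (det w) ⟩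
    1ℤ + + (B w ℕ.* C w) - + (B w ℕ.* C w) ≡⟨ eq (+ (B w ℕ.* C w)) ⟩
    1ℤ                                   ∎
    where
    open ≡-Reasoning
    eq : ∀ x → 1ℤ + x - x ≡ 1ℤ
    eq = solve-∀

  -- C w / D w is in lowest terms.
  same-fraction : ∀ {w v} → All Positive w → All Positive v → C w ℕ.* D v ≡ C v ℕ.* D w → w ≡ v
  same-fraction {w} {v} p q eq = bottom-injective p q (cong₂ _,_ C≡ D≡)
    where
    divides-D : ∀ w v → C w ℕ.* D v ≡ C v ℕ.* D w → D w ℕ∣.∣ D v
    divides-D w v eq = ℕ∣.∣m+n∣m⇒∣n (subst (D w ℕ∣.∣_) expand (ℕ∣.m∣m*n (A w ℕ.* D v)))
                                   (ℕ∣.n∣m*n (B w ℕ.* C v))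
      where
      open ≡-Reasoning
      ring₁ : ∀ d a d′ → d ℕ.* (a ℕ.* d′) ≡ a ℕ.* d ℕ.* d′
      ring₁ = ℕ.solve-∀
      ring₂ : ∀ b c d′ → (1 ℕ.+ b ℕ.* c) ℕ.* d′ ≡ b ℕ.* (c ℕ.* d′) ℕ.+ d′
      ring₂ = ℕ.solve-∀
      expand : D w ℕ.* (A w ℕ.* D v) ≡ B w ℕ.* C v ℕ.* D w ℕ.+ D v
      expand = begin
        D w ℕ.* (A w ℕ.* D v)              ≡⟨ ring₁ (D w) (A w) (D v) ⟩
        A w ℕ.* D w ℕ.* D v                ≡⟨ cong (ℕ._* D v) (det w) ⟩
        (1 ℕ.+ B w ℕ.* C w) ℕ.* D v        ≡⟨ ring₂ (B w) (C w) (D v) ⟩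
        B w ℕ.* (C w ℕ.* D v) ℕ.+ D v      ≡⟨ cong (λ z → B w ℕ.* z ℕ.+ D v) eq ⟩
        B w ℕ.* (C v ℕ.* D w) ℕ.+ D v      ≡⟨ cong (ℕ._+ D v) (ℕ.*-assoc (B w) (C v) (D w)) ⟨
        B w ℕ.* C v ℕ.* D w ℕ.+ D v        ∎
    D≡ : D w ≡ D v
    D≡ = ℕ∣.∣-antisym (divides-D w v eq) (divides-D v w (sym eq))
    C≡ : C w ≡ C v
    C≡ = ℕ.*-cancelʳ-≡ (C w) (C v) (D w) {{ℕ.>-nonZero (D>0 p)}} (trans (cong (C w ℕ.*_) D≡) eq)

  module _ {p : ℕ} (pp : Prime p) where

    private
      P = + p
      instance _ = prime⇒nonZero pp

    -- Both cross products stay below p, so the congruence is an equality of reduced fractions. This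
    -- is what limits the outer words to denominators below √p.
    fractions-distinct : ∀ {w v} → All Positive w → All Positive v → D w ℕ.* D v < p →
      P ∣ + C w * + D v - + C v * + D w → w ≡ v
    fractions-distinct {w} {v} pos-w pos-v small h = same-fraction pos-w pos-v
      (residue-unique pp (ℕ.≤-<-trans (ℕ.*-monoˡ-≤ (D v) (ℕ.<⇒≤ (C<D pos-w))) small)
        (ℕ.≤-<-trans (ℕ.≤-trans (ℕ.*-monoˡ-≤ (D w) (ℕ.<⇒≤ (C<D pos-v))) (ℕ.≤-reflexive (ℕ.*-comm (D v) (D w)))) small)
        (∣-resp (cong₂ _-_ (sym (ℤ.pos-* (C w) (D v))) (sym (ℤ.pos-* (C v) (D w)))) h))

    -- Any three points of a set with this property lie in at most two residue classes.
    Two : ℤ → ℤ → ℤ → Set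
    Two x y z = P ∣ x - y ⊎ P ∣ x - z ⊎ P ∣ y - z

    -- Which coordinate to fix depends on the curve, because a conic or a line may contain a whole
    -- line in one of the two directions. Either alternative bounds the set by 2 p points.
    Thin : (ℤ → ℤ → Set) → Set
    Thin S = (∀ {c d₁ d₂ d₃} → S c d₁ → S c d₂ → S c d₃ → Two d₁ d₂ d₃) ⊎
             (∀ {d c₁ c₂ c₃} → S c₁ d → S c₂ d → S c₃ d → Two c₁ c₂ c₃)

    Thin-⊆ : ∀ {S T : ℤ → ℤ → Set} → (∀ {c d} → S c d → T c d) → Thin T → Thin S
    Thin-⊆ f (inj₁ h) = inj₁ λ x y z → h (f x) (f y) (f z)
    Thin-⊆ f (inj₂ h) = inj₂ λ x y z → h (f x) (f y) (f z)

    Line : ℤ → ℤ → ℤ → ℤ → Set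
    Line r s c d = P ∣ r * c + s * d

    line-thin : ∀ r s → ¬ (P ∣ r × P ∣ s) → Thin (Line r s)
    line-thin r s n = cases (P ∣? r) (P ∣? s)
      where
      eq₁ : ∀ r s c d d′ → (r * c + s * d) - (r * c + s * d′) ≡ s * (d - d′)
      eq₁ = solve-∀
      eq₂ : ∀ r s c c′ d → (r * c + s * d) - (r * c′ + s * d) ≡ r * (c - c′)
      eq₂ = solve-∀
      cases : Dec (P ∣ r) → Dec (P ∣ s) → Thin (Line r s)
      cases _ (no m) = inj₁ λ {c} {d₁} {d₂} h k _ →
        inj₁ (∣-cancelˡ pp s (d₁ - d₂) m (∣-resp (eq₁ r s c d₁ d₂) (∣m∣n⇒∣m-n h k)))
      cases (no m) (yes _) = inj₂ λ {d} {c₁} {c₂} h k _ →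
        inj₁ (∣-cancelˡ pp r (c₁ - c₂) m (∣-resp (eq₂ r s c₁ c₂ d) (∣m∣n⇒∣m-n h k)))
      cases (yes h) (yes k) = contradiction (h , k) n

    Conic : ℤ → ℤ → ℤ → ℤ → ℤ → ℤ → Set
    Conic r s t e c d = P ∣ r * (d * d) + s * (c * d) + t * (c * c) + e

    -- If d² or c² has a nonzero coefficient, fixing the other variable leaves a quadratic.
    -- Otherwise s c d + e ≡ 0, and e ≢ 0 forces s c ≢ 0, so c determines d.
    conic-thin : ∀ r s t e → P ∤ e → Thin (Conic r s t e)
    conic-thin r s t e p∤e = cases (P ∣? r) (P ∣? t)
      where
      eq₁ : ∀ r s t e c d → r * (d * d) + s * (c * d) + t * (c * c) + e ≡ r * (d * d) + s * c * d + (t * (c * c) + e)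
      eq₁ = solve-∀
      eq₂ : ∀ r s t e c d → r * (d * d) + s * (c * d) + t * (c * c) + e ≡ t * (c * c) + s * d * c + (r * (d * d) + e)
      eq₂ = solve-∀
      eq₃ : ∀ r s t e c d → (r * (d * d) + s * (c * d) + t * (c * c) + e) - (d * d * r + c * c * t) ≡ s * c * d + e
      eq₃ = solve-∀
      eq₄ : ∀ u d d′ e → (u * d + e) - (u * d′ + e) ≡ u * (d - d′)
      eq₄ = solve-∀
      eq₅ : ∀ x e → (x + e) - x ≡ e
      eq₅ = solve-∀
      cases : Dec (P ∣ r) → Dec (P ∣ t) → Thin (Conic r s t e)
      cases (no n) _ = inj₁ λ {c} {d₁} {d₂} {d₃} h₁ h₂ h₃ →
        quadratic-roots pp r (s * c) (t * (c * c) + e) d₁ d₂ d₃ n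
          (∣-resp (eq₁ r s t e c d₁) h₁) (∣-resp (eq₁ r s t e c d₂) h₂) (∣-resp (eq₁ r s t e c d₃) h₃)
      cases (yes _) (no n) = inj₂ λ {d} {c₁} {c₂} {c₃} h₁ h₂ h₃ →
        quadratic-roots pp t (s * d) (r * (d * d) + e) c₁ c₂ c₃ n
          (∣-resp (eq₂ r s t e c₁ d) h₁) (∣-resp (eq₂ r s t e c₂ d) h₂) (∣-resp (eq₂ r s t e c₃ d) h₃)
      cases (yes p∣r) (yes p∣t) = inj₁ λ {c} {d₁} {d₂} h₁ h₂ _ →
        inj₁ (∣-cancelˡ pp (s * c) (d₁ - d₂) (nonzero c d₁ (simple c d₁ h₁))
          (∣-resp (eq₄ (s * c) d₁ d₂ e) (∣m∣n⇒∣m-n (simple c d₁ h₁) (simple c d₂ h₂))))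
        where
        simple : ∀ c d → Conic r s t e c d → P ∣ s * c * d + e
        simple c d h = ∣-resp (eq₃ r s t e c d) (∣m∣n⇒∣m-n h (∣-combination (d * d) (c * c) p∣r p∣t))
        nonzero : ∀ c d → P ∣ s * c * d + e → P ∤ s * c
        nonzero c d h k = p∤e (∣-resp (eq₅ (s * c * d) e) (∣m∣n⇒∣m-n h (∣m⇒∣m*n d k)))

    Independent : Mat → Mat → Set
    Independent F G = ∀ u v →
      P ∣ u * m₁₁ F + v * m₁₁ G → P ∣ u * m₁₂ F + v * m₁₂ G →
      P ∣ u * m₂₁ F + v * m₂₁ G → P ∣ u * m₂₂ F + v * m₂₂ G → P ∣ u × P ∣ v

    Section : Mat → Mat → ℤ → ℤ → Set
    Section F G c d = Σ[ a ∈ ℤ ] Σ[ b ∈ ℤ ] a * d - b * c ≡ 1ℤ × P ∣ F ∙ mat a b c d × P ∣ G ∙ mat a b c d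

    -- Eliminating the top row from a d − b c = 1 leaves a conic in (c , d), or a line when it cannot be eliminated.
    section-thin : ∀ F G → Independent F G → Thin (Section F G)
    section-thin F@(mat t₁ t₂ s₁ s₂) G@(mat t₁′ t₂′ s₁′ s₂′) ind = cases (P ∣? Δ) (P ∣? t₁) (P ∣? t₂)
      where
      Δ = t₁ * t₂′ - t₂ * t₁′
      α₁ = t₂′ * s₁ - t₂ * s₁′
      α₂ = t₂′ * s₂ - t₂ * s₂′
      β₁ = t₁ * s₁′ - t₁′ * s₁
      β₂ = t₁ * s₂′ - t₁′ * s₂
      eliminate-b : ∀ t₁ t₂ s₁ s₂ t₁′ t₂′ s₁′ s₂′ a b c d →
        t₂′ * (t₁ * a + t₂ * b + s₁ * c + s₂ * d) - t₂ * (t₁′ * a + t₂′ * b + s₁′ * c + s₂′ * d) ≡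
        (t₁ * t₂′ - t₂ * t₁′) * a + ((t₂′ * s₁ - t₂ * s₁′) * c + (t₂′ * s₂ - t₂ * s₂′) * d)
      eliminate-b = solve-∀
      eliminate-a : ∀ t₁ t₂ s₁ s₂ t₁′ t₂′ s₁′ s₂′ a b c d →
        t₁ * (t₁′ * a + t₂′ * b + s₁′ * c + s₂′ * d) - t₁′ * (t₁ * a + t₂ * b + s₁ * c + s₂ * d) ≡
        (t₁ * t₂′ - t₂ * t₁′) * b + ((t₁ * s₁′ - t₁′ * s₁) * c + (t₁ * s₂′ - t₁′ * s₂) * d)
      eliminate-a = solve-∀
      first : ∀ {a b c d} → P ∣ F ∙ mat a b c d → P ∣ G ∙ mat a b c d → P ∣ Δ * a + (α₁ * c + α₂ * d)
      first {a} {b} {c} {d} h k = ∣-resp (eliminate-b t₁ t₂ s₁ s₂ t₁′ t₂′ s₁′ s₂′ a b c d) (∣m∣n⇒∣m-n (∣n⇒∣m*n t₂′ h) (∣n⇒∣m*n t₂ k))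
      second : ∀ {a b c d} → P ∣ F ∙ mat a b c d → P ∣ G ∙ mat a b c d → P ∣ Δ * b + (β₁ * c + β₂ * d)
      second {a} {b} {c} {d} h k = ∣-resp (eliminate-a t₁ t₂ s₁ s₂ t₁′ t₂′ s₁′ s₂′ a b c d) (∣m∣n⇒∣m-n (∣n⇒∣m*n t₁ k) (∣n⇒∣m*n t₁′ h))
      drop : ∀ x y → P ∣ x → P ∣ x + y → P ∣ y
      drop x y h k = ∣-resp (eq x y) (∣m∣n⇒∣m-n k h)
        where
        eq : ∀ x y → (x + y) - x ≡ y
        eq = solve-∀
      cases : Dec (P ∣ Δ) → Dec (P ∣ t₁) → Dec (P ∣ t₂) → Thin (Section F G)
      -- By Cramer's rule Δ a and Δ b are linear forms in (c , d), and d (Δ a) - c (Δ b) = Δ turns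
      -- them into a conic with nonzero constant term.
      cases (no n) _ _ = Thin-⊆ into (conic-thin α₂ (α₁ - β₂) (- β₁) Δ n)
        where
        eq : ∀ e α₁ α₂ β₁ β₂ a b c d → d * (e * a + (α₁ * c + α₂ * d)) + (- c) * (e * b + (β₁ * c + β₂ * d)) ≡
          α₂ * (d * d) + (α₁ - β₂) * (c * d) + (- β₁) * (c * c) + e * (a * d - b * c)
        eq = solve-∀
        into : ∀ {c d} → Section F G c d → Conic α₂ (α₁ - β₂) (- β₁) Δ c d
        into {c} {d} (a , b , det≡1 , h , k) = ∣-resp
          (trans (eq Δ α₁ α₂ β₁ β₂ a b c d)
                 (cong (λ z → α₂ * (d * d) + (α₁ - β₂) * (c * d) + (- β₁) * (c * c) + z)
                       (trans (cong (λ z → Δ * z) det≡1) (ℤ.*-identityʳ Δ))))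
          (∣-combination d (- c) (first {a} {b} h k) (second {a} {b} h k))
      -- With Δ ≡ 0 the elimination of b also removes a and leaves a line. Were it trivial, (t₂′ , -
      -- t₂) would be a linear dependence between `F` and `G`, hence t₂ ≡ 0.
      cases (yes p∣Δ) _ (no n) = Thin-⊆ into (line-thin α₁ α₂ nontrivial)
        where
        into : ∀ {c d} → Section F G c d → Line α₁ α₂ c d
        into {c} {d} (a , b , _ , h , k) = drop (Δ * a) (α₁ * c + α₂ * d) (∣m⇒∣m*n a p∣Δ) (first {a} {b} h k)
        eq₁ : ∀ t₁ t₂ t₁′ t₂′ → t₁ * t₂′ - t₂ * t₁′ ≡ t₂′ * t₁ + (- t₂) * t₁′
        eq₁ = solve-∀
        eq₂ : ∀ t₂ t₂′ → 0ℤ ≡ t₂′ * t₂ + (- t₂) * t₂′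
        eq₂ = solve-∀
        eq₃ : ∀ t₂ t₂′ s s′ → t₂′ * s - t₂ * s′ ≡ t₂′ * s + (- t₂) * s′
        eq₃ = solve-∀
        nontrivial : ¬ (P ∣ α₁ × P ∣ α₂)
        nontrivial (h , k) = n (∣-resp (ℤ.neg-involutive t₂) (∣m⇒∣-m (proj₂ (ind t₂′ (- t₂)
          (∣-resp (eq₁ t₁ t₂ t₁′ t₂′) p∣Δ) (∣-resp (eq₂ t₂ t₂′) (divides 0ℤ refl))
          (∣-resp (eq₃ t₂ t₂′ s₁ s₁′) h) (∣-resp (eq₃ t₂ t₂′ s₂ s₂′) k)))))
      cases (yes p∣Δ) (no n) (yes _) = Thin-⊆ into (line-thin β₁ β₂ nontrivial)
        where
        into : ∀ {c d} → Section F G c d → Line β₁ β₂ c d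
        into {c} {d} (a , b , _ , h , k) = drop (Δ * b) (β₁ * c + β₂ * d) (∣m⇒∣m*n b p∣Δ) (second {a} {b} h k)
        eq₁ : ∀ t₁ t₂ t₁′ t₂′ → t₁ * t₂′ - t₂ * t₁′ ≡ (- t₁′) * t₂ + t₁ * t₂′
        eq₁ = solve-∀
        eq₂ : ∀ t₁ t₁′ → 0ℤ ≡ (- t₁′) * t₁ + t₁ * t₁′
        eq₂ = solve-∀
        eq₃ : ∀ t₁ t₁′ s s′ → t₁ * s′ - t₁′ * s ≡ (- t₁′) * s + t₁ * s′
        eq₃ = solve-∀
        nontrivial : ¬ (P ∣ β₁ × P ∣ β₂)
        nontrivial (h , k) = n (proj₂ (ind (- t₁′) t₁
          (∣-resp (eq₂ t₁ t₁′) (divides 0ℤ refl)) (∣-resp (eq₁ t₁ t₂ t₁′ t₂′) p∣Δ)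
          (∣-resp (eq₃ t₁ t₁′ s₁ s₁′) h) (∣-resp (eq₃ t₁ t₁′ s₂ s₂′) k)))
      -- The form `F` itself involves only (c , d) here, and independence makes it nonzero.
      cases (yes p∣Δ) (yes p∣t₁) (yes p∣t₂) = Thin-⊆ into (line-thin s₁ s₂ nontrivial)
        where
        eq : ∀ t₁ t₂ s₁ s₂ a b c d → (t₁ * a + t₂ * b + s₁ * c + s₂ * d) - (a * t₁ + b * t₂) ≡ s₁ * c + s₂ * d
        eq = solve-∀
        into : ∀ {c d} → Section F G c d → Line s₁ s₂ c d
        into {c} {d} (a , b , _ , h , _) = ∣-resp (eq t₁ t₂ s₁ s₂ a b c d) (∣m∣n⇒∣m-n h (∣-combination a b p∣t₁ p∣t₂))
        eq₁ : ∀ t u → t ≡ 1ℤ * t + 0ℤ * u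
        eq₁ = solve-∀
        nontrivial : ¬ (P ∣ s₁ × P ∣ s₂)
        nontrivial (h , k) = p∤1 pp (proj₁ (ind 1ℤ 0ℤ
          (∣-resp (eq₁ t₁ t₁′) p∣t₁) (∣-resp (eq₁ t₂ t₂′) p∣t₂)
          (∣-resp (eq₁ s₁ s₁′) h) (∣-resp (eq₁ s₂ s₂′) k)))

    opaque
      on-section? : ∀ F G w → Dec (P ∣ F ∙ matrix w × P ∣ G ∙ matrix w)
      on-section? F G w = (P ∣? F ∙ matrix w) ×-dec (P ∣? G ∙ matrix w)

    -- Entries below p are determined by their residues and words by their bottom rows, so thinness
    -- leaves at most two words for each of the p values of C or of D.
    count-section : ∀ {𝓤} → Unique 𝓤 → (∀ {w} → w ∈ 𝓤 → All Positive w) → (∀ {w} → w ∈ 𝓤 → D w < p) →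
      ∀ F G → Independent F G → count (on-section? F G) 𝓤 ≤ p ℕ.* 2
    count-section {𝓤} unique positive small F G ind = cases (section-thin F G ind)
      where
      solutions = filter (on-section? F G) 𝓤
      s-unique : Unique solutions
      s-unique = Unique.filter⁺ (on-section? F G) unique
      s∈ : ∀ {w} → w ∈ solutions → w ∈ 𝓤
      s∈ i = proj₁ (∈-filter⁻ (on-section? F G) {xs = 𝓤} i)
      section : ∀ {w} → w ∈ solutions → Section F G (+ C w) (+ D w)
      section {w} i = + A w , + B w , det-matrix w , proj₂ (∈-filter⁻ (on-section? F G) {xs = 𝓤} i)
      C< : ∀ {w} → w ∈ solutions → C w < p
      C< i = ℕ.<-trans (C<D (positive (s∈ i))) (small (s∈ i))
      D< : ∀ {w} → w ∈ solutions → D w < p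
      D< i = small (s∈ i)
      equal : ∀ {w v} → w ∈ solutions → v ∈ solutions → C w ≡ C v → D w ≡ D v → w ≡ v
      equal i j e e′ = bottom-injective (positive (s∈ i)) (positive (s∈ j)) (cong₂ _,_ e e′)
      finish : length solutions ≤ length (upTo p) ℕ.* 2 → count (on-section? F G) 𝓤 ≤ p ℕ.* 2
      finish = subst₂ _≤_ (length-filter-∑ (on-section? F G) 𝓤) (cong (ℕ._* 2) (length-upTo p))
      cases : Thin (Section F G) → count (on-section? F G) 𝓤 ≤ p ℕ.* 2
      cases (inj₁ thin) = finish (length-two-to-one ℕ._≟_ s-unique C (λ i → ∈-upTo⁺ (C< i)) fibre)
        where
        fibre : ∀ {x y z} → x ∈ solutions → y ∈ solutions → z ∈ solutions → C x ≡ C y → C x ≡ C z → x ≡ y ⊎ x ≡ z ⊎ y ≡ z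
        fibre {x} {y} {z} i j k e e′ = conclude (thin {+ C x} {+ D x} {+ D y} {+ D z} (section i)
            (subst (λ c → Section F G (+ c) (+ D y)) (sym e) (section j)) (subst (λ c → Section F G (+ c) (+ D z)) (sym e′) (section k)))
          where
          conclude : Two (+ D x) (+ D y) (+ D z) → x ≡ y ⊎ x ≡ z ⊎ y ≡ z
          conclude (inj₁ h)        = inj₁ (equal i j e (residue-unique pp (D< i) (D< j) h))
          conclude (inj₂ (inj₁ h)) = inj₂ (inj₁ (equal i k e′ (residue-unique pp (D< i) (D< k) h)))
          conclude (inj₂ (inj₂ h)) = inj₂ (inj₂ (equal j k (trans (sym e) e′) (residue-unique pp (D< j) (D< k) h)))
      cases (inj₂ thin) = finish (length-two-to-one ℕ._≟_ s-unique D (λ i → ∈-upTo⁺ (D< i)) fibre)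
        where
        fibre : ∀ {x y z} → x ∈ solutions → y ∈ solutions → z ∈ solutions → D x ≡ D y → D x ≡ D z → x ≡ y ⊎ x ≡ z ⊎ y ≡ z
        fibre {x} {y} {z} i j k e e′ = conclude (thin {+ D x} {+ C x} {+ C y} {+ C z} (section i)
            (subst (λ d → Section F G (+ C y) (+ d)) (sym e) (section j)) (subst (λ d → Section F G (+ C z) (+ d)) (sym e′) (section k)))
          where
          conclude : Two (+ C x) (+ C y) (+ C z) → x ≡ y ⊎ x ≡ z ⊎ y ≡ z
          conclude (inj₁ h)        = inj₁ (equal i j (residue-unique pp (C< i) (C< j) h) e)
          conclude (inj₂ (inj₁ h)) = inj₂ (inj₁ (equal i k (residue-unique pp (C< i) (C< k) h) e′))
          conclude (inj₂ (inj₂ h)) = inj₂ (inj₂ (equal j k (residue-unique pp (C< j) (C< k) h) (trans (sym e) e′)))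

-- Integral linear relations of rank 1.

module DegenerateForms where

  open FiniteSums
  open Words
  open Planes using (Mat; mat; m₁₁; m₁₂; m₂₁; m₂₂)
  open Conics using (matrix; _∙_; detᶻ; det-matrix)
  open import Data.Integer.Base as ℤ renaming (∣_∣ to abs) using (ℤ; +_; _+_; _*_; _-_; -_; 0ℤ; 1ℤ)
  open import Data.Integer.Tactic.RingSolver using (solve-∀)
  open import Data.Nat.Base as ℕ using (ℕ; suc; _≤_; _<_; s≤s; z≤n)

  abs-≡ : ∀ x y → abs x ≡ abs y → x ≡ y ⊎ x ≡ - y
  abs-≡ (+ m)        (+ n)        e = inj₁ (cong +_ e)
  abs-≡ (+ suc m)    ℤ.-[1+ n ]   e = inj₂ (cong +_ e)
  abs-≡ ℤ.-[1+ m ]   (+ suc n)    e = inj₂ (cong -_ (cong +_ e))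
  abs-≡ ℤ.-[1+ m ]   ℤ.-[1+ n ]   e = inj₁ (cong -_ (cong +_ e))

  Zero : Mat → Set
  Zero F = m₁₁ F ≡ 0ℤ × m₁₂ F ≡ 0ℤ × m₂₁ F ≡ 0ℤ × m₂₂ F ≡ 0ℤ

  module _ {I : Set} {𝓖 : List I} (unique : Unique 𝓖) (g : I → Word)
    (injective : ∀ {i j} → i ∈ 𝓖 → j ∈ 𝓖 → C (g i) ≡ C (g j) → D (g i) ≡ D (g j) → i ≡ j)
    (positive : ∀ {i} → i ∈ 𝓖 → All Positive (g i))
    {p : ℕ} (small : ∀ {i} → i ∈ 𝓖 → D (g i) < p) where

    vanishes? : ∀ F i → Dec (F ∙ matrix (g i) ≡ 0ℤ)
    vanishes? F i = F ∙ matrix (g i) ℤ.≟ 0ℤ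

    -- If α ≠ 0, the factorisation makes X = α c + β d a divisor of α², so |X| ≤ Y². The pair (D ,
    -- |X|) then determines the word up to the sign of X. This gives p (Y² + 1) keys with at most
    -- two words each.
    count-degenerate : ∀ F Y → 1 ≤ Y → abs (m₁₁ F) ≤ Y → abs (m₁₂ F) ≤ Y → detᶻ F ≡ 0ℤ → ¬ Zero F →
      count (vanishes? F) 𝓖 ≤ p ℕ.* suc (Y ℕ.* Y) ℕ.* 2
    count-degenerate F@(mat α β γ δ) Y 1≤Y α≤Y β≤Y det≡0 F≢0 = cases (α ℤ.≟ 0ℤ) (β ℤ.≟ 0ℤ)
      where
      solutions = filter (vanishes? F) 𝓖
      s-unique : Unique solutions
      s-unique = Unique.filter⁺ (vanishes? F) unique
      s∈ : ∀ {i} → i ∈ solutions → i ∈ 𝓖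
      s∈ i = proj₁ (∈-filter⁻ (vanishes? F) {xs = 𝓖} i)
      s≡0 : ∀ {i} → i ∈ solutions → F ∙ matrix (g i) ≡ 0ℤ
      s≡0 i = proj₂ (∈-filter⁻ (vanishes? F) {xs = 𝓖} i)
      targets : List (ℕ × ℕ)
      targets = cartesianProduct (upTo p) (upTo (suc (Y ℕ.* Y)))
      ∈-targets : ∀ {x y} → x < p → y ≤ Y ℕ.* Y → (x , y) ∈ targets
      ∈-targets x< y≤ = ∈-cartesianProduct⁺ (∈-upTo⁺ x<) (∈-upTo⁺ (s≤s y≤))
      finish : length solutions ≤ length targets ℕ.* 2 → count (vanishes? F) 𝓖 ≤ p ℕ.* suc (Y ℕ.* Y) ℕ.* 2
      finish = subst₂ _≤_ (length-filter-∑ (vanishes? F) 𝓖)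
        (cong (ℕ._* 2) (trans (length-cartesianProduct (upTo p) (upTo (suc (Y ℕ.* Y))))
          (cong₂ ℕ._*_ (length-upTo p) (length-upTo (suc (Y ℕ.* Y))))))
      X : I → ℤ
      X i = α * + C (g i) + β * + D (g i)
      c d : I → ℤ
      c i = + C (g i)
      d i = + D (g i)
      d≢0 : ∀ {i} → i ∈ solutions → d i ≢ 0ℤ
      d≢0 i e = ℕ.<⇒≢ (D>0 (positive (s∈ i))) (sym (ℤ.+-injective e))
      same : ∀ {i j} → i ∈ solutions → j ∈ solutions → c i ≡ c j → D (g i) ≡ D (g j) → i ≡ j
      same i j e e′ = injective (s∈ i) (s∈ j) (ℤ.+-injective e) e′

      factor : ∀ a b c d → a * d - b * c ≡ 1ℤ → F ∙ mat a b c d ≡ 0ℤ →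
        (α * c + β * d) * (α * b + γ * d) ≡ - (α * α)
      factor a b c d det≡1 F≡0 = trans (ring α β γ δ a b c d)
        (trans (cong₂ (λ x y → α * d * x - α * α * y - detᶻ F * d * d) F≡0 det≡1)
        (trans (cong (λ x → α * d * 0ℤ - α * α * 1ℤ - x * d * d) det≡0) (ring′ α d)))
        where
        ring : ∀ α β γ δ a b c d → (α * c + β * d) * (α * b + γ * d) ≡
          α * d * (α * a + β * b + γ * c + δ * d) - α * α * (a * d - b * c) - (α * δ - β * γ) * d * d
        ring = solve-∀
        ring′ : ∀ α d → α * d * 0ℤ - α * α * 1ℤ - 0ℤ * d * d ≡ - (α * α)
        ring′ = solve-∀

      abs-bound : ∀ x y z → z ≢ 0ℤ → x * y ≡ - (z * z) → abs z ≤ Y → abs x ≤ Y ℕ.* Y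
      abs-bound x y z z≢0 e z≤Y = ℕ.≤-trans (ℕ∣.∣⇒≤ {{ℕ.≢-nonZero nonzero}} (ℕ∣.divides (abs y) e′)) (ℕ.*-mono-≤ z≤Y z≤Y)
        where
        e′ : abs z ℕ.* abs z ≡ abs y ℕ.* abs x
        e′ = trans (sym (ℤ.abs-* z z)) (trans (sym (ℤ.∣-i∣≡∣i∣ (z * z))) (trans (cong abs (sym e))
             (trans (ℤ.abs-* x y) (ℕ.*-comm (abs x) (abs y)))))
        nonzero : abs z ℕ.* abs z ≢ 0
        nonzero h with ℕ.m*n≡0⇒m≡0∨n≡0 (abs z) h
        ... | inj₁ k = z≢0 (ℤ.∣i∣≡0⇒i≡0 k)
        ... | inj₂ k = z≢0 (ℤ.∣i∣≡0⇒i≡0 k)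

      cancel : ∀ x y z → x ≢ 0ℤ → x * y ≡ x * z → y ≡ z
      cancel x y z x≢0 = ℤ.*-cancelˡ-≡ x y z {{ℤ.≢-nonZero x≢0}}

      cases : Dec (α ≡ 0ℤ) → Dec (β ≡ 0ℤ) → count (vanishes? F) 𝓖 ≤ p ℕ.* suc (Y ℕ.* Y) ℕ.* 2
      cases (no α≢0) _ = finish (length-two-to-one (≡-dec ℕ._≟_ ℕ._≟_) s-unique (λ i → D (g i) , abs (X i)) into fibre)
        where
        into : ∀ {i} → i ∈ solutions → (D (g i) , abs (X i)) ∈ targets
        into {i} m = ∈-targets (small (s∈ m)) (abs-bound (X i) (α * + B (g i) + γ * + D (g i)) α α≢0
          (factor (+ A (g i)) (+ B (g i)) (+ C (g i)) (+ D (g i)) (det-matrix (g i)) (s≡0 m)) α≤Y)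
        determined : ∀ {i j} → i ∈ solutions → j ∈ solutions → D (g i) ≡ D (g j) → X i ≡ X j → i ≡ j
        determined {i} {j} m n e e′ = same m n (cancel α (c i) (c j) α≢0
          (trans (sym (ring (α * c i) (β * d i))) (trans (cong₂ (λ x y → x - β * + y) e′ e) (ring (α * c j) (β * d j))))) e
          where
          ring : ∀ x y → x + y - y ≡ x
          ring = solve-∀
        ±-cases : ∀ x y z → x ≡ y ⊎ x ≡ - y → x ≡ z ⊎ x ≡ - z → x ≡ y ⊎ x ≡ z ⊎ y ≡ z
        ±-cases x y z (inj₁ e) _ = inj₁ e
        ±-cases x y z (inj₂ _) (inj₁ e) = inj₂ (inj₁ e)
        ±-cases x y z (inj₂ e) (inj₂ f) = inj₂ (inj₂ (ℤ.neg-injective (trans (sym e) f)))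
        fibre : ∀ {i j k} → i ∈ solutions → j ∈ solutions → k ∈ solutions →
          (D (g i) , abs (X i)) ≡ (D (g j) , abs (X j)) → (D (g i) , abs (X i)) ≡ (D (g k) , abs (X k)) → i ≡ j ⊎ i ≡ k ⊎ j ≡ k
        fibre {i} {j} {k} l m n e f = conclude (±-cases (X i) (X j) (X k)
            (abs-≡ (X i) (X j) (cong proj₂ e)) (abs-≡ (X i) (X k) (cong proj₂ f)))
          where
          conclude : X i ≡ X j ⊎ X i ≡ X k ⊎ X j ≡ X k → i ≡ j ⊎ i ≡ k ⊎ j ≡ k
          conclude (inj₁ h)        = inj₁ (determined l m (cong proj₁ e) h)
          conclude (inj₂ (inj₁ h)) = inj₂ (inj₁ (determined l n (cong proj₁ f) h))
          conclude (inj₂ (inj₂ h)) = inj₂ (inj₂ (determined m n (trans (sym (cong proj₁ e)) (cong proj₁ f)) h))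
      -- The relation is γ c + δ d = 0. Here γ ≠ 0, since otherwise δ d = 0 and `F` would vanish, so
      -- d determines c.
      cases (yes α≡0) (yes β≡0) = finish (ℕ.≤-trans
        (length-injection (≡-dec ℕ._≟_ ℕ._≟_) s-unique (λ i → D (g i) , 0) (λ m → ∈-targets (small (s∈ m)) z≤n)
          λ m n e → determined m n (cong proj₁ e)) (ℕ.m≤m*n (length targets) 2))
        where
        line : ∀ a b c d → F ∙ mat a b c d ≡ 0ℤ → γ * c + δ * d ≡ 0ℤ
        line a b c d e = trans (ring a b γ c δ d) (trans (cong₂ (λ x y → x * a + y * b + γ * c + δ * d) (sym α≡0) (sym β≡0)) e)
          where
          ring : ∀ a b γ c δ d → γ * c + δ * d ≡ 0ℤ * a + 0ℤ * b + γ * c + δ * d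
          ring = solve-∀
        on-line : ∀ {i} → i ∈ solutions → γ * c i + δ * d i ≡ 0ℤ
        on-line {i} m = line (+ A (g i)) (+ B (g i)) (c i) (d i) (s≡0 m)
        γ≢0 : ∀ {i} → i ∈ solutions → γ ≢ 0ℤ
        γ≢0 {i} m γ≡0 = F≢0 (α≡0 , β≡0 , γ≡0 , cancel (d i) δ 0ℤ (d≢0 m)
          (trans (ring (c i) δ (d i)) (trans (cong (λ x → x * c i + δ * d i) (sym γ≡0)) (trans (on-line m) (sym (ℤ.*-zeroʳ (d i)))))))
          where
          ring : ∀ c δ d → d * δ ≡ 0ℤ * c + δ * d
          ring = solve-∀
        determined : ∀ {i j} → i ∈ solutions → j ∈ solutions → D (g i) ≡ D (g j) → i ≡ j
        determined {i} {j} m n e = same m n (cancel γ (c i) (c j) (γ≢0 m)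
          (trans (ring (γ * c i) (δ * d i)) (trans (cong₂ (λ x y → x - δ * + y) (trans (on-line m) (sym (on-line n))) e) (sym (ring (γ * c j) (δ * d j)))))) e
          where
          ring : ∀ x y → x ≡ x + y - y
          ring = solve-∀
      -- Vanishing of the determinant gives γ = 0, and then d divides β. So D ≤ Y ≤ Y², and the pair
      -- (C , D) fits into the same list of keys.
      cases (yes α≡0) (no β≢0) = finish (ℕ.≤-trans
        (length-injection (≡-dec ℕ._≟_ ℕ._≟_) s-unique (λ i → C (g i) , D (g i))
          (λ {i} m → ∈-targets (ℕ.<-trans (C<D (positive (s∈ m))) (small (s∈ m)))
             (ℕ.≤-trans (D≤Y {i} m) (ℕ.m≤m*n Y Y {{ℕ.>-nonZero 1≤Y}})))
          λ m n e → same m n (cong (+_ ∘ proj₁) e) (cong proj₂ e)) (ℕ.m≤m*n (length targets) 2))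
        where
        γ≡0 : γ ≡ 0ℤ
        γ≡0 = cancel β γ 0ℤ β≢0 (trans (ring β γ δ) (trans (cong (λ x → x * δ - (x * δ - β * γ)) (sym α≡0))
            (trans (cong (λ x → α * δ - x) det≡0) (trans (cong (λ x → x * δ - 0ℤ) α≡0) (ring′ β δ)))))
          where
          ring : ∀ β γ δ → β * γ ≡ 0ℤ * δ - (0ℤ * δ - β * γ)
          ring = solve-∀
          ring′ : ∀ β δ → 0ℤ * δ - 0ℤ ≡ β * 0ℤ
          ring′ = solve-∀
        -- From β b + δ d = 0 and a d − b c = 1, d divides β.
        divisor : ∀ a b c d → a * d - b * c ≡ 1ℤ → F ∙ mat a b c d ≡ 0ℤ → β ≡ (β * a + δ * c) * d
        divisor a b c d det≡1 F≡0 = trans (sym (ℤ.*-identityʳ β)) (trans (cong (λ x → β * x) (sym det≡1))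
          (trans (ring β δ a b c d) (trans (cong₂ (λ x y → (β * a + δ * c) * d - c * (x * a + β * b + y * c + δ * d)) (sym α≡0) (sym γ≡0))
          (trans (cong (λ x → (β * a + δ * c) * d - c * x) F≡0) (ring′ ((β * a + δ * c) * d) c)))))
          where
          ring : ∀ β δ a b c d → β * (a * d - b * c) ≡ (β * a + δ * c) * d - c * (0ℤ * a + β * b + 0ℤ * c + δ * d)
          ring = solve-∀
          ring′ : ∀ x c → x - c * 0ℤ ≡ x
          ring′ = solve-∀
        D≤Y : ∀ {i} → i ∈ solutions → D (g i) ≤ Y
        D≤Y {i} m = ℕ.≤-trans (ℕ∣.∣⇒≤ {{ℕ.≢-nonZero (β≢0 ∘ ℤ.∣i∣≡0⇒i≡0)}} (ℕ∣.divides (abs (β * + A (g i) + δ * + C (g i)))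
          (trans (cong abs (divisor (+ A (g i)) (+ B (g i)) (+ C (g i)) (+ D (g i)) (det-matrix (g i)) (s≡0 m)))
                 (ℤ.abs-* (β * + A (g i) + δ * + C (g i)) (+ D (g i)))))) β≤Y

-- Products g h that are pairwise distinct modulo p up to scalars.

module Products where

  open FiniteSums
  open Residues
  open Words
  open Planes using (Mat; mat; m₁₁; m₁₂; m₂₁; m₂₂)
  open Conics
  open DegenerateForms
  open import Data.Integer.Base as ℤ renaming (∣_∣ to abs) using (ℤ; +_; _+_; _*_; _-_; -_; 0ℤ; 1ℤ; -1ℤ)
  open import Data.Integer.Divisibility.Signed as ℤ∣ using (_∣_; divides; _∣?_; ∣m∣n⇒∣m+n; ∣m∣n⇒∣m-n; ∣m⇒∣m*n)
  open import Data.Integer.Tactic.RingSolver using (solve-∀)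
  open import Data.Nat.Base as ℕ using (ℕ; suc; _≤_; _<_; s≤s; z≤n)
  import Data.List.Properties as List

  _≟ʷ_ : DecidableEquality Word
  _≟ʷ_ = List.≡-dec (≡-dec ℕ._≟_ ℕ._≟_)

  -- This is F hᵀ. Since F ∙ X is the trace of Fᵀ X, it is the form whose value at g is the value of
  -- `F` at g h.
  twist : Mat → Mat → Mat
  twist (mat f₁ f₂ f₃ f₄) (mat a b c d) = mat (f₁ * a + f₂ * b) (f₁ * c + f₂ * d) (f₃ * a + f₄ * b) (f₃ * c + f₄ * d)

  pos-dot : ∀ a b c d → + (a ℕ.* b ℕ.+ c ℕ.* d) ≡ + a * + b + + c * + d
  pos-dot a b c d = trans (ℤ.pos-+ (a ℕ.* b) (c ℕ.* d)) (cong₂ _+_ (ℤ.pos-* a b) (ℤ.pos-* c d))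

  twist-∙ : ∀ F g h → twist F (matrix h) ∙ matrix g ≡ F ∙ matrix (g ++ h)
  twist-∙ (mat f₁ f₂ f₃ f₄) g h = trans
    (ring f₁ f₂ f₃ f₄ (+ A g) (+ B g) (+ C g) (+ D g) (+ A h) (+ B h) (+ C h) (+ D h))
    (cong₂ _+_ (cong₂ _+_ (cong₂ _+_ (cong (λ z → f₁ * z) (sym (entry (A g) (A h) (B g) (C h) (A-++ g h))))
                                      (cong (λ z → f₂ * z) (sym (entry (A g) (B h) (B g) (D h) (B-++ g h)))))
                                      (cong (λ z → f₃ * z) (sym (entry (C g) (A h) (D g) (C h) (C-++ g h)))))
                                      (cong (λ z → f₄ * z) (sym (entry (C g) (B h) (D g) (D h) (D-++ g h)))))
    where
    entry : ∀ {x} a b c d → x ≡ a ℕ.* b ℕ.+ c ℕ.* d → + x ≡ + a * + b + + c * + d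
    entry a b c d e = trans (cong +_ e) (pos-dot a b c d)
    ring : ∀ f₁ f₂ f₃ f₄ a b c d a′ b′ c′ d′ →
      (f₁ * a′ + f₂ * b′) * a + (f₁ * c′ + f₂ * d′) * b + (f₃ * a′ + f₄ * b′) * c + (f₃ * c′ + f₄ * d′) * d ≡
      f₁ * (a * a′ + b * c′) + f₂ * (a * b′ + b * d′) + f₃ * (c * a′ + d * c′) + f₄ * (c * b′ + d * d′)
    ring = solve-∀

  det-twist : ∀ F h → detᶻ h ≡ 1ℤ → detᶻ (twist F h) ≡ detᶻ F
  det-twist (mat f₁ f₂ f₃ f₄) (mat a b c d) e = trans (ring f₁ f₂ f₃ f₄ a b c d)
    (trans (cong (λ z → (f₁ * f₄ - f₂ * f₃) * z) e) (ℤ.*-identityʳ (f₁ * f₄ - f₂ * f₃)))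
    where
    ring : ∀ f₁ f₂ f₃ f₄ a b c d → (f₁ * a + f₂ * b) * (f₃ * c + f₄ * d) - (f₁ * c + f₂ * d) * (f₃ * a + f₄ * b) ≡
      (f₁ * f₄ - f₂ * f₃) * (a * d - b * c)
    ring = solve-∀

  twist-Zero : ∀ F h → detᶻ h ≡ 1ℤ → Zero (twist F h) → Zero F
  twist-Zero (mat f₁ f₂ f₃ f₄) (mat a b c d) e (z₁ , z₂ , z₃ , z₄) =
    first f₁ f₂ z₁ z₂ , second f₁ f₂ z₁ z₂ , first f₃ f₄ z₃ z₄ , second f₃ f₄ z₃ z₄
    where
    ring₀ : ∀ x y → x * 0ℤ - y * 0ℤ ≡ 0ℤ
    ring₀ = solve-∀
    ring₁ : ∀ f f′ a b c d → f * (a * d - b * c) ≡ d * (f * a + f′ * b) - b * (f * c + f′ * d)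
    ring₁ = solve-∀
    ring₂ : ∀ f f′ a b c d → f′ * (a * d - b * c) ≡ a * (f * c + f′ * d) - c * (f * a + f′ * b)
    ring₂ = solve-∀
    first : ∀ f f′ → f * a + f′ * b ≡ 0ℤ → f * c + f′ * d ≡ 0ℤ → f ≡ 0ℤ
    first f f′ h k = trans (sym (ℤ.*-identityʳ f)) (trans (cong (λ z → f * z) (sym e))
      (trans (ring₁ f f′ a b c d) (trans (cong₂ (λ x y → d * x - b * y) h k) (ring₀ d b))))
    second : ∀ f f′ → f * a + f′ * b ≡ 0ℤ → f * c + f′ * d ≡ 0ℤ → f′ ≡ 0ℤ
    second f f′ h k = trans (sym (ℤ.*-identityʳ f′)) (trans (cong (λ z → f′ * z) (sym e))
      (trans (ring₂ f f′ a b c d) (trans (cong₂ (λ x y → a * x - c * y) k h) (ring₀ a c))))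

  Zero? : ∀ F → Dec (Zero F)
  Zero? F = (m₁₁ F ℤ.≟ 0ℤ) ×-dec (m₁₂ F ℤ.≟ 0ℤ) ×-dec (m₂₁ F ℤ.≟ 0ℤ) ×-dec (m₂₂ F ℤ.≟ 0ℤ)

  record Bounded (Y : ℕ) (F : Mat) : Set where
    constructor bounded
    field
      b₁₁ : abs (m₁₁ F) ≤ Y
      b₁₂ : abs (m₁₂ F) ≤ Y
      b₂₁ : abs (m₂₁ F) ≤ Y
      b₂₂ : abs (m₂₂ F) ≤ Y

  integers : ℕ → List ℤ
  integers n = map +_ (upTo (suc n)) ++ map (λ i → - + i) (upTo (suc n))

  ∈-integers : ∀ {n} z → abs z ≤ n → z ∈ integers n
  ∈-integers {n} (+ k) k≤ = ∈-++⁺ˡ (∈-map⁺ +_ (∈-upTo⁺ (s≤s k≤)))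
  ∈-integers {n} ℤ.-[1+ k ] k≤ = ∈-++⁺ʳ (map +_ (upTo (suc n))) (∈-map⁺ (λ i → - + i) (∈-upTo⁺ (s≤s k≤)))

  length-integers : ∀ n → length (integers n) ≡ suc n ℕ.+ suc n
  length-integers n = trans (length-++ (map +_ (upTo (suc n))))
    (cong₂ ℕ._+_ (trans (length-map +_ (upTo (suc n))) (length-upTo (suc n)))
                 (trans (length-map (λ i → - + i) (upTo (suc n))) (length-upTo (suc n))))

  box : ℕ → List Mat
  box Y = map (λ (x , y , z , w) → mat x y z w)
    (cartesianProduct (integers Y) (cartesianProduct (integers Y) (cartesianProduct (integers Y) (integers Y))))

  ∈-box : ∀ {Y} F → Bounded Y F → F ∈ box Y
  ∈-box (mat x y z w) (bounded p q r s) = ∈-map⁺ (λ (x , y , z , w) → mat x y z w)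
    (∈-cartesianProduct⁺ (∈-integers x p) (∈-cartesianProduct⁺ (∈-integers y q)
      (∈-cartesianProduct⁺ (∈-integers z r) (∈-integers w s))))

  length-box : ∀ Y → let m = suc Y ℕ.+ suc Y in length (box Y) ≡ m ℕ.* (m ℕ.* (m ℕ.* m))
  length-box Y = trans (length-map _ (cartesianProduct I (cartesianProduct I (cartesianProduct I I)))) (cubes I (length-integers Y))
    where
    I = integers Y
    cubes : ∀ xs {m} → length xs ≡ m →
      length (cartesianProduct xs (cartesianProduct xs (cartesianProduct xs xs))) ≡ m ℕ.* (m ℕ.* (m ℕ.* m))
    cubes xs refl = trans (length-cartesianProduct xs (cartesianProduct xs (cartesianProduct xs xs))) (cong (length xs ℕ.*_)
      (trans (length-cartesianProduct xs (cartesianProduct xs xs)) (cong (length xs ℕ.*_) (length-cartesianProduct xs xs))))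

  ∈-integers⁻ : ∀ {n z} → z ∈ integers n → abs z ≤ n
  ∈-integers⁻ {n} i with ∈-++⁻ (map +_ (upTo (suc n))) i
  ... | inj₁ j with ∈-map⁻ +_ j
  ... | k , k∈ , refl = ℕ.≤-pred (∈-upTo⁻ k∈)
  ∈-integers⁻ {n} i | inj₂ j with ∈-map⁻ (λ i → - + i) j
  ... | k , k∈ , refl = ℕ.≤-trans (ℕ.≤-reflexive (ℤ.∣-i∣≡∣i∣ (+ k))) (ℕ.≤-pred (∈-upTo⁻ k∈))

  ∈-box⁻ : ∀ {Y F} → F ∈ box Y → Bounded Y F
  ∈-box⁻ {Y} i with ∈-map⁻ (λ (x , y , z , w) → mat x y z w) i
  ... | (x , y , z , w) , j , refl with ∈-cartesianProduct⁻ (integers Y) _ j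
  ... | p , j with ∈-cartesianProduct⁻ (integers Y) _ j
  ... | q , j with ∈-cartesianProduct⁻ (integers Y) _ j
  ... | r , s = bounded (∈-integers⁻ p) (∈-integers⁻ q) (∈-integers⁻ r) (∈-integers⁻ s)

  abs-dot : ∀ {f f′ h h′ X Y} → abs f ≤ X → abs f′ ≤ X → h ≤ Y → h′ ≤ Y → abs (f * + h + f′ * + h′) ≤ 2 ℕ.* (X ℕ.* Y)
  abs-dot {f} {f′} {h} {h′} {X} {Y} p q r s = begin
    abs (f * + h + f′ * + h′)               ≤⟨ ℤ.∣i+j∣≤∣i∣+∣j∣ (f * + h) (f′ * + h′) ⟩
    abs (f * + h) ℕ.+ abs (f′ * + h′)       ≡⟨ cong₂ ℕ._+_ (ℤ.abs-* f (+ h)) (ℤ.abs-* f′ (+ h′)) ⟩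
    abs f ℕ.* h ℕ.+ abs f′ ℕ.* h′           ≤⟨ ℕ.+-mono-≤ (ℕ.*-mono-≤ p r) (ℕ.*-mono-≤ q s) ⟩
    X ℕ.* Y ℕ.+ X ℕ.* Y                     ≡⟨ cong (X ℕ.* Y ℕ.+_) (ℕ.+-identityʳ (X ℕ.* Y)) ⟨
    2 ℕ.* (X ℕ.* Y)                         ∎
    where open ℕ.≤-Reasoning

  abs-detᶻ : ∀ {Y F} → Bounded Y F → abs (detᶻ F) ≤ 2 ℕ.* (Y ℕ.* Y)
  abs-detᶻ {Y} {mat a b c d} (bounded p q r s) = begin
    abs (a * d - b * c)                  ≤⟨ ℤ.∣i-j∣≤∣i∣+∣j∣ (a * d) (b * c) ⟩
    abs (a * d) ℕ.+ abs (b * c)          ≡⟨ cong₂ ℕ._+_ (ℤ.abs-* a d) (ℤ.abs-* b c) ⟩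
    abs a ℕ.* abs d ℕ.+ abs b ℕ.* abs c  ≤⟨ ℕ.+-mono-≤ (ℕ.*-mono-≤ p s) (ℕ.*-mono-≤ q r) ⟩
    Y ℕ.* Y ℕ.+ Y ℕ.* Y                  ≡⟨ cong (Y ℕ.* Y ℕ.+_) (ℕ.+-identityʳ (Y ℕ.* Y)) ⟨
    2 ℕ.* (Y ℕ.* Y)                      ∎
    where open ℕ.≤-Reasoning

  -- The remainders `x` and `y` are arbitrary words, so a concatenation decodes uniquely from the
  -- left whatever follows the code word.
  PrefixFree : List Word → Set
  PrefixFree 𝓦 = ∀ {w v x y} → w ∈ 𝓦 → v ∈ 𝓦 → w ++ x ≡ v ++ y → w ≡ v × x ≡ y

  -- Expand det X = det Y = 1 for X = σ Y + P adj(F)ᵀ.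
  transfer : ∀ P σ f₁ f₂ f₃ f₄ x₁ x₂ x₃ x₄ y₁ y₂ y₃ y₄ → P ≢ 0ℤ → σ * σ ≡ 1ℤ →
    x₁ ≡ σ * y₁ + f₄ * P → x₂ ≡ σ * y₂ - f₃ * P → x₃ ≡ σ * y₃ - f₂ * P → x₄ ≡ σ * y₄ + f₁ * P →
    x₁ * x₄ - x₂ * x₃ ≡ 1ℤ → y₁ * y₄ - y₂ * y₃ ≡ 1ℤ →
    f₁ * y₁ + f₂ * y₂ + f₃ * y₃ + f₄ * y₄ ≡ - (σ * (P * (f₁ * f₄ - f₂ * f₃)))
  transfer P σ f₁ f₂ f₃ f₄ _ _ _ _ y₁ y₂ y₃ y₄ P≢0 σ²≡1 refl refl refl refl detX detY =
    trans (sym (ℤ.*-identityˡ L)) (trans (cong (λ z → z * L) (sym σ²≡1)) (trans (ring₃ σ L (P * Δ)) (trans (cong (λ z → σ * z + - (σ * (P * Δ))) σL+PΔ≡0) (ring₄ σ (- (σ * (P * Δ)))))))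
    where
    L = f₁ * y₁ + f₂ * y₂ + f₃ * y₃ + f₄ * y₄
    Δ = f₁ * f₄ - f₂ * f₃
    ring₁ : ∀ P σ f₁ f₂ f₃ f₄ y₁ y₂ y₃ y₄ →
      P * (σ * (f₁ * y₁ + f₂ * y₂ + f₃ * y₃ + f₄ * y₄) + P * (f₁ * f₄ - f₂ * f₃)) ≡
      ((σ * y₁ + f₄ * P) * (σ * y₄ + f₁ * P) - (σ * y₂ - f₃ * P) * (σ * y₃ - f₂ * P)) - σ * σ * (y₁ * y₄ - y₂ * y₃)
    ring₁ = solve-∀
    ring₃ : ∀ σ L Q → σ * σ * L ≡ σ * (σ * L + Q) + - (σ * Q)
    ring₃ = solve-∀
    ring₄ : ∀ σ x → σ * 0ℤ + x ≡ x
    ring₄ = solve-∀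
    σL+PΔ≡0 : σ * L + P * Δ ≡ 0ℤ
    σL+PΔ≡0 = ℤ.*-cancelˡ-≡ P (σ * L + P * Δ) 0ℤ {{ℤ.≢-nonZero P≢0}}
      (trans (ring₁ P σ f₁ f₂ f₃ f₄ y₁ y₂ y₃ y₄) (trans (cong₂ (λ u v → u - σ * σ * v) detX detY)
        (trans (cong (λ z → 1ℤ - z * 1ℤ) σ²≡1) (sym (ℤ.*-zeroʳ P)))))

  abs-twist : ∀ {F X Y} h → Bounded X F → All Positive h → D h ≤ Y → Bounded (2 ℕ.* (X ℕ.* Y)) (twist F (matrix h))
  abs-twist {mat f₁ f₂ f₃ f₄} {X} {Y} h (bounded p q r s) pos D≤ = bounded
    (abs-dot {f₁} {f₂} p q a≤ b≤) (abs-dot {f₁} {f₂} p q c≤ D≤) (abs-dot {f₃} {f₄} r s a≤ b≤) (abs-dot {f₃} {f₄} r s c≤ D≤)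
    where
    a≤ : A h ≤ Y
    a≤ = ℕ.≤-trans (A≤D pos) D≤
    b≤ : B h ≤ Y
    b≤ = ℕ.≤-trans (B≤D pos) D≤
    c≤ : C h ≤ Y
    c≤ = ℕ.≤-trans (ℕ.<⇒≤ (C<D pos)) D≤

  record Sign (σ : ℤ) : Set where
    constructor isSign
    field
      square : σ * σ ≡ 1ℤ
      abs≡1  : abs σ ≡ 1

  module GoodPairs {p : ℕ} (pp : Prime p) (𝓤 𝓓 : List Word)
    (𝓤-unique : Unique 𝓤) (𝓓-unique : Unique 𝓓)
    (𝓤-positive : ∀ {w} → w ∈ 𝓤 → All Positive w) (𝓓-positive : ∀ {w} → w ∈ 𝓓 → All Positive w)
    (𝓤-prefix : PrefixFree 𝓤) (𝓓-prefix : PrefixFree 𝓓)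
    (Y : ℕ) (1≤Y : 1 ≤ Y) (Y-small : 2 ℕ.* (Y ℕ.* Y) < p)
    (𝓤-small : ∀ {w} → w ∈ 𝓤 → D w < p)
    (𝓓-small : ∀ {w v} → w ∈ 𝓓 → v ∈ 𝓓 → D w ℕ.* D v < p)
    (𝓖-small : ∀ {w v} → w ∈ 𝓤 → v ∈ 𝓓 → D (w ++ v) < p) where

    private
      P = + p

    𝓖 : List (Word × Word)
    𝓖 = cartesianProduct 𝓤 𝓓

    𝓖∈ : ∀ {x} → x ∈ 𝓖 → proj₁ x ∈ 𝓤 × proj₂ x ∈ 𝓓
    𝓖∈ = ∈-cartesianProduct⁻ 𝓤 𝓓

    word : Word × Word → Word
    word (w , v) = w ++ v

    word-positive : ∀ {x} → x ∈ 𝓖 → All Positive (word x)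
    word-positive i = All.++⁺ (𝓤-positive (proj₁ (𝓖∈ i))) (𝓓-positive (proj₂ (𝓖∈ i)))

    word-small : ∀ {x} → x ∈ 𝓖 → D (word x) < p
    word-small i = 𝓖-small (proj₁ (𝓖∈ i)) (proj₂ (𝓖∈ i))

    word-injective : ∀ {x y} → x ∈ 𝓖 → y ∈ 𝓖 → C (word x) ≡ C (word y) → D (word x) ≡ D (word y) → x ≡ y
    word-injective {w , v} {w′ , v′} i j e e′ = pair (𝓤-prefix (proj₁ (𝓖∈ i)) (proj₁ (𝓖∈ j))
        (bottom-injective (word-positive i) (word-positive j) (cong₂ _,_ e e′)))
      where
      pair : w ≡ w′ × v ≡ v′ → (w , v) ≡ (w′ , v′)
      pair (refl , refl) = refl

    𝓖-unique : Unique 𝓖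
    𝓖-unique = Unique.cartesianProduct⁺ 𝓤-unique 𝓓-unique

    -- For singular `F` the relation is required over ℤ and not only modulo p. That is what a
    -- coincidence of products yields, because its relation has value ± p det F, and the count for
    -- rank 1 needs it.
    Bad : Mat → Word × Word → Set
    Bad F x = ¬ Zero F × P ∣ F ∙ matrix (word x) × (detᶻ F ≡ 0ℤ → F ∙ matrix (word x) ≡ 0ℤ)

    opaque
      bad? : ∀ F x → Dec (Bad F x)
      bad? F x = ¬? (Zero? F) ×-dec (P ∣? F ∙ matrix (word x)) ×-dec
        ((detᶻ F ℤ.≟ 0ℤ) →-dec (F ∙ matrix (word x) ℤ.≟ 0ℤ))

    -- `F` is invertible modulo p, so a dependence between F wᵀ and F vᵀ passes to the bottom rows
    -- of `w` and `v`, which are not proportional modulo p.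
    twists-independent : ∀ F {w v} → P ∤ detᶻ F → w ∈ 𝓓 → v ∈ 𝓓 → w ≢ v → Independent pp (twist F (matrix w)) (twist F (matrix v))
    twists-independent (mat f₁ f₂ f₃ f₄) {w} {v} n w∈ v∈ w≢v s t h₁ h₂ h₃ h₄ =
      cramer pp (+ C w) (+ C v) (+ D w) (+ D v)
        (λ h → w≢v (fractions-distinct pp (𝓓-positive w∈) (𝓓-positive v∈) (𝓓-small w∈ v∈) h))
        (∣-resp (comm s t (+ C w) (+ C v)) (proj₁ lower)) (∣-resp (comm s t (+ D w) (+ D v)) (proj₂ lower))
      where
      comm : ∀ s t x y → s * x + t * y ≡ x * s + y * t
      comm = solve-∀
      ring : ∀ s t f f′ x y x′ y′ → s * (f * x + f′ * y) + t * (f * x′ + f′ * y′) ≡ f * (s * x + t * x′) + f′ * (s * y + t * y′)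
      ring = solve-∀
      lower : P ∣ s * + C w + t * + C v × P ∣ s * + D w + t * + D v
      lower = cramer pp f₁ f₂ f₃ f₄ n
        (∣-resp (ring s t f₁ f₂ (+ C w) (+ D w) (+ C v) (+ D v)) h₂)
        (∣-resp (ring s t f₃ f₄ (+ C w) (+ D w) (+ C v) (+ D v)) h₄)

    -- For fixed `w` either at most one `v` occurs, which costs |𝓤| in total, or `w` satisfies the
    -- relations twisted by two different `v`. Each of the |𝓓|² pairs admits at most 2 p such `w`.
    count-nondegenerate : ∀ F → P ∤ detᶻ F → count (bad? F) 𝓖 ≤ length 𝓤 ℕ.+ length 𝓓 ℕ.* (length 𝓓 ℕ.* (p ℕ.* 2))
    count-nondegenerate F n = begin
      count (bad? F) 𝓖                                        ≡⟨ ∑-cartesianProduct 𝓤 𝓓 (λ x → 𝟙 (bad? F x)) ⟩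
      ∑[ w ← 𝓤 ] ∑[ v ← 𝓓 ] 𝟙 (bad? F (w , v))               ≤⟨ ∑-mono 𝓤 (λ w _ → ∑-mono 𝓓 (λ v _ → 𝟙-mono (bad? F (w , v)) (Q? w v) (to w v))) ⟩
      ∑[ w ← 𝓤 ] count (Q? w) 𝓓                               ≤⟨ ∑-mono 𝓤 (λ w _ → count≤1+pairs _≟ʷ_ (Q? w) 𝓓-unique (R w) (both w)) ⟩
      ∑[ w ← 𝓤 ] (1 ℕ.+ ∑[ v ← 𝓓 ] ∑[ v′ ← 𝓓 ] R w v v′)      ≡⟨ ∑-+ 𝓤 (λ _ → 1) (λ w → ∑[ v ← 𝓓 ] ∑[ v′ ← 𝓓 ] R w v v′) ⟩
      ∑[ _ ← 𝓤 ] 1 ℕ.+ ∑[ w ← 𝓤 ] ∑[ v ← 𝓓 ] ∑[ v′ ← 𝓓 ] R w v v′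
        ≡⟨ cong₂ ℕ._+_ (sym (length≡∑1 𝓤)) (trans (∑-swap 𝓤 𝓓 (λ w v → ∑[ v′ ← 𝓓 ] R w v v′)) (∑-cong 𝓓 (λ v → ∑-swap 𝓤 𝓓 (λ w v′ → R w v v′)))) ⟩
      length 𝓤 ℕ.+ ∑[ v ← 𝓓 ] ∑[ v′ ← 𝓓 ] ∑[ w ← 𝓤 ] R w v v′ ≤⟨ ℕ.+-monoʳ-≤ (length 𝓤) (∑-≤ 𝓓 λ v v∈ → ∑-≤ 𝓓 λ v′ v′∈ → section v v′ v∈ v′∈) ⟩
      length 𝓤 ℕ.+ length 𝓓 ℕ.* (length 𝓓 ℕ.* (p ℕ.* 2))     ∎
      where
      open ℕ.≤-Reasoning
      Q : Word → Word → Set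
      Q w v = P ∣ twist F (matrix v) ∙ matrix w
      opaque
        Q? : ∀ w v → Dec (Q w v)
        Q? w v = P ∣? twist F (matrix v) ∙ matrix w
      to : ∀ w v → Bad F (w , v) → Q w v
      to w v (_ , h , _) = ∣-resp (sym (twist-∙ F w v)) h
      R′ : ∀ w v v′ → Dec (v ≡ v′) → ℕ
      R′ w v v′ (yes _) = 0
      R′ w v v′ (no _)  = 𝟙 (on-section? pp (twist F (matrix v)) (twist F (matrix v′)) w)
      R : Word → Word → Word → ℕ
      R w v v′ = R′ w v v′ (v ≟ʷ v′)
      both : ∀ w {v v′} → v ∈ 𝓓 → v′ ∈ 𝓓 → v ≢ v′ → Q w v → Q w v′ → 1 ≤ R w v v′
      both w {v} {v′} _ _ ne q q′ = helper (v ≟ʷ v′)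
        where
        helper : (d : Dec (v ≡ v′)) → 1 ≤ R′ w v v′ d
        helper (yes e) = contradiction e ne
        helper (no _)  = ℕ.≤-reflexive (sym (𝟙-true (on-section? pp (twist F (matrix v)) (twist F (matrix v′)) w) (q , q′)))
      section : ∀ v v′ → v ∈ 𝓓 → v′ ∈ 𝓓 → ∑[ w ← 𝓤 ] R w v v′ ≤ p ℕ.* 2
      section v v′ v∈ v′∈ = helper (v ≟ʷ v′)
        where
        helper : (d : Dec (v ≡ v′)) → ∑[ w ← 𝓤 ] R′ w v v′ d ≤ p ℕ.* 2
        helper (yes _) = ℕ.≤-trans (ℕ.≤-reflexive (trans (∑-const 𝓤 0) (ℕ.*-zeroʳ (length 𝓤)))) z≤n
        helper (no ne) = count-section pp 𝓤-unique 𝓤-positive 𝓤-small (twist F (matrix v)) (twist F (matrix v′))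
          (twists-independent F n v∈ v′∈ ne)

    bad-bound : ℕ
    bad-bound = length 𝓤 ℕ.+ length 𝓓 ℕ.* (length 𝓓 ℕ.* (p ℕ.* 2)) ℕ.+ p ℕ.* suc (Y ℕ.* Y) ℕ.* 2

    count-bad : ∀ F → Bounded Y F → count (bad? F) 𝓖 ≤ bad-bound
    count-bad F b = cases (Zero? F) (detᶻ F ℤ.≟ 0ℤ)
      where
      cases : Dec (Zero F) → Dec (detᶻ F ≡ 0ℤ) → count (bad? F) 𝓖 ≤ bad-bound
      cases (yes z) _ = ℕ.≤-trans (ℕ.≤-reflexive (count-none (bad? F) {𝓖} (λ _ (nz , _) → nz z))) z≤n
      cases (no nz) (yes e) = ℕ.≤-trans (∑-mono 𝓖 (λ x _ → 𝟙-mono (bad? F x) (vanishes-dec x) (λ (_ , _ , f) → f e)))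
        (ℕ.≤-trans (count-degenerate 𝓖-unique word word-injective word-positive word-small F Y 1≤Y (Bounded.b₁₁ b) (Bounded.b₁₂ b) e nz)
                   (ℕ.m≤n+m _ (length 𝓤 ℕ.+ length 𝓓 ℕ.* (length 𝓓 ℕ.* (p ℕ.* 2)))))
        where vanishes-dec = vanishes? 𝓖-unique word word-injective word-positive word-small F
      -- The determinant is nonzero and at most 2 Y² < p in absolute value, hence invertible modulo
      -- p.
      cases (no _) (no ne) = ℕ.≤-trans (count-nondegenerate F (small-∤ pp (ℕ.≤-<-trans (abs-detᶻ b) Y-small) ne)) (ℕ.m≤m+n _ _)

    Good : Word × Word → Set
    Good x = ¬ Any (λ F → Bad F x) (box Y)

    good? : ∀ x → Dec (Good x)
    good? x = ¬? (any? (λ F → bad? F x) (box Y))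

    good : List (Word × Word)
    good = filter good? 𝓖

    good-many : length 𝓤 ℕ.* length 𝓓 ≤ length good ℕ.+ length (box Y) ℕ.* bad-bound
    good-many = begin
      length 𝓤 ℕ.* length 𝓓                              ≡⟨ length-cartesianProduct 𝓤 𝓓 ⟨
      length 𝓖                                           ≤⟨ length-good good? bad? 𝓖 (box Y) (λ {x} _ ng → find (decidable-stable (any? (λ F → bad? F x) (box Y)) ng)) ⟩
      length good ℕ.+ ∑[ F ← box Y ] count (bad? F) 𝓖    ≤⟨ ℕ.+-monoʳ-≤ (length good) (∑-≤ (box Y) λ F i → count-bad F (∈-box⁻ i)) ⟩
      length good ℕ.+ length (box Y) ℕ.* bad-bound       ∎
      where open ℕ.≤-Reasoning

    module Multiples {𝓗 : List Word} (𝓗-unique : Unique 𝓗) (𝓗-positive : ∀ {w} → w ∈ 𝓗 → All Positive w)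
      (H : ℕ) (𝓗-small : ∀ {w} → w ∈ 𝓗 → D w ≤ H) (Y≡ : Y ≡ 2 ℕ.* (2 ℕ.* H ℕ.* H))
      (𝓖-half : ∀ {w v} → w ∈ 𝓤 → v ∈ 𝓓 → 2 ℕ.* D (w ++ v) ≤ p) where

      products : List ((Word × Word) × Word)
      products = cartesianProduct good 𝓗

      products-unique : Unique products
      products-unique = Unique.cartesianProduct⁺ (Unique.filter⁺ good? 𝓖-unique) 𝓗-unique

      product : (Word × Word) × Word → Word
      product (x , h) = word x ++ h

      products∈ : ∀ {j} → j ∈ products → proj₁ j ∈ 𝓖 × Good (proj₁ j) × proj₂ j ∈ 𝓗
      products∈ i with ∈-cartesianProduct⁻ good 𝓗 i
      ... | x∈ , h∈ = proj₁ (∈-filter⁻ good? {xs = 𝓖} x∈) , proj₂ (∈-filter⁻ good? {xs = 𝓖} x∈) , h∈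

      product-positive : ∀ {j} → j ∈ products → All Positive (product j)
      product-positive i = All.++⁺ (word-positive (proj₁ (products∈ i))) (𝓗-positive (proj₂ (proj₂ (products∈ i))))

      product-injective : ∀ {j j′} → j ∈ products → j′ ∈ products → product j ≡ product j′ → j ≡ j′
      product-injective {(w , v) , h} {(w′ , v′) , h′} i i′ e = first (𝓤-prefix w∈ w′∈ e₁)
        where
        w∈ = proj₁ (𝓖∈ (proj₁ (products∈ i)))
        w′∈ = proj₁ (𝓖∈ (proj₁ (products∈ i′)))
        e₁ : w ++ (v ++ h) ≡ w′ ++ (v′ ++ h′)
        e₁ = trans (sym (List.++-assoc w v h)) (trans e (List.++-assoc w′ v′ h′))
        first : w ≡ w′ × v ++ h ≡ v′ ++ h′ → ((w , v) , h) ≡ ((w′ , v′) , h′)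
        first (refl , e₂) = second (𝓓-prefix (proj₂ (𝓖∈ (proj₁ (products∈ i)))) (proj₂ (𝓖∈ (proj₁ (products∈ i′)))) e₂)
          where
          second : v ≡ v′ × h ≡ h′ → ((w , v) , h) ≡ ((w , v′) , h′)
          second (refl , refl) = refl

      -- The factor 2 lost in a concatenation is the reason for assuming `𝓖-half`; with p H as bound
      -- the quotients by p stay below 2 H.
      product-small : ∀ {j} → j ∈ products → D (product j) ≤ p ℕ.* H
      product-small {(w , v) , h} i = begin
        D ((w ++ v) ++ h)               ≤⟨ D-++-≤ (word-positive x∈) (𝓗-positive h∈) ⟩
        2 ℕ.* (D (w ++ v) ℕ.* D h)      ≡⟨ ℕ.*-assoc 2 (D (w ++ v)) (D h) ⟨
        2 ℕ.* D (w ++ v) ℕ.* D h        ≤⟨ ℕ.*-mono-≤ (𝓖-half (proj₁ (𝓖∈ x∈)) (proj₂ (𝓖∈ x∈))) (𝓗-small h∈) ⟩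
        p ℕ.* H                         ∎
        where
        open ℕ.≤-Reasoning
        x∈ = proj₁ (products∈ i)
        h∈ = proj₂ (proj₂ (products∈ i))

      private
        P≢0 : P ≢ 0ℤ
        P≢0 e = ℕ.≢-nonZero⁻¹ p {{prime⇒nonZero pp}} (ℤ.+-injective e)

        quotient-bound : ∀ {x y m σ} → abs σ ≡ 1 → x ≤ p ℕ.* H → y ≤ p ℕ.* H → + x - σ * + y ≡ m * P → abs m ≤ 2 ℕ.* H
        quotient-bound {x} {y} {m} {σ} s x≤ y≤ e = ℕ.*-cancelʳ-≤ (abs m) (2 ℕ.* H) p {{prime⇒nonZero pp}} (begin
          abs m ℕ.* p                       ≡⟨ ℤ.abs-* m P ⟨
          abs (m * P)                       ≡⟨ cong abs e ⟨
          abs (+ x - σ * + y)               ≤⟨ ℤ.∣i-j∣≤∣i∣+∣j∣ (+ x) (σ * + y) ⟩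
          x ℕ.+ abs (σ * + y)               ≡⟨ cong (x ℕ.+_) (trans (ℤ.abs-* σ (+ y)) (trans (cong (ℕ._* y) s) (ℕ.*-identityˡ y))) ⟩
          x ℕ.+ y                           ≤⟨ ℕ.+-mono-≤ x≤ y≤ ⟩
          p ℕ.* H ℕ.+ p ℕ.* H               ≡⟨ eq p H ⟩
          2 ℕ.* H ℕ.* p                     ∎)
          where
          open ℕ.≤-Reasoning
          eq : ∀ p H → p ℕ.* H ℕ.+ p ℕ.* H ≡ 2 ℕ.* H ℕ.* p
          eq = ℕ.solve-∀

      module _ {j j′} (i : j ∈ products) (i′ : j′ ∈ products) where

        private
          X Z : Word
          X = product j
          Z = product j′

          D≤ : ∀ {w} → All Positive w → D w ≤ p ℕ.* H → A w ≤ p ℕ.* H × B w ≤ p ℕ.* H × C w ≤ p ℕ.* H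
          D≤ pos b = ℕ.≤-trans (A≤D pos) b , ℕ.≤-trans (B≤D pos) b , ℕ.≤-trans (ℕ.<⇒≤ (C<D pos)) b

        -- The quotients (X - σ Z) / p form a matrix of size 2 H, whose cofactors give a relation
        -- satisfied by Z = g′ h′; twisting by h′ makes it a relation on g′ with coefficients up to
        -- 2 (2 H · H) = Y. As g′ is good, the relation is zero, so X = σ Z over ℤ and the words
        -- agree.
        congruent⇒equal : ∀ {σ} → Sign σ →
          P ∣ + A X - σ * + A Z → P ∣ + B X - σ * + B Z → P ∣ + C X - σ * + C Z → P ∣ + D X - σ * + D Z → j ≡ j′
        congruent⇒equal {σ} (isSign σ²≡1 ∣σ∣≡1) (divides q₁ e₁) (divides q₂ e₂) (divides q₃ e₃) (divides q₄ e₄) = cases (Zero? F)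
          where
          F₀ F : Mat
          -- Cofactors of the quotient matrix, matching the shape X = σ Z + P adj(F₀)ᵀ that
          -- `transfer` expects.
          F₀ = mat q₄ (- q₃) (- q₂) q₁
          h′ = proj₂ j′
          F = twist F₀ (matrix h′)
          bX = product-small i
          bZ = product-small i′
          pX = product-positive i
          pZ = product-positive i′
          F₀-bounded : Bounded (2 ℕ.* H) F₀
          F₀-bounded = bounded
            (quotient-bound {D X} {D Z} {q₄} {σ} ∣σ∣≡1 bX bZ e₄)
            (ℕ.≤-trans (ℕ.≤-reflexive (ℤ.∣-i∣≡∣i∣ q₃))
              (quotient-bound {C X} {C Z} {q₃} {σ} ∣σ∣≡1 (proj₂ (proj₂ (D≤ pX bX))) (proj₂ (proj₂ (D≤ pZ bZ))) e₃))
            (ℕ.≤-trans (ℕ.≤-reflexive (ℤ.∣-i∣≡∣i∣ q₂))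
              (quotient-bound {B X} {B Z} {q₂} {σ} ∣σ∣≡1 (proj₁ (proj₂ (D≤ pX bX))) (proj₁ (proj₂ (D≤ pZ bZ))) e₂))
            (quotient-bound {A X} {A Z} {q₁} {σ} ∣σ∣≡1 (proj₁ (D≤ pX bX)) (proj₁ (D≤ pZ bZ)) e₁)
          F-bounded : Bounded Y F
          F-bounded = subst (λ y → Bounded y F) (sym Y≡)
            (abs-twist h′ F₀-bounded (𝓗-positive (proj₂ (proj₂ (products∈ i′)))) (𝓗-small (proj₂ (proj₂ (products∈ i′)))))
          move₊ : ∀ x y q → x - y ≡ q → x ≡ y + q
          move₊ x y q e = trans (ring x y) (cong (λ z → y + z) e)
            where
            ring : ∀ x y → x ≡ y + (x - y)
            ring = solve-∀
          move₋ : ∀ x y q → x - y ≡ q * P → x ≡ y - (- q) * P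
          move₋ x y q e = trans (move₊ x y (q * P) e) (ring y q P)
            where
            ring : ∀ y q P → y + q * P ≡ y - (- q) * P
            ring = solve-∀
          Δ : ℤ
          Δ = q₄ * q₁ - (- q₃) * (- q₂)
          value : F ∙ matrix (word (proj₁ j′)) ≡ - (σ * (P * Δ))
          value = trans (twist-∙ F₀ (word (proj₁ j′)) h′)
            (transfer P σ q₄ (- q₃) (- q₂) q₁ (+ A X) (+ B X) (+ C X) (+ D X) (+ A Z) (+ B Z) (+ C Z) (+ D Z) P≢0 σ²≡1
              (move₊ (+ A X) (σ * + A Z) (q₁ * P) e₁) (move₋ (+ B X) (σ * + B Z) q₂ e₂)
              (move₋ (+ C X) (σ * + C Z) q₃ e₃) (move₊ (+ D X) (σ * + D Z) (q₄ * P) e₄)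
              (det-matrix X) (det-matrix Z))
          F-bad : ¬ Zero F → Bad F (proj₁ j′)
          F-bad nz = nz , divides (- (σ * Δ)) (trans value (ring σ P Δ)) , vanish
            where
            ring : ∀ σ P Δ → - (σ * (P * Δ)) ≡ - (σ * Δ) * P
            ring = solve-∀
            vanish : detᶻ F ≡ 0ℤ → F ∙ matrix (word (proj₁ j′)) ≡ 0ℤ
            vanish z = trans value (trans (cong (λ y → - (σ * (P * y))) (trans (sym (det-twist F₀ (matrix h′) (det-matrix h′))) z)) (ring₀ σ P))
              where
              ring₀ : ∀ σ P → - (σ * (P * 0ℤ)) ≡ 0ℤ
              ring₀ = solve-∀
          cases : Dec (Zero F) → j ≡ j′
          cases (no nz) = contradiction (lose (∈-box F F-bounded) (F-bad nz)) (proj₁ (proj₂ (products∈ i′)))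
          cases (yes z) = product-injective i i′ (bottom-injective pX pZ (cong₂ _,_
              (equal (C X) (C Z) q₃ e₃ (trans (sym (ℤ.neg-involutive q₃)) (cong -_ (proj₁ (proj₂ F₀≡0)))))
              (equal (D X) (D Z) q₄ e₄ (proj₁ F₀≡0))))
            where
            F₀≡0 : Zero F₀
            F₀≡0 = twist-Zero F₀ (matrix h′) (det-matrix h′) z
            -- Nonnegative entries: absolute values remove the sign.
            equal : ∀ x y q → + x - σ * + y ≡ q * P → q ≡ 0ℤ → x ≡ y
            equal x y q e q≡0 = trans (cong abs x≡σy) (trans (ℤ.abs-* σ (+ y)) (trans (cong (ℕ._* y) ∣σ∣≡1) (ℕ.*-identityˡ y)))
              where
              x≡σy : + x ≡ σ * + y
              x≡σy = trans (move₊ (+ x) (σ * + y) (q * P) e) (trans (cong (λ z → σ * + y + z * P) q≡0) (ring (σ * + y) P))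
                where
                ring : ∀ z P → z + 0ℤ * P ≡ z
                ring = solve-∀

        -- Determinants of l X ≡ l′ Z give l² ≡ l′², so l′ ≡ ± l. Cancelling l leaves X ≡ ± Z.
        projectively-distinct : ∀ l l′ → P ∤ l →
          P ∣ l * + A X - l′ * + A Z → P ∣ l * + B X - l′ * + B Z → P ∣ l * + C X - l′ * + C Z → P ∣ l * + D X - l′ * + D Z → j ≡ j′
        projectively-distinct l l′ n h₁ h₂ h₃ h₄ = cases (euclid pp (l - l′) (l + l′) difference)
          where
          ring : ∀ l l′ x₁ x₂ x₃ x₄ y₁ y₂ y₃ y₄ →
            ((l * x₄) * (l * x₁ - l′ * y₁) + (l′ * y₁) * (l * x₄ - l′ * y₄)) -
            ((l * x₃) * (l * x₂ - l′ * y₂) + (l′ * y₂) * (l * x₃ - l′ * y₃)) ≡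
            l * l * (x₁ * x₄ - x₂ * x₃) - l′ * l′ * (y₁ * y₄ - y₂ * y₃)
          ring = solve-∀
          ring′ : ∀ l l′ → l * l * 1ℤ - l′ * l′ * 1ℤ ≡ (l - l′) * (l + l′)
          ring′ = solve-∀
          difference : P ∣ (l - l′) * (l + l′)
          difference = ∣-resp (trans (ring l l′ (+ A X) (+ B X) (+ C X) (+ D X) (+ A Z) (+ B Z) (+ C Z) (+ D Z))
              (trans (cong₂ (λ x y → l * l * x - l′ * l′ * y) (det-matrix X) (det-matrix Z)) (ring′ l l′)))
            (∣m∣n⇒∣m-n (∣-combination (l * + D X) (l′ * + A Z) h₁ h₄) (∣-combination (l * + C X) (l′ * + B Z) h₂ h₃))
          minus : ∀ x y → P ∣ l - l′ → P ∣ l * x - l′ * y → P ∣ x - 1ℤ * y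
          minus x y d h = ∣-cancelˡ pp l (x - 1ℤ * y) n (∣-resp (eq l l′ x y) (∣m∣n⇒∣m-n h (∣m⇒∣m*n y d)))
            where
            eq : ∀ l l′ x y → (l * x - l′ * y) - (l - l′) * y ≡ l * (x - 1ℤ * y)
            eq = solve-∀
          plus : ∀ x y → P ∣ l + l′ → P ∣ l * x - l′ * y → P ∣ x - -1ℤ * y
          plus x y d h = ∣-cancelˡ pp l (x - -1ℤ * y) n (∣-resp (eq l l′ x y) (∣m∣n⇒∣m+n h (∣m⇒∣m*n y d)))
            where
            eq : ∀ l l′ x y → (l * x - l′ * y) + (l + l′) * y ≡ l * (x - -1ℤ * y)
            eq = solve-∀
          cases : P ∣ l - l′ ⊎ P ∣ l + l′ → j ≡ j′
          cases (inj₁ d) = congruent⇒equal {1ℤ} (isSign refl refl)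
            (minus (+ A X) (+ A Z) d h₁) (minus (+ B X) (+ B Z) d h₂) (minus (+ C X) (+ C Z) d h₃) (minus (+ D X) (+ D Z) d h₄)
          cases (inj₂ d) = congruent⇒equal { -1ℤ} (isSign refl refl)
            (plus (+ A X) (+ A Z) d h₁) (plus (+ B X) (+ B Z) d h₂) (plus (+ C X) (+ C Z) d h₃) (plus (+ D X) (+ D Z) d h₄)

-- Cardinalities of the codes in powers of t = 2ˣ.

module CodeSizes where

  open FiniteSums
  open Words
  open PrefixCodes
  open Products using (PrefixFree)
  open import Data.Nat.Base hiding (_/_)
  open import Data.Nat.Properties
  open import Data.Nat.Tactic.RingSolver using (solve-∀)

  *-^ : ∀ m n o → (m * n) ^ o ≡ m ^ o * n ^ o
  *-^ m n zero    = refl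
  *-^ m n (suc o) = trans (cong (m * n *_) (*-^ m n o)) (ring m n (m ^ o) (n ^ o))
    where
    ring : ∀ m n p q → m * n * (p * q) ≡ m * p * (n * q)
    ring = solve-∀

  module Codes (k e : ℕ) (1≤k : 1 ≤ k) (base : (k + 2) ^ (e + e) ≤ 2 * k ^ (e + e)) (t x : ℕ) (t≡2^x : t ≡ 2 ^ x) where

    opaque
      -- Depth x n suffices, since tⁿ = 2^(x n) and a letter at least doubles the denominator.
      code : ℕ → ℕ × ℕ → List Word
      code n s = leaves (t ^ n) k (x * n) s

      code-unique : ∀ n s → Unique (code n s)
      code-unique n s = leaves-unique (t ^ n) k (x * n) s

      code-length : ∀ n c d → 0 < d → c ≤ d → t ^ n ≤ 2 ^ (x * n) * d →
        t ^ n * t ^ n * k ^ (x * n + x * n) ≤ length (code n (c , d)) * (d * (d + c)) * (k + 2) ^ (x * n + x * n)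
      code-length n = length-leaves (t ^ n) k (x * n)

      code-Leaf : ∀ {n s w} → w ∈ code n s → Leaf (t ^ n) k s w
      code-Leaf {n} {s} = leaves-Leaf (t ^ n) k (x * n) s

    private
      t≢0 : NonZero t
      t≢0 = subst NonZero (sym t≡2^x) (m^n≢0 2 x)

    code-Letters : ∀ {n s w} → w ∈ code n s → All (Letter k) w
    code-Letters {n} i = Leaf-Letters (t ^ n) k (code-Leaf {n} i)

    code-positive : ∀ {n s w} → w ∈ code n s → All Positive w
    code-positive {n} i = All.map Letter⇒Positive (code-Letters {n} i)

    code-prefix : ∀ {n s} → PrefixFree (code n s)
    code-prefix {n} i j = Leaf-prefix-free (t ^ n) k (code-Leaf {n} i) (code-Leaf {n} j)

    -- The bound 3 covers both starting rows in use, (0 , 1) and (2 , 3); with 4 ≤ (k + 1)² it puts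
    -- the start below the final bound as well.
    code-D< : ∀ {κ} → suc k * suc k ≤ κ → 4 ≤ suc k * suc k → ∀ n {s w} → w ∈ code n s →
              proj₁ s ≤ proj₂ s → proj₂ s ≤ 3 → proj₂ (run s w) < κ * t ^ n
    code-D< κ≥ 4≤ n {s} i s₁≤s₂ s₂≤3 = <-≤-trans
      (Leaf-bound (t ^ n) k (code-Leaf {n} i) s₁≤s₂ (≤-<-trans s₂≤3 (<-≤-trans 4≤ (m≤m*n (suc k * suc k) (t ^ n) {{m^n≢0 t n {{t≢0}}}}))))
      (*-monoˡ-≤ (t ^ n) κ≥)

    private
      -- The exponent is 2 e · x c, and by `base` every 2 e factors (k + 2) / k cost at most 2. The
      -- total 2^(x c) is a power of t because t is a power of 2.
      loss : ∀ c → (k + 2) ^ (x * (e * c) + x * (e * c)) ≤ t ^ c * k ^ (x * (e * c) + x * (e * c))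
      loss c = begin
        (k + 2) ^ (x * (e * c) + x * (e * c))   ≡⟨ cong ((k + 2) ^_) (exponent x e c) ⟩
        (k + 2) ^ ((e + e) * (x * c))           ≡⟨ ^-*-assoc (k + 2) (e + e) (x * c) ⟨
        ((k + 2) ^ (e + e)) ^ (x * c)           ≤⟨ ^-monoˡ-≤ (x * c) base ⟩
        (2 * k ^ (e + e)) ^ (x * c)             ≡⟨ *-^ 2 (k ^ (e + e)) (x * c) ⟩
        2 ^ (x * c) * (k ^ (e + e)) ^ (x * c)   ≡⟨ cong₂ _*_ (trans (sym (^-*-assoc 2 x c)) (cong (_^ c) (sym t≡2^x))) (trans (^-*-assoc k (e + e) (x * c)) (cong (k ^_) (sym (exponent x e c)))) ⟩
        t ^ c * k ^ (x * (e * c) + x * (e * c)) ∎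
        where
        open ≤-Reasoning
        exponent : ∀ x e c → x * (e * c) + x * (e * c) ≡ (e + e) * (x * c)
        exponent = solve-∀

    -- For n = e c the code has at least t^(2 n - n / e) words, up to the weight d (d + a) of the
    -- starting row.
    length-code : ∀ n c → n ≡ e * c → ∀ a d → 0 < d → a ≤ d →
      t ^ n * t ^ n ≤ length (code n (a , d)) * (d * (d + a)) * t ^ c
    length-code n c refl a d d>0 a≤d = *-cancelʳ-≤ _ _ (k ^ (f + f)) {{>-nonZero (m^n>0 k {{>-nonZero 1≤k}} (f + f))}} (begin
      t ^ n * t ^ n * k ^ (f + f)                ≤⟨ code-length n a d d>0 a≤d fuel ⟩
      L * (d * (d + a)) * (k + 2) ^ (f + f)      ≤⟨ *-monoʳ-≤ (L * (d * (d + a))) (loss c) ⟩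
      L * (d * (d + a)) * (t ^ c * k ^ (f + f))  ≡⟨ *-assoc (L * (d * (d + a))) (t ^ c) (k ^ (f + f)) ⟨
      L * (d * (d + a)) * t ^ c * k ^ (f + f)    ∎)
      where
      open ≤-Reasoning
      f = x * n
      L = length (code n (a , d))
      fuel : t ^ n ≤ 2 ^ f * d
      fuel = begin
        t ^ n        ≡⟨ trans (cong (_^ n) t≡2^x) (^-*-assoc 2 x n) ⟩
        2 ^ f        ≤⟨ m≤m*n (2 ^ f) d {{>-nonZero d>0}} ⟩
        2 ^ f * d    ∎

  length-words : ∀ {𝓦} → Unique 𝓦 → (∀ {w} → w ∈ 𝓦 → All Positive w) → ∀ {n} → (∀ {w} → w ∈ 𝓦 → D w < n) → length 𝓦 ≤ n * n
  length-words {𝓦} u pos {n} small = ≤-trans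
    (length-injection (≡-dec _≟_ _≟_) u (λ w → C w , D w)
      (λ i → ∈-cartesianProduct⁺ (∈-upTo⁺ (<-trans (C<D (pos i)) (small i))) (∈-upTo⁺ (small i)))
      (λ i j e → bottom-injective (pos i) (pos j) e))
    (≤-reflexive (trans (length-cartesianProduct (upTo n) (upTo n)) (cong₂ _*_ (length-upTo n) (length-upTo n))))

-- Comparison of exponents of t.

module Estimates where

  open import Data.Bool.Base using (T)
  open import Data.Nat.Base hiding (_/_)
  open import Data.Nat.Properties
  open import Data.Nat.Tactic.RingSolver using (solve-∀)

  module Powers (t : ℕ) (t-large : 2 ^ 2048 ≤ t) where

    private instance
      t≢0 : NonZero t
      t≢0 = >-nonZero (≤-trans (m^n>0 2 2048) t-large)

    raise : ∀ a b {_ : T (a ≤ᵇ b)} → t ^ a ≤ t ^ b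
    raise a b {h} = ^-monoʳ-≤ t (≤ᵇ⇒≤ a b h)

    constant : ∀ c {_ : T (c ≤ᵇ 2048)} → 2 ^ c ≤ t
    constant c {h} = ≤-trans (^-monoʳ-≤ 2 (≤ᵇ⇒≤ c 2048 h)) t-large

    times : ∀ {x y} a b → x ≤ t ^ a → y ≤ t ^ b → x * y ≤ t ^ (a + b)
    times a b p q = ≤-trans (*-mono-≤ p q) (≤-reflexive (sym (^-distribˡ-+-* t a b)))

    module _ {κ R p U n h a H Y g : ℕ} (κ≤t : κ ≤ t) (R≤t³ : R ≤ t ^ 3) (p< : p < R * t ^ 5000)
      (U≥ : t ^ 8955 ≤ U) (n≥ : t ^ 995 ≤ n) (n≤ : n ≤ (κ * t ^ 500) * (κ * t ^ 500))
      (h≥ : t ^ 199 ≤ h) (a≥ : t ^ 4975 ≤ 16 * a)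
      (H≡ : H ≡ κ * t ^ 100) (Y≡ : Y ≡ 2 * (2 * H * H)) where

      H≤ : H ≤ t ^ 101
      H≤ = ≤-trans (≤-reflexive H≡) (*-monoˡ-≤ (t ^ 100) κ≤t)

      Y≤ : Y ≤ t ^ 203
      Y≤ = begin
        Y                    ≡⟨ Y≡ ⟩
        2 * (2 * H * H)      ≡⟨ eq H ⟩
        4 * (H * H)          ≤⟨ *-mono-≤ (constant 2) (times 101 101 H≤ H≤) ⟩
        t ^ 203              ∎
        where
        open ≤-Reasoning
        eq : ∀ H → 2 * (2 * H * H) ≡ 4 * (H * H)
        eq = solve-∀

      p≤ : p ≤ t ^ 5003
      p≤ = begin
        p                                 ≤⟨ <⇒≤ p< ⟩
        R * t ^ 5000                      ≤⟨ *-monoˡ-≤ (t ^ 5000) R≤t³ ⟩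
        t ^ 3 * t ^ 5000                  ≡⟨ ^-distribˡ-+-* t 3 5000 ⟨
        t ^ 5003                          ∎
        where open ≤-Reasoning

      n≤t : n ≤ t ^ 1002
      n≤t = ≤-trans n≤ (times 501 501 b b)
        where
        b : κ * t ^ 500 ≤ t ^ 501
        b = *-monoˡ-≤ (t ^ 500) κ≤t

      module _ (1≤Y : 1 ≤ Y) where

        m = suc Y + suc Y

        m≤ : m ≤ t ^ 204
        m≤ = begin
          suc Y + suc Y        ≤⟨ +-mono-≤ s s ⟩
          Y + Y + (Y + Y)      ≡⟨ eq Y ⟩
          4 * Y                ≤⟨ *-mono-≤ (constant 2) Y≤ ⟩
          t ^ 204              ∎
          where
          open ≤-Reasoning
          s : suc Y ≤ Y + Y
          s = +-monoˡ-≤ Y 1≤Y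
          eq : ∀ Y → Y + Y + (Y + Y) ≡ 4 * Y
          eq = solve-∀

        box≤ : m * (m * (m * m)) ≤ t ^ 816
        box≤ = times 204 612 m≤ (times 204 408 m≤ (times 204 204 m≤ m≤))

        sucY²≤ : suc (Y * Y) ≤ t ^ 407
        sucY²≤ = begin
          1 + Y * Y              ≤⟨ +-monoˡ-≤ (Y * Y) (*-mono-≤ 1≤Y 1≤Y) ⟩
          Y * Y + Y * Y          ≡⟨ eq (Y * Y) ⟩
          2 * (Y * Y)            ≤⟨ *-mono-≤ (constant 1) (times 203 203 Y≤ Y≤) ⟩
          t ^ 407                ∎
          where
          open ≤-Reasoning
          eq : ∀ x → x + x ≡ 2 * x
          eq = solve-∀

        -- At most half of the U n pairs are bad. Relative to U n, the three terms are of the orders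
        -- m⁴ / n, m⁴ p n / U and m⁴ p Y² / (U n). The first is the tightest: t⁸¹⁷ against t⁹⁹⁵.
        few-bad : m * (m * (m * m)) * (U + n * (n * (p * 2)) + p * suc (Y * Y) * 2) * 2 ≤ U * n
        few-bad = *-cancelˡ-≤ 4 (begin
          4 * (x * (U + n * (n * (p * 2)) + p * s * 2) * 2)
            ≡⟨ eq₁ x U n p s ⟩
          (8 * x) * U + (16 * (x * (p * n))) * n + 16 * (x * (p * s))
            ≤⟨ +-mono-≤ (+-mono-≤ (*-monoˡ-≤ U first) (*-monoˡ-≤ n second)) third ⟩
          n * U + U * n + U * n
            ≤⟨ m≤m+n _ (U * n) ⟩
          n * U + U * n + U * n + U * n
            ≡⟨ eq₂ U n ⟩
          4 * (U * n) ∎)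
          where
          open ≤-Reasoning
          x = m * (m * (m * m))
          s = suc (Y * Y)
          eq₁ : ∀ x U n p s → 4 * (x * (U + n * (n * (p * 2)) + p * s * 2) * 2) ≡
            (8 * x) * U + (16 * (x * (p * n))) * n + 16 * (x * (p * s))
          eq₁ = solve-∀
          eq₂ : ∀ U n → n * U + U * n + U * n + U * n ≡ 4 * (U * n)
          eq₂ = solve-∀
          first : 8 * x ≤ n
          first = ≤-trans (*-mono-≤ (constant 3) box≤) (≤-trans (raise 817 995) n≥)
          second : 16 * (x * (p * n)) ≤ U
          second = ≤-trans (*-mono-≤ (constant 4) (times 816 6005 box≤ (times 5003 1002 p≤ n≤t))) (≤-trans (raise 6822 8955) U≥)
          third : 16 * (x * (p * s)) ≤ U * n
          third = ≤-trans (*-mono-≤ (constant 4) (times 816 5410 box≤ (times 5003 407 p≤ sucY²≤)))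
            (≤-trans (raise 6227 9950) (≤-trans (≤-reflexive (^-distribˡ-+-* t 8955 995)) (*-mono-≤ U≥ n≥)))

        -- After division by p the left side is at most t²⁰⁰¹³ with all constants included. The
        -- right side reaches t²⁰⁰⁹⁹, where 20099 = 4 · 5000 + 200 - 101 combines the gain from `h`
        -- with the losses of all codes.
        many-products : 2 ≤ p → U * n ≤ g + m * (m * (m * m)) * (U + n * (n * (p * 2)) + p * suc (Y * Y) * 2) →
          p * (p * (p * (p * p))) < (p ∸ 1) * (g * h) * (a * a)
        many-products 2≤p good-many = *-cancelˡ-< 1024 _ _ (begin-strict
          -- 1024 = 2 · 2 · 16² pays for p ≤ 2 (p - 1), for U n ≤ 2 g and for the constant 16 in
          -- each of the two factors |𝓐|.
          1024 * (p * (p * (p * (p * p))))       ≡⟨ eq₀ p ⟩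
          p * (1024 * (p * (p * (p * p))))       ≤⟨ *-monoʳ-≤ p (*-mono-≤ (constant 10) (times 5003 15009 p≤ (times 5003 10006 p≤ (times 5003 5003 p≤ p≤)))) ⟩
          p * t ^ 20013                          <⟨ *-monoʳ-< p {{>-nonZero (≤-trans (s≤s z≤n) 2≤p)}} (^-monoʳ-< t (≤-trans (constant 1) ≤-refl) {20013} {20099} (≤ᵇ⇒≤ 20014 20099 _)) ⟩
          p * t ^ 20099                          ≡⟨ cong (p *_) (trans (^-distribˡ-+-* t 9950 10149) (cong₂ _*_ (^-distribˡ-+-* t 8955 995) (trans (^-distribˡ-+-* t 199 9950) (cong (t ^ 199 *_) (^-distribˡ-+-* t 4975 4975))))) ⟩
          p * (t ^ 8955 * t ^ 995 * (t ^ 199 * (t ^ 4975 * t ^ 4975)))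
            ≤⟨ *-mono-≤ p≤2 (*-mono-≤ (≤-trans (*-mono-≤ U≥ n≥) Un≤) (*-mono-≤ h≥ (*-mono-≤ a≥ a≥))) ⟩
          ((p ∸ 1) + (p ∸ 1)) * ((g + g) * (h * (16 * a * (16 * a))))
            ≡⟨ eq₁ (p ∸ 1) g h a ⟩
          1024 * ((p ∸ 1) * (g * h) * (a * a))   ∎)
          where
          open ≤-Reasoning
          b = m * (m * (m * m)) * (U + n * (n * (p * 2)) + p * suc (Y * Y) * 2)
          eq₀ : ∀ p → 1024 * (p * (p * (p * (p * p)))) ≡ p * (1024 * (p * (p * (p * p))))
          eq₀ = solve-∀
          eq₁ : ∀ q g h a → (q + q) * ((g + g) * (h * (16 * a * (16 * a)))) ≡ 1024 * (q * (g * h) * (a * a))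
          eq₁ = solve-∀
          p≤2 : p ≤ (p ∸ 1) + (p ∸ 1)
          p≤2 = lemma p 2≤p
            where
            lemma : ∀ p → 2 ≤ p → p ≤ (p ∸ 1) + (p ∸ 1)
            lemma (suc (suc p)) _ = s≤s (m≤n+m (suc p) p)
            lemma (suc zero) (s≤s ())
          Un≤ : U * n ≤ g + g
          Un≤ = +-cancelʳ-≤ (b * 2) _ _ (begin
            U * n + b * 2            ≤⟨ +-monoʳ-≤ (U * n) few-bad ⟩
            U * n + U * n            ≤⟨ +-mono-≤ good-many good-many ⟩
            (g + b) + (g + b)        ≡⟨ eq₂ g b ⟩
            g + g + b * 2            ∎)
            where
            eq₂ : ∀ g b → (g + b) + (g + b) ≡ g + g + b * 2
            eq₂ = solve-∀

-- Choice of codes, the denominator divisible by p, and small primes.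

module Conclusion where

  open import Defs
  open FiniteSums
  open Residues
  open Words
  open Expansions
  open Planes
  open Conics
  open Products
  open CodeSizes
  open Estimates
  open import Data.Bool.Base using (T)
  open import Data.Empty using (⊥-elim)
  open import Data.Integer.Base as ℤ using (+_)
  open import Data.Integer.Divisibility.Signed as ℤ∣ using (∣⇒∣ᵤ)
  import Data.Integer.Tactic.RingSolver as ℤ
  import Data.Maybe.Relation.Unary.Any as Maybe
  open import Data.Nat.Base as ℕ hiding (_/_)
  open import Data.Nat.Coprimality using (Coprime; coprime⇒gcd≡1)
  open import Data.Nat.Divisibility using (_∣_; _∣?_; ∣-refl; ∣m⇒∣m*n; ∣m+n∣m⇒∣n; ∣1⇒≡1)
  open import Data.Nat.GCD using (gcd)
  open import Data.Nat.Properties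
  open import Data.Nat.Tactic.RingSolver using (solve-∀)
  open import Data.Rational.Base using (_/_)

  Zaremba : ℕ → ℕ → Set
  Zaremba k p = Σ[ q ∈ ℕ ] Σ[ a ∈ ℕ ] Σ[ q≢0 ∈ NonZero q ]
    0 < a × a < q × gcd a q ≡ 1 × p ∣ q × q ≤ 1 * p ^ 30 ×
    PartialQuotientsBoundedBy k (_/_ (+ a) q {{q≢0}})

  word-coprime : ∀ w → Coprime (B w) (D w)
  word-coprime w {d} (d∣B , d∣D) = ∣1⇒≡1 (∣m+n∣m⇒∣n
    (subst (d ∣_) (trans (*-comm (D w) (A w)) (trans (det w) (+-comm 1 (B w * C w)))) (∣m⇒∣m*n (A w) d∣D)) (∣m⇒∣m*n (C w) d∣B))

  B<D : ∀ {w} → All Positive w → B w < D w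
  B<D {w} pos = subst₂ _<_ C≡ D≡ (C<D (transpose-All {Positive} (All.map (λ (p , q) → q , p) pos)))
    where open Transposed (transpose-Transposed w)

  B>0 : ∀ {l w} → All Positive (l ∷ w) → 0 < B (l ∷ w)
  B>0 {l} {w} pos = n≢0⇒n>0 λ B≡0 → <⇒≢ (≤-<-trans (C>0 pos) (C<D pos))
    (sym (m*n≡1⇒n≡1 (A (l ∷ w)) (D (l ∷ w)) (trans (det (l ∷ w)) (cong (λ z → 1 + z * C (l ∷ w)) B≡0))))

  weaken : ∀ {k k′ x} → k ≤ k′ → PartialQuotientsBoundedBy k x → PartialQuotientsBoundedBy k′ x
  weaken k≤ (bs , regular , bs≤) = bs , regular , All.map (λ b≤ → ≤-trans b≤ k≤) bs≤

  -- The fraction 1 / p = [0; p] has denominator p itself.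
  small-prime : ∀ {k p} → Prime p → p ≤ k → Zaremba k p
  small-prime {k} {p} pp p≤k = p , 1 , p≢0 , s≤s z≤n , 2≤p , coprime⇒gcd≡1 {1} {p} (λ (d∣1 , _) → ∣1⇒≡1 d∣1) , ∣-refl , bound ,
    p ∷ [] , record { positive = p≢0 ∷ [] ; last≥2 = Maybe.just 2≤p
                    ; value = trans (congruence {1} {p} {p * 1 + 0} {{p≢0}} {{denominatorᶜ-nonZero (p≢0 ∷ [])}} (eq p)) (sym (⟦⟧-fraction (p≢0 ∷ []))) } , p≤k ∷ []
    where
    p≢0 = prime⇒nonZero pp
    2≤p : 2 ≤ p
    2≤p = nonTrivial⇒n>1 p {{prime⇒nonTrivial pp}}
    bound : p ≤ 1 * p ^ 30
    bound = begin
      p              ≡⟨ *-identityʳ p ⟨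
      p ^ 1          ≤⟨ ^-monoʳ-≤ p {{p≢0}} {1} {30} (s≤s z≤n) ⟩
      p ^ 30         ≡⟨ *-identityˡ (p ^ 30) ⟨
      1 * p ^ 30     ∎
      where open ≤-Reasoning
    congruence : ∀ {a q q′} .{{_ : NonZero q}} .{{_ : NonZero q′}} → q ≡ q′ → + a / q ≡ + a / q′
    congruence refl = refl
    eq : ∀ p → p ≡ p * 1 + 0
    eq = solve-∀

  -- The explicit first letter makes the numerator B positive, and the last letter (1 , 2) ends the
  -- expansion with 2, as regularity demands.
  word-Zaremba : ∀ {k p} l w v → All (Letter k) (l ∷ w ++ (v ++ [ 1 , 2 ])) →
    p ∣ D (l ∷ w ++ (v ++ [ 1 , 2 ])) → D (l ∷ w ++ (v ++ [ 1 , 2 ])) ≤ 1 * p ^ 30 → Zaremba k p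
  word-Zaremba {k} {p} l w v = subst (λ u → All (Letter k) u → p ∣ D u → D u ≤ 1 * p ^ 30 → Zaremba k p) (++-assoc (l ∷ w) v [ 1 , 2 ])
    λ letters p∣ q≤ →
      let pos = All.map Letter⇒Positive letters
          instance q≢0 = >-nonZero (D>0 pos)
      in D u , B u , q≢0 , B>0 pos , B<D pos , coprime⇒gcd≡1 (word-coprime u) , p∣ , q≤ ,
         word-continuedFraction (l ∷ w ++ v) 1 2 letters ≤-refl
    where
    u = (l ∷ w ++ v) ++ [ 1 , 2 ]

  bilinear : ∀ u x v → + D (u ++ (x ++ transpose v)) ≡
    + C u ℤ.* + C v ℤ.* + A x ℤ.+ + C u ℤ.* + D v ℤ.* + B x ℤ.+ + D u ℤ.* + C v ℤ.* + C x ℤ.+ + D u ℤ.* + D v ℤ.* + D x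
  bilinear u x v = begin
    + D (u ++ (x ++ t))                             ≡⟨ cong +_ (D-++ u (x ++ t)) ⟩
    + (C u * B (x ++ t) + D u * D (x ++ t))         ≡⟨ pos-dot (C u) (B (x ++ t)) (D u) (D (x ++ t)) ⟩
    + C u ℤ.* + B (x ++ t) ℤ.+ + D u ℤ.* + D (x ++ t)
      ≡⟨ cong₂ (λ y z → + C u ℤ.* y ℤ.+ + D u ℤ.* z)
          (trans (cong +_ (trans (B-++ x t) (cong₂ (λ y z → A x * y + B x * z) B≡ D≡))) (pos-dot (A x) (C v) (B x) (D v)))
          (trans (cong +_ (trans (D-++ x t) (cong₂ (λ y z → C x * y + D x * z) B≡ D≡))) (pos-dot (C x) (C v) (D x) (D v))) ⟩
    + C u ℤ.* (+ A x ℤ.* + C v ℤ.+ + B x ℤ.* + D v) ℤ.+ + D u ℤ.* (+ C x ℤ.* + C v ℤ.+ + D x ℤ.* + D v)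
      ≡⟨ ring (+ C u) (+ D u) (+ C v) (+ D v) (+ A x) (+ B x) (+ C x) (+ D x) ⟩
    + C u ℤ.* + C v ℤ.* + A x ℤ.+ + C u ℤ.* + D v ℤ.* + B x ℤ.+ + D u ℤ.* + C v ℤ.* + C x ℤ.+ + D u ℤ.* + D v ℤ.* + D x ∎
    where
    open ≡-Reasoning
    t = transpose v
    open Transposed (transpose-Transposed v)
    ring : ∀ c d e f x₁ x₂ x₃ x₄ → c ℤ.* (x₁ ℤ.* e ℤ.+ x₂ ℤ.* f) ℤ.+ d ℤ.* (x₃ ℤ.* e ℤ.+ x₄ ℤ.* f) ≡
      c ℤ.* e ℤ.* x₁ ℤ.+ c ℤ.* f ℤ.* x₂ ℤ.+ d ℤ.* e ℤ.* x₃ ℤ.+ d ℤ.* f ℤ.* x₄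
    ring = ℤ.solve-∀

  scale : ∀ b c n → 2 ≤ b → c ≤ n → 1 ≤ c → ∃ λ x → c * b ^ x ≤ n × n < c * b ^ suc x
  scale b c n 2≤b c≤n 1≤c = search n (begin-strict
    n             <⟨ exponential n ⟩
    2 ^ n         ≤⟨ ^-monoˡ-≤ n 2≤b ⟩
    b ^ n         ≤⟨ m≤n*m (b ^ n) c {{>-nonZero 1≤c}} ⟩
    c * b ^ n     ∎)
    where
    open ≤-Reasoning
    exponential : ∀ n → n < 2 ^ n
    exponential zero    = s≤s z≤n
    exponential (suc n) = ≤-trans (+-mono-≤ (m^n>0 2 n) (exponential n)) (≤-reflexive (cong (λ z → 2 ^ n + z) (sym (+-identityʳ (2 ^ n)))))
    search : ∀ y → n < c * b ^ y → ∃ λ x → c * b ^ x ≤ n × n < c * b ^ suc x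
    search zero    h = contradiction (≤-trans h (≤-reflexive (*-identityʳ c))) (≤⇒≯ c≤n)
    search (suc y) h with c * b ^ y ≤? n
    ... | yes p = y , p , h
    ... | no ¬p = search y (≰⇒> ¬p)

  -- A step multiplies a denominator by less than (k + 1)² ≤ κ.  A prime p is located between r t⁵⁰⁰⁰ and r b t⁵⁰⁰⁰
  -- for a power t of 2, and b = 2⁵⁰⁰⁰ is the gap between consecutive values of t⁵⁰⁰⁰.
  module Primes (k κ r b : ℕ) (2≤k : 2 ≤ k) (base : (k + 2) ^ (100 + 100) ≤ 2 * k ^ (100 + 100))
    (κ≥ : suc k * suc k ≤ κ) (κ≤ : κ ≤ 2 ^ 2048) (r≥ : 2 ^ 10 * (κ * κ) ≤ r) (κ≤r : κ ≤ r) (2≤r : 2 ≤ r) (2≤b : 2 ≤ b)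
    (rb≤ : r * b ≤ (2 ^ 2048) ^ 3) (b^ : ∀ x → b ^ x ≡ (2 ^ x) ^ 5000) where

   1≤k : 1 ≤ k
   1≤k = ≤-trans (s≤s z≤n) 2≤k

   4≤κ : 4 ≤ suc k * suc k
   4≤κ = *-mono-≤ {2} {suc k} {2} {suc k} (s≤s 1≤k) (s≤s 1≤k)

   module Large {p : ℕ} (pp : Prime p) (t x : ℕ) (t≡2^x : t ≡ 2 ^ x) (x-large : 2048 ≤ x)
    (p≥ : r * t ^ 5000 ≤ p) (p< : p < r * b * t ^ 5000) where

    open CodeSizes.Codes k 100 1≤k base t x t≡2^x

    t-large : 2 ^ 2048 ≤ t
    t-large = ≤-trans (^-monoʳ-≤ 2 x-large) (≤-reflexive (sym t≡2^x))

    open Powers t t-large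

    instance
      t≢0 : NonZero t
      t≢0 = >-nonZero (≤-trans (m^n>0 2 2048) t-large)
      p≢0 : NonZero p
      p≢0 = prime⇒nonZero pp

    2≤p : 2 ≤ p
    2≤p = nonTrivial⇒n>1 p {{prime⇒nonTrivial pp}}

    -- The denominators reach p / 2 on 𝓤 𝓓 and √p on 𝓐.  The factor 𝓗, of size p ^ (1/50), lifts the
    -- number of products above p², which outweighs the losses from bounding the letters.
    𝓤 𝓓 𝓗 𝓐 : List Word
    𝓤 = code 4500 (0 , 1)
    𝓓 = code 500 (0 , 1)
    𝓗 = code 100 (0 , 1)
    -- The letter (2 , 1) takes the row (0 , 1) to (2 , 3), where the code starts. In the transposed
    -- right-hand word it becomes the final letter (1 , 2), so the last partial quotient is 2.
    𝓐 = map ((2 , 1) ∷_) (code 2500 (2 , 3))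

    D𝓤 : ∀ {w} → w ∈ 𝓤 → D w < κ * t ^ 4500
    D𝓤 i = code-D< κ≥ 4≤κ 4500 i z≤n (s≤s z≤n)
    D𝓓 : ∀ {w} → w ∈ 𝓓 → D w < κ * t ^ 500
    D𝓓 i = code-D< κ≥ 4≤κ 500 i z≤n (s≤s z≤n)
    D𝓗 : ∀ {w} → w ∈ 𝓗 → D w < κ * t ^ 100
    D𝓗 i = code-D< κ≥ 4≤κ 100 i z≤n (s≤s z≤n)

    pos𝓤 : ∀ {w} → w ∈ 𝓤 → All Positive w
    pos𝓤 = code-positive {4500}
    pos𝓓 : ∀ {w} → w ∈ 𝓓 → All Positive w
    pos𝓓 = code-positive {500}
    pos𝓗 : ∀ {w} → w ∈ 𝓗 → All Positive w
    pos𝓗 = code-positive {100}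

    𝓐-letters : ∀ {w} → w ∈ 𝓐 → All (Letter k) w
    𝓐-letters i with ∈-map⁻ ((2 , 1) ∷_) i
    ... | v , v∈ , refl = ((s≤s z≤n , 2≤k) , (s≤s z≤n , 1≤k)) ∷ code-Letters {2500} v∈

    pos𝓐 : ∀ {w} → w ∈ 𝓐 → All Positive w
    pos𝓐 i = All.map Letter⇒Positive (𝓐-letters i)

    D𝓐 : ∀ {w} → w ∈ 𝓐 → D w < κ * t ^ 2500
    D𝓐 i with ∈-map⁻ ((2 , 1) ∷_) i
    ... | v , v∈ , refl = code-D< κ≥ 4≤κ 2500 v∈ (s≤s (s≤s z≤n)) ≤-refl

    𝓐-unique : Unique 𝓐
    𝓐-unique = Unique.map⁺ ∷-injectiveʳ (code-unique 2500 (2 , 3))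

    below-p : ∀ a → {_ : T (a ≤ᵇ 5000)} → r * t ^ a ≤ p
    below-p a {h} = ≤-trans (*-monoʳ-≤ r (raise a 5000 {h})) p≥

    length𝓤 : t ^ 8955 ≤ length 𝓤
    length𝓤 = *-cancelʳ-≤ (t ^ 8955) (length 𝓤) (t ^ 45) {{m^n≢0 t 45}} (begin
      t ^ 8955 * t ^ 45                   ≡⟨ ^-distribˡ-+-* t 8955 45 ⟨
      t ^ 9000                            ≡⟨ ^-distribˡ-+-* t 4500 4500 ⟩
      t ^ 4500 * t ^ 4500                 ≤⟨ length-code 4500 45 refl 0 1 (s≤s z≤n) z≤n ⟩
      length 𝓤 * 1 * t ^ 45               ≡⟨ cong (_* t ^ 45) (*-identityʳ (length 𝓤)) ⟩
      length 𝓤 * t ^ 45                   ∎)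
      where open ≤-Reasoning

    length𝓓 : t ^ 995 ≤ length 𝓓
    length𝓓 = *-cancelʳ-≤ (t ^ 995) (length 𝓓) (t ^ 5) {{m^n≢0 t 5}} (begin
      t ^ 995 * t ^ 5                     ≡⟨ ^-distribˡ-+-* t 995 5 ⟨
      t ^ 1000                            ≡⟨ ^-distribˡ-+-* t 500 500 ⟩
      t ^ 500 * t ^ 500                   ≤⟨ length-code 500 5 refl 0 1 (s≤s z≤n) z≤n ⟩
      length 𝓓 * 1 * t ^ 5                ≡⟨ cong (_* t ^ 5) (*-identityʳ (length 𝓓)) ⟩
      length 𝓓 * t ^ 5                    ∎)
      where open ≤-Reasoning

    length𝓗 : t ^ 199 ≤ length 𝓗
    length𝓗 = *-cancelʳ-≤ (t ^ 199) (length 𝓗) (t ^ 1) {{m^n≢0 t 1}} (begin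
      t ^ 199 * t ^ 1                     ≡⟨ ^-distribˡ-+-* t 199 1 ⟨
      t ^ 200                             ≡⟨ ^-distribˡ-+-* t 100 100 ⟩
      t ^ 100 * t ^ 100                   ≤⟨ length-code 100 1 refl 0 1 (s≤s z≤n) z≤n ⟩
      length 𝓗 * 1 * t ^ 1                ≡⟨ cong (_* t ^ 1) (*-identityʳ (length 𝓗)) ⟩
      length 𝓗 * t ^ 1                    ∎)
      where open ≤-Reasoning

    length𝓐 : t ^ 4975 ≤ 16 * length 𝓐
    length𝓐 = ≤-trans (*-cancelʳ-≤ (t ^ 4975) (length W * 15) (t ^ 25) {{m^n≢0 t 25}} (begin
      t ^ 4975 * t ^ 25                   ≡⟨ ^-distribˡ-+-* t 4975 25 ⟨
      t ^ 5000                            ≡⟨ ^-distribˡ-+-* t 2500 2500 ⟩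
      -- 15 = 3 (3 + 2) is the weight d (d + c) of the starting row (2 , 3).
      t ^ 2500 * t ^ 2500                 ≤⟨ length-code 2500 25 refl 2 3 (s≤s z≤n) (s≤s (s≤s z≤n)) ⟩
      length W * 15 * t ^ 25              ∎)) (begin
      length W * 15                       ≤⟨ *-monoʳ-≤ (length W) (≤ᵇ⇒≤ 15 16 _) ⟩
      length W * 16                       ≡⟨ *-comm (length W) 16 ⟩
      16 * length W                       ≡⟨ cong (16 *_) (length-map ((2 , 1) ∷_) W) ⟨
      16 * length 𝓐                       ∎)
      where
      open ≤-Reasoning
      W = code 2500 (2 , 3)

    H Y : ℕ
    H = κ * t ^ 100
    Y = 2 * (2 * H * H)

    1≤H : 1 ≤ H
    1≤H = *-mono-≤ (≤-trans (s≤s z≤n) (≤-trans 4≤κ κ≥)) (m^n>0 t 100)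

    1≤Y : 1 ≤ Y
    1≤Y = *-mono-≤ {1} {2} (s≤s z≤n) (*-mono-≤ {1} {2 * H} (*-mono-≤ {1} {2} (s≤s z≤n) 1≤H) 1≤H)

    length𝓓≤ : length 𝓓 ≤ (κ * t ^ 500) * (κ * t ^ 500)
    length𝓓≤ = length-words (code-unique 500 (0 , 1)) pos𝓓 D𝓓

    κ≤t : κ ≤ t
    κ≤t = ≤-trans κ≤ t-large

    R≤t³ : r * b ≤ t ^ 3
    R≤t³ = ≤-trans rb≤ (^-monoˡ-≤ 3 t-large)

    Y≤t : Y ≤ t ^ 203
    Y≤t = Y≤ {a = length 𝓐} {g = 0} κ≤t R≤t³ p< length𝓤 length𝓓 length𝓓≤ length𝓗 length𝓐 refl refl

    t≤p : ∀ a → {_ : T (a ≤ᵇ 5000)} → t ^ a < p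
    t≤p a {h} = <-≤-trans (m<m*n (t ^ a) r {{m^n≢0 t a}} 2≤r) (≤-trans (≤-reflexive (*-comm (t ^ a) r)) (below-p a {h}))

    Y-small : 2 * (Y * Y) < p
    Y-small = ≤-<-trans (*-mono-≤ (constant 1) (times 203 203 Y≤t Y≤t)) (t≤p 407)

    -- `r` absorbs the overshoot κ of both codes together with the factor 4, which pays for one
    -- concatenation and for the factor 2 in `𝓖-half`.
    product< : ∀ a b {w v} → {_ : T (a + b ≤ᵇ 5000)} → w < κ * t ^ a → v < κ * t ^ b → 4 * (w * v) ≤ p
    product< a b {w} {v} {h} w< v< = begin
      4 * (w * v)                                  ≤⟨ *-mono-≤ {4} {2 ^ 10} (≤ᵇ⇒≤ 4 (2 ^ 10) _) (*-mono-≤ (<⇒≤ w<) (<⇒≤ v<)) ⟩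
      2 ^ 10 * (κ * t ^ a * (κ * t ^ b))           ≡⟨ eq (2 ^ 10) κ (t ^ a) (t ^ b) ⟩
      2 ^ 10 * (κ * κ) * (t ^ a * t ^ b)           ≤⟨ *-monoˡ-≤ (t ^ a * t ^ b) r≥ ⟩
      r * (t ^ a * t ^ b)                          ≡⟨ cong (r *_) (^-distribˡ-+-* t a b) ⟨
      r * t ^ (a + b)                              ≤⟨ below-p (a + b) {h} ⟩
      p                                            ∎
      where
      open ≤-Reasoning
      eq : ∀ r s u v → r * (s * u * (s * v)) ≡ r * (s * s) * (u * v)
      eq = solve-∀

    <p : ∀ {n} → 0 < n → 4 * n ≤ p → n < p
    <p {n} n>0 h = <-≤-trans (m<m+n n (≤-trans n>0 (m≤m+n n _))) h

    𝓐-small : ∀ {w v} → w ∈ 𝓐 → v ∈ 𝓐 → D w * D v < p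
    𝓐-small i j = <p (*-mono-≤ (D>0 (pos𝓐 i)) (D>0 (pos𝓐 j))) (product< 2500 2500 (D𝓐 i) (D𝓐 j))

    𝓐<p : ∀ {w} → w ∈ 𝓐 → D w < p
    𝓐<p {w} i = ≤-<-trans (m≤m*n (D w) (D w) {{>-nonZero (D>0 (pos𝓐 i))}}) (𝓐-small i i)

    𝓓-small : ∀ {w v} → w ∈ 𝓓 → v ∈ 𝓓 → D w * D v < p
    𝓓-small i j = <p (*-mono-≤ (D>0 (pos𝓓 i)) (D>0 (pos𝓓 j))) (product< 500 500 (D𝓓 i) (D𝓓 j))

    𝓖-quarter : ∀ {w v} → w ∈ 𝓤 → v ∈ 𝓓 → 4 * (D w * D v) ≤ p
    𝓖-quarter i j = product< 4500 500 (D𝓤 i) (D𝓓 j)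

    𝓖-half : ∀ {w v} → w ∈ 𝓤 → v ∈ 𝓓 → 2 * D (w ++ v) ≤ p
    𝓖-half {w} {v} i j = begin
      2 * D (w ++ v)          ≤⟨ *-monoʳ-≤ 2 (D-++-≤ (pos𝓤 i) (pos𝓓 j)) ⟩
      2 * (2 * (D w * D v))   ≡⟨ *-assoc 2 2 (D w * D v) ⟨
      4 * (D w * D v)         ≤⟨ 𝓖-quarter i j ⟩
      p                       ∎
      where open ≤-Reasoning

    𝓖-small : ∀ {w v} → w ∈ 𝓤 → v ∈ 𝓓 → D (w ++ v) < p
    𝓖-small {w} {v} i j = <-≤-trans (m<m+n (D (w ++ v)) (≤-trans (D>0 (All.++⁺ (pos𝓤 i) (pos𝓓 j))) (m≤m+n _ 0))) (𝓖-half i j)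

    𝓤-small : ∀ {w} → w ∈ 𝓤 → D w < p
    𝓤-small {w} i = <-≤-trans (D𝓤 i) (≤-trans (*-monoˡ-≤ (t ^ 4500) κ≤r) (below-p 4500))

    open Products.GoodPairs pp 𝓤 𝓓 (code-unique 4500 (0 , 1)) (code-unique 500 (0 , 1)) pos𝓤 pos𝓓
      (code-prefix {4500}) (code-prefix {500}) Y 1≤Y Y-small 𝓤-small 𝓓-small 𝓖-small
    open Multiples (code-unique 100 (0 , 1)) pos𝓗 H (λ i → <⇒≤ (D𝓗 i)) refl 𝓖-half

    p⁵< : p * (p * (p * (p * p))) < (p ∸ 1) * length products * (length 𝓐 * length 𝓐)
    p⁵< = subst (λ z → p * (p * (p * (p * p))) < (p ∸ 1) * z * (length 𝓐 * length 𝓐)) (sym (length-cartesianProduct good 𝓗))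
      (many-products {U = length 𝓤} {n = length 𝓓} {h = length 𝓗} {a = length 𝓐} {Y = Y} {g = length good} κ≤t R≤t³ p< length𝓤 length𝓓 length𝓓≤ length𝓗 length𝓐 refl refl 1≤Y 2≤p
        (subst (λ b → length 𝓤 * length 𝓓 ≤ length good + b * bad-bound) (length-box Y) good-many))

    Triple : Set
    Triple = Word × ((Word × Word) × Word) × Word

    whole : Triple → Word
    whole (u , j , v) = u ++ (product j ++ transpose v)

    triples : List Triple
    triples = cartesianProduct 𝓐 (cartesianProduct products 𝓐)

    triples∈ : ∀ {y} → y ∈ triples → proj₁ y ∈ 𝓐 × proj₁ (proj₂ y) ∈ products × proj₂ (proj₂ y) ∈ 𝓐
    triples∈ i = proj₁ split , ∈-cartesianProduct⁻ products 𝓐 (proj₂ split)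
      where split = ∈-cartesianProduct⁻ 𝓐 (cartesianProduct products 𝓐) i

    -- By `bilinear`, D of a whole word is the value at the product of the tensor of two bottom
    -- rows. If it never vanished modulo p, all products would avoid all hyperplanes, and the
    -- incidence bound would contradict `p⁵<`.
    incidence : ¬ (∀ {y} → y ∈ triples → ¬ p ∣ D (whole y))
    incidence none = <⇒≱ p⁵< (Incidence.incidence-bound pp _≟ʷ_ 𝓐-unique (λ w → + C w) (λ w → + D w)
        (λ {w} i → small-∤ pp (𝓐<p i) (λ e → <⇒≢ (D>0 (pos𝓐 i)) (sym (ℤ.+-injective e))))
        (λ i j → fractions-distinct pp (pos𝓐 i) (pos𝓐 j) (𝓐-small i j))
        products-unique (λ j → matrix (product j))
        (λ l l′ i j → projectively-distinct i j l l′)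
        (λ {j} z _ h₁ h₂ h₃ h₄ → invertible (+ A (product j)) (+ B (product j)) (+ C (product j)) (+ D (product j)) z (det-matrix (product j)) h₁ h₂ h₃ h₄)
        (λ {u} {v} {j} u∈ v∈ j∈ h → none (∈-cartesianProduct⁺ u∈ (∈-cartesianProduct⁺ j∈ v∈))
          (∣⇒∣ᵤ (∣-resp (sym (bilinear u (product j) v)) h))))
      where
      invertible : ∀ a b c d z → a ℤ.* d ℤ.- b ℤ.* c ≡ ℤ.1ℤ → + p ℤ∣.∣ a ℤ.* z → + p ℤ∣.∣ b ℤ.* z → + p ℤ∣.∣ c ℤ.* z → + p ℤ∣.∣ d ℤ.* z → + p ℤ∣.∣ z
      invertible a b c d z e h₁ h₂ _ _ = ∣-resp (trans (ring a b c d z) (trans (cong (ℤ._* z) e) (ℤ.*-identityˡ z))) (∣-combination d (ℤ.- c) h₁ h₂)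
        where
        ring : ∀ a b c d z → d ℤ.* (a ℤ.* z) ℤ.+ (ℤ.- c) ℤ.* (b ℤ.* z) ≡ (a ℤ.* d ℤ.- b ℤ.* c) ℤ.* z
        ring = ℤ.solve-∀

    H≤p : H ≤ p
    H≤p = ≤-trans (*-monoˡ-≤ (t ^ 100) κ≤r) (below-p 100)

    zaremba-from : ∀ y → y ∈ triples → p ∣ D (whole y) → Zaremba k p
    zaremba-from (u , j , v) i p∣ = conclude (∈-map⁻ ((2 , 1) ∷_) u∈) (∈-map⁻ ((2 , 1) ∷_) v∈)
      where
      u∈ = proj₁ (triples∈ i)
      j∈ = proj₁ (proj₂ (triples∈ i))
      v∈ = proj₂ (proj₂ (triples∈ i))
      j-letters : All (Letter k) (product j)
      j-letters = All.++⁺ (All.++⁺ (code-Letters {4500} (proj₁ (𝓖∈ x∈))) (code-Letters {500} (proj₂ (𝓖∈ x∈)))) (code-Letters {100} (proj₂ (proj₂ (products∈ j∈))))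
        where x∈ = proj₁ (products∈ j∈)
      v-letters : All (Letter k) (transpose v)
      v-letters = transpose-All (All.map (λ (a , b) → b , a) (𝓐-letters v∈))
      letters : All (Letter k) (whole (u , j , v))
      letters = All.++⁺ (𝓐-letters u∈) (All.++⁺ j-letters v-letters)
      -- The outer words contribute p each, the product p H ≤ p², and the two concatenations a
      -- factor 2 ≤ p each, p⁶ in all.
      D-bound : D (whole (u , j , v)) ≤ 1 * p ^ 30
      D-bound = begin
        D (u ++ (product j ++ transpose v))
          ≤⟨ D-++-≤ (pos𝓐 u∈) (All.++⁺ (product-positive j∈) (All.map Letter⇒Positive v-letters)) ⟩
        2 * (D u * D (product j ++ transpose v))
          ≤⟨ *-monoʳ-≤ 2 (*-mono-≤ (<⇒≤ (𝓐<p u∈)) (D-++-≤ (product-positive j∈) (All.map Letter⇒Positive v-letters))) ⟩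
        2 * (p * (2 * (D (product j) * D (transpose v))))
          ≤⟨ *-monoʳ-≤ 2 (*-monoʳ-≤ p (*-monoʳ-≤ 2 (*-mono-≤ (≤-trans (product-small j∈) (*-monoʳ-≤ p H≤p))
               (≤-trans (≤-reflexive (Transposed.D≡ (transpose-Transposed v))) (<⇒≤ (𝓐<p v∈)))))) ⟩
        2 * (p * (2 * (p * p * p)))
          ≤⟨ *-mono-≤ 2≤p (*-monoʳ-≤ p (*-monoˡ-≤ (p * p * p) 2≤p)) ⟩
        p * (p * (p * (p * p * p)))  ≡⟨ eq p ⟩
        p ^ 6                        ≤⟨ ^-monoʳ-≤ p {6} {30} (≤ᵇ⇒≤ 6 30 _) ⟩
        p ^ 30                       ≡⟨ *-identityˡ (p ^ 30) ⟨
        1 * p ^ 30                   ∎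
        where
        open ≤-Reasoning
        eq : ∀ p → p * (p * (p * (p * p * p))) ≡ p * (p * (p * (p * (p * (p * 1)))))
        eq = solve-∀
      conclude : (∃ λ u′ → u′ ∈ code 2500 (2 , 3) × u ≡ (2 , 1) ∷ u′) → (∃ λ v′ → v′ ∈ code 2500 (2 , 3) × v ≡ (2 , 1) ∷ v′) → Zaremba k p
      conclude (u′ , _ , refl) (v′ , _ , refl) = word-Zaremba (2 , 1) u′ (product j ++ transpose v′)
        (subst (All (Letter k)) shape letters) (subst (λ w → p ∣ D w) shape p∣) (subst (λ w → D w ≤ 1 * p ^ 30) shape D-bound)
        where
        shape : whole ((2 , 1) ∷ u′ , j , (2 , 1) ∷ v′) ≡ (2 , 1) ∷ u′ ++ ((product j ++ transpose v′) ++ [ 1 , 2 ])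
        shape = cong (λ z → (2 , 1) ∷ u′ ++ z) (trans (cong (product j ++_) (transpose-∷ (2 , 1) v′)) (sym (++-assoc (product j) (transpose v′) [ 1 , 2 ])))

    Divisible : Triple → Set
    Divisible y = p ∣ D (whole y)

    opaque
      divisible? : Dec (Any Divisible triples)
      divisible? = any? (λ y → p ∣? D (whole y)) triples

    large-prime : Zaremba k p
    large-prime = cases divisible?
      where
      found : (∃ λ y → y ∈ triples × Divisible y) → Zaremba k p
      found (y , y∈ , p∣) = zaremba-from y y∈ p∣
      cases : Dec (Any Divisible triples) → Zaremba k p
      cases (yes h) = found (find h)
      cases (no n)  = ⊥-elim (incidence λ y∈ p∣ → n (lose {P = Divisible} y∈ p∣))

   -- Above it the scale t = 2ˣ has x ≥ 2048, as the estimates require. The finitely many smaller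
   -- primes only raise the bound on the partial quotients, to k + `threshold`.
   threshold : ℕ
   threshold = r * b ^ 2048

   every-prime : ∀ p → Prime p → Zaremba (k + threshold) p
   every-prime p pp = cases (p ≤? threshold)
    where
    large : threshold < p → (∃ λ x → r * b ^ x ≤ p × p < r * b ^ suc x) → Zaremba k p
    large p> (x , lower , upper) = Large.large-prime pp (2 ^ x) x refl x-large
      (subst (λ z → r * z ≤ p) (b^ x) lower)
      (<-≤-trans upper (≤-reflexive (trans (sym (*-assoc r b (b ^ x))) (cong (r * b *_) (b^ x)))))
      where
      x-large : 2048 ≤ x
      x-large = ≮⇒≥ λ x<2048 → <⇒≱ (<-trans p> upper) (*-monoʳ-≤ r (^-monoʳ-≤ b {{>-nonZero (≤-trans (s≤s z≤n) 2≤b)}} x<2048))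
    weaken-Zaremba : Zaremba k p → Zaremba (k + threshold) p
    weaken-Zaremba (q , a , q≢0 , h₁ , h₂ , h₃ , h₄ , h₅ , h) = q , a , q≢0 , h₁ , h₂ , h₃ , h₄ , h₅ , weaken (m≤m+n k threshold) h
    cases : Dec (p ≤ threshold) → Zaremba (k + threshold) p
    cases (yes p≤) = small-prime pp (≤-trans p≤ (m≤n+m threshold k))
    cases (no p≰)  = weaken-Zaremba (large p> (scale b r p 2≤b
      (≤-trans (m≤m*n r (b ^ 2048) {{m^n≢0 b 2048 {{>-nonZero (≤-trans (s≤s z≤n) 2≤b)}}}}) (<⇒≤ p>)) (≤-trans (s≤s z≤n) 2≤r)))
      where p> = ≰⇒> p≰

   solution : Σ[ k ∈ ℕ ] 0 < k × (∀ p → Prime p → Zaremba k p)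
   solution = k + threshold , ≤-trans 1≤k (m≤m+n k threshold) , every-prime

  -- k = 800 makes the loss ((k + 2) / k)²⁰⁰ at most 2, and κ = 2²⁰ exceeds (k + 1)².
  opaque
    parameters : Σ[ k ∈ ℕ ] 0 < k × (∀ p → Prime p → Zaremba k p)
    parameters = Primes.solution 800 (2 ^ 20) (2 ^ 50) (2 ^ 5000)
      (≤ᵇ⇒≤ 2 800 _) (≤ᵇ⇒≤ (802 ^ 200) (2 * 800 ^ 200) _) (≤ᵇ⇒≤ (801 * 801) (2 ^ 20) _)
      (^-monoʳ-≤ 2 (≤ᵇ⇒≤ 20 2048 _)) (≤ᵇ⇒≤ (2 ^ 10 * (2 ^ 20 * 2 ^ 20)) (2 ^ 50) _) (≤ᵇ⇒≤ (2 ^ 20) (2 ^ 50) _)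
      (≤ᵇ⇒≤ 2 (2 ^ 50) _) (≤ᵇ⇒≤ 2 (2 ^ 5000) _) (≤ᵇ⇒≤ (2 ^ 50 * 2 ^ 5000) ((2 ^ 2048) ^ 3) _)
      (λ x → trans (^-*-assoc 2 5000 x) (trans (cong (2 ^_) (*-comm 5000 x)) (sym (^-*-assoc 2 x 5000))))

open import Defs
open import Data.Integer.Base using (+_)
open import Data.Nat.Base using (ℕ; NonZero; _*_; _^_; _≤_; _<_; s≤s; z≤n)
open import Data.Nat.Divisibility using (_∣_)
open import Data.Nat.GCD using (gcd)
open import Data.Rational.Base using (_/_)
open Conclusion using (parameters)

theorem1 : Σ[ k ∈ ℕ ] Σ[ C₀ ∈ ℕ ] 0 < k × 0 < C₀ × (∀ (p : ℕ) → Prime p →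
    Σ[ q ∈ ℕ ] Σ[ a ∈ ℕ ] Σ[ q≢0 ∈ NonZero q ]
    0 < a × a < q × gcd a q ≡ 1 × p ∣ q × q ≤ C₀ * p ^ 30 ×
    PartialQuotientsBoundedBy k (_/_ (+ a) q {{q≢0}}))
theorem1 = proj₁ parameters , 1 , proj₁ (proj₂ parameters) , s≤s z≤n , proj₂ (proj₂ parameters)
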